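{- Let $q,z$ be complex numbers with $0<|q|<1$, $z\neq 0$, and $z\ne q^{m}$ for every integer $m$. Then $$(1-z)(zq, z^{ -1}q,q;q)_{\infty}\,g_2(z;q)=\sum_{n=0}^{\infty}\left(\sum_{m=0}^{[n/2]}(-1)^{m+n}z^{n-2m}q^{\frac{1}{2}(n^2-2m^2)+\frac{1}{2}n}+\sum_{m=1}^{[n/2]}(-1)^{m+n}z^{2m-n-1}q^{\frac{1}{2}(n^2-2m^2)+\frac{1}{2}n}\right).$$
   Context: Notation: $(a;q)_\infty=\prod_{n=0}^\infty(1-aq^n)$, $(a;q)_n=\dfrac{(a;q)_\infty}{(aq^n;q)_\infty}$ (so $(a;q)_n=\prod_{i=0}^{n-1}(1-aq^i)$ for $n\ge 0$), and $(a_1,\ldots,a_k;q)_\infty=(a_1;q)_\infty\cdots(a_k;q)_\infty$. $[x]$ denotes the integer part (floor) of $x$. Empty sums are $0$. The universal mock theta function $g_2$ is $$g_2(z;q)=\sum_{n=0}^{\infty}\frac{(-q;q)_n\,q^{\frac{1}{2}n(n+1)}}{(z;q)_{n+1}(z^{ -1}q;q)_{n+1}}.$$ -}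

module Defs where

open import Algebra.Bundles.Raw using (RawRing)
import Algebra.Definitions.RawSemiring as RawSemiringDefs
open import Data.Fin.Base using (toℕ)
open import Data.Integer.Base as ℤ using (ℤ; +_; -[1+_]; _⊖_)
open import Data.Nat.Base as ℕ using (ℕ; zero; suc)
import Data.Nat.DivMod as ℕ
import Data.Nat.Properties as ℕ
open import Data.Product.Base using (Σ-syntax; ∃-syntax; _×_; _,_)
open import Data.Rational.Base as ℚ using (ℚ; 0ℚ; 1ℚ; ½)
import Data.Rational.Properties as ℚ
open import Data.Rational.Solver using (module +-*-Solver)
open import Level using (0ℓ)
open import Relation.Binary.PropositionalEquality
  using (_≡_; refl; sym; trans; cong; cong₂; subst; module ≡-Reasoning)
open import Relation.Nullary using (yes; no; contradiction)

-- Real numbers are Cauchy sequences of rationals, compared by the setoid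
-- equality _≃ᴿ_; the field operations act termwise.

Eventually : (ℕ → Set) → Set
Eventually P = ∃[ N ] (∀ n → N ℕ.≤ n → P n)

IsCauchy : (ℕ → ℚ) → Set
IsCauchy s = ∀ ε → 0ℚ ℚ.< ε →
  ∃[ N ] (∀ m n → N ℕ.≤ m → N ℕ.≤ n → ℚ.∣ s m ℚ.- s n ∣ ℚ.< ε)

record ℝ : Set where
  constructor mkℝ
  field
    seq    : ℕ → ℚ
    cauchy : IsCauchy seq

open ℝ public

infix 4 _≃ᴿ_ _<ᴿ_

_≃ᴿ_ : ℝ → ℝ → Set
x ≃ᴿ y = ∀ ε → 0ℚ ℚ.< ε → Eventually (λ n → ℚ.∣ seq x n ℚ.- seq y n ∣ ℚ.< ε)

_<ᴿ_ : ℝ → ℝ → Set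
x <ᴿ y = ∃[ ε ] 0ℚ ℚ.< ε × Eventually (λ n → seq x n ℚ.+ ε ℚ.< seq y n)

½-pos : ∀ {ε} → 0ℚ ℚ.< ε → 0ℚ ℚ.< ½ ℚ.* ε
½-pos = ℚ.*-monoʳ-<-pos ½

½+½ : ∀ ε → ½ ℚ.* ε ℚ.+ ½ ℚ.* ε ≡ ε
½+½ ε = trans (sym (ℚ.*-distribʳ-+ ε ½ ½)) (ℚ.*-identityˡ ε)

quotient : ∀ B ε → 0ℚ ℚ.< B → 0ℚ ℚ.< ε → ∃[ δ ] 0ℚ ℚ.< δ × B ℚ.* δ ≡ ε
quotient B ε 0<B 0<ε =
  1/B ℚ.* ε
  , subst (ℚ._< 1/B ℚ.* ε) (ℚ.*-zeroʳ 1/B) (ℚ.*-monoʳ-<-pos 1/B 0<ε)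
  , trans (sym (ℚ.*-assoc B 1/B ε))
      (trans (cong (ℚ._* ε) (ℚ.*-inverseʳ B)) (ℚ.*-identityˡ ε))
  where
  instance
    B-pos : ℚ.Positive B
    B-pos = ℚ.positive 0<B
    B-nonZero : ℚ.NonZero B
    B-nonZero = ℚ.pos⇒nonZero B
  1/B : ℚ
  1/B = ℚ.1/ B
  instance
    1/B-pos : ℚ.Positive 1/B
    1/B-pos = ℚ.1/pos⇒pos B

const-cauchy : ∀ p → IsCauchy (λ _ → p)
const-cauchy p ε 0<ε =
  0 , λ _ _ _ _ → subst (ℚ._< ε) (sym (cong ℚ.∣_∣ (ℚ.+-inverseʳ p))) 0<ε

neg-cauchy : ∀ {s} → IsCauchy s → IsCauchy (λ n → ℚ.- s n)
neg-cauchy {s} cs ε 0<ε with cs ε 0<ε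
... | N , h = N , λ m n N≤m N≤n → subst (ℚ._< ε) (sym (eq m n)) (h m n N≤m N≤n)
  where
  eq : ∀ m n → ℚ.∣ (ℚ.- s m) ℚ.- (ℚ.- s n) ∣ ≡ ℚ.∣ s m ℚ.- s n ∣
  eq m n = trans (cong ℚ.∣_∣ (sym (ℚ.neg-distrib-+ (s m) (ℚ.- s n))))
                 (ℚ.∣-p∣≡∣p∣ (s m ℚ.- s n))

+-cauchy : ∀ {s t} → IsCauchy s → IsCauchy t → IsCauchy (λ n → s n ℚ.+ t n)
+-cauchy {s} {t} cs ct ε 0<ε
  with cs (½ ℚ.* ε) (½-pos 0<ε) | ct (½ ℚ.* ε) (½-pos 0<ε)
... | M , hs | N , ht = M ℕ.⊔ N , bound
  where
  open ℚ.≤-Reasoning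
  open +-*-Solver
  bound : ∀ m n → M ℕ.⊔ N ℕ.≤ m → M ℕ.⊔ N ℕ.≤ n →
          ℚ.∣ (s m ℚ.+ t m) ℚ.- (s n ℚ.+ t n) ∣ ℚ.< ε
  bound m n h k = begin-strict
    ℚ.∣ (s m ℚ.+ t m) ℚ.- (s n ℚ.+ t n) ∣
      ≡⟨ cong ℚ.∣_∣ (solve 4 (λ a b c d → (a :+ b) :- (c :+ d) := (a :- c) :+ (b :- d))
           refl (s m) (t m) (s n) (t n)) ⟩
    ℚ.∣ (s m ℚ.- s n) ℚ.+ (t m ℚ.- t n) ∣
      ≤⟨ ℚ.∣p+q∣≤∣p∣+∣q∣ (s m ℚ.- s n) (t m ℚ.- t n) ⟩
    ℚ.∣ s m ℚ.- s n ∣ ℚ.+ ℚ.∣ t m ℚ.- t n ∣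
      <⟨ ℚ.+-mono-< (hs m n (ℕ.m⊔n≤o⇒m≤o M N h) (ℕ.m⊔n≤o⇒m≤o M N k))
                    (ht m n (ℕ.m⊔n≤o⇒n≤o M N h) (ℕ.m⊔n≤o⇒n≤o M N k)) ⟩
    ½ ℚ.* ε ℚ.+ ½ ℚ.* ε
      ≡⟨ ½+½ ε ⟩
    ε ∎

cauchy-bounded : ∀ {s} → IsCauchy s →
  ∃[ B ] 0ℚ ℚ.< B × Eventually (λ n → ℚ.∣ s n ∣ ℚ.≤ B)
cauchy-bounded {s} cs with cs 1ℚ (ℚ.positive⁻¹ 1ℚ)
... | N , h = 1ℚ ℚ.+ ℚ.∣ s N ∣ , 0<B , N , bound
  where
  open ℚ.≤-Reasoning
  open +-*-Solver
  0<B : 0ℚ ℚ.< 1ℚ ℚ.+ ℚ.∣ s N ∣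
  0<B = ℚ.+-mono-<-≤ (ℚ.positive⁻¹ 1ℚ) (ℚ.0≤∣p∣ (s N))
  bound : ∀ n → N ℕ.≤ n → ℚ.∣ s n ∣ ℚ.≤ 1ℚ ℚ.+ ℚ.∣ s N ∣
  bound n N≤n = begin
    ℚ.∣ s n ∣
      ≡⟨ cong ℚ.∣_∣ (solve 2 (λ a b → a := (a :- b) :+ b) refl (s n) (s N)) ⟩
    ℚ.∣ (s n ℚ.- s N) ℚ.+ s N ∣
      ≤⟨ ℚ.∣p+q∣≤∣p∣+∣q∣ (s n ℚ.- s N) (s N) ⟩
    ℚ.∣ s n ℚ.- s N ∣ ℚ.+ ℚ.∣ s N ∣
      ≤⟨ ℚ.+-monoˡ-≤ ℚ.∣ s N ∣ (ℚ.<⇒≤ (h n N N≤n ℕ.≤-refl)) ⟩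
    1ℚ ℚ.+ ℚ.∣ s N ∣ ∎

*-bound : ∀ {B δ} p q → 0ℚ ℚ.< B → ℚ.∣ p ∣ ℚ.≤ B → ℚ.∣ q ∣ ℚ.< δ →
          ℚ.∣ p ℚ.* q ∣ ℚ.< B ℚ.* δ
*-bound {B} {δ} p q 0<B p≤B q<δ = begin-strict
  ℚ.∣ p ℚ.* q ∣         ≡⟨ ℚ.∣p*q∣≡∣p∣*∣q∣ p q ⟩
  ℚ.∣ p ∣ ℚ.* ℚ.∣ q ∣   ≤⟨ ℚ.*-monoʳ-≤-nonNeg ℚ.∣ q ∣ {{ℚ.∣-∣-nonNeg q}} p≤B ⟩
  B ℚ.* ℚ.∣ q ∣         <⟨ ℚ.*-monoʳ-<-pos B {{ℚ.positive 0<B}} q<δ ⟩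
  B ℚ.* δ               ∎
  where open ℚ.≤-Reasoning

*-distribˡ-- : ∀ p q r → p ℚ.* (q ℚ.- r) ≡ p ℚ.* q ℚ.- p ℚ.* r
*-distribˡ-- p q r = trans (ℚ.*-distribˡ-+ p q (ℚ.- r))
  (cong (p ℚ.* q ℚ.+_) (sym (ℚ.neg-distribʳ-* p r)))

*-difference : ∀ a b c d →
  a ℚ.* b ℚ.- c ℚ.* d ≡ a ℚ.* (b ℚ.- d) ℚ.+ d ℚ.* (a ℚ.- c)
*-difference a b c d = begin
  a ℚ.* b ℚ.- c ℚ.* d
    ≡⟨ solve 3 (λ x y w → x :- w := (x :- y) :+ (y :- w)) refl (a ℚ.* b) (a ℚ.* d) (c ℚ.* d) ⟩
  (a ℚ.* b ℚ.- a ℚ.* d) ℚ.+ (a ℚ.* d ℚ.- c ℚ.* d)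
    ≡⟨ cong₂ ℚ._+_ (*-distribˡ-- a b d)
         (trans (*-distribˡ-- d a c) (cong₂ ℚ._-_ (ℚ.*-comm d a) (ℚ.*-comm d c))) ⟨
  a ℚ.* (b ℚ.- d) ℚ.+ d ℚ.* (a ℚ.- c) ∎
  where
  open ≡-Reasoning
  open +-*-Solver

*-difference-bound : ∀ A B δ η a b c d → 0ℚ ℚ.< A → 0ℚ ℚ.< B →
  ℚ.∣ a ∣ ℚ.≤ A → ℚ.∣ d ∣ ℚ.≤ B → ℚ.∣ b ℚ.- d ∣ ℚ.< δ → ℚ.∣ a ℚ.- c ∣ ℚ.< η →
  ℚ.∣ a ℚ.* b ℚ.- c ℚ.* d ∣ ℚ.< A ℚ.* δ ℚ.+ B ℚ.* η
*-difference-bound A B δ η a b c d 0<A 0<B a≤A d≤B b-d<δ a-c<η = begin-strict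
  ℚ.∣ a ℚ.* b ℚ.- c ℚ.* d ∣
    ≡⟨ cong ℚ.∣_∣ (*-difference a b c d) ⟩
  ℚ.∣ a ℚ.* (b ℚ.- d) ℚ.+ d ℚ.* (a ℚ.- c) ∣
    ≤⟨ ℚ.∣p+q∣≤∣p∣+∣q∣ (a ℚ.* (b ℚ.- d)) (d ℚ.* (a ℚ.- c)) ⟩
  ℚ.∣ a ℚ.* (b ℚ.- d) ∣ ℚ.+ ℚ.∣ d ℚ.* (a ℚ.- c) ∣
    <⟨ ℚ.+-mono-< (*-bound {A} {δ} a (b ℚ.- d) 0<A a≤A b-d<δ)
                  (*-bound {B} {η} d (a ℚ.- c) 0<B d≤B a-c<η) ⟩
  A ℚ.* δ ℚ.+ B ℚ.* η ∎
  where open ℚ.≤-Reasoning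

*-cauchy : ∀ {s t} → IsCauchy s → IsCauchy t → IsCauchy (λ n → s n ℚ.* t n)
*-cauchy {s} {t} cs ct ε 0<ε =
  let A , 0<A , K , hA = cauchy-bounded {s} cs
      B , 0<B , L , hB = cauchy-bounded {t} ct
      δ , 0<δ , Aδ = quotient A (½ ℚ.* ε) 0<A (½-pos {ε} 0<ε)
      η , 0<η , Bη = quotient B (½ ℚ.* ε) 0<B (½-pos {ε} 0<ε)
      M , hs = cs η 0<η
      N , ht = ct δ 0<δ
      I = K ℕ.⊔ L
      J = M ℕ.⊔ N
  in I ℕ.⊔ J , λ m n h k →
    subst (ℚ.∣ s m ℚ.* t m ℚ.- s n ℚ.* t n ∣ ℚ.<_)
      (trans (cong₂ ℚ._+_ Aδ Bη) (½+½ ε))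
      (*-difference-bound A B δ η (s m) (t m) (s n) (t n) 0<A 0<B
        (hA m (ℕ.m⊔n≤o⇒m≤o K L (ℕ.m⊔n≤o⇒m≤o I J h)))
        (hB n (ℕ.m⊔n≤o⇒n≤o K L (ℕ.m⊔n≤o⇒m≤o I J k)))
        (ht m n (ℕ.m⊔n≤o⇒n≤o M N (ℕ.m⊔n≤o⇒n≤o I J h))
                (ℕ.m⊔n≤o⇒n≤o M N (ℕ.m⊔n≤o⇒n≤o I J k)))
        (hs m n (ℕ.m⊔n≤o⇒m≤o M N (ℕ.m⊔n≤o⇒n≤o I J h))
                (ℕ.m⊔n≤o⇒m≤o M N (ℕ.m⊔n≤o⇒n≤o I J k))))

-- The value at 0 is arbitrary: reals are only inverted when positive, and then
-- all but finitely many terms are positive.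
invℚ : ℚ → ℚ
invℚ p with p ℚ.≟ 0ℚ
... | yes _  = 0ℚ
... | no p≢0 = ℚ.1/_ p {{ℚ.≢-nonZero p≢0}}

invℚ-inverseˡ : ∀ p → 0ℚ ℚ.< p → invℚ p ℚ.* p ≡ 1ℚ
invℚ-inverseˡ p 0<p with p ℚ.≟ 0ℚ
... | yes p≡0 = contradiction (sym p≡0) (ℚ.<⇒≢ 0<p)
... | no p≢0  = ℚ.*-inverseˡ p {{ℚ.≢-nonZero p≢0}}

inv-bound : ∀ {ε η} a b → 0ℚ ℚ.< ε → ε ℚ.< a → ε ℚ.< b →
  ℚ.∣ a ℚ.- b ∣ ℚ.< (ε ℚ.* ε) ℚ.* η → ℚ.∣ invℚ a ℚ.- invℚ b ∣ ℚ.< η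
inv-bound {ε} {η} a b 0<ε ε<a ε<b h =
  ℚ.*-cancelˡ-<-nonNeg (ε ℚ.* ε) {{ℚ.pos⇒nonNeg (ε ℚ.* ε) {{ℚ.pos*pos⇒pos ε ε}}}} (begin-strict
    (ε ℚ.* ε) ℚ.* d
      ≤⟨ ℚ.*-monoʳ-≤-nonNeg d {{ℚ.∣-∣-nonNeg (x ℚ.- y)}} ε²≤ab ⟩
    (a ℚ.* b) ℚ.* d
      ≡⟨ cong (ℚ._* d) (sym (ℚ.0≤p⇒∣p∣≡p (ℚ.<⇒≤ (ℚ.positive⁻¹ (a ℚ.* b) {{ℚ.pos*pos⇒pos a b}})))) ⟩
    ℚ.∣ a ℚ.* b ∣ ℚ.* d
      ≡⟨ sym (ℚ.∣p*q∣≡∣p∣*∣q∣ (a ℚ.* b) (x ℚ.- y)) ⟩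
    ℚ.∣ (a ℚ.* b) ℚ.* (x ℚ.- y) ∣
      ≡⟨ cong ℚ.∣_∣ (trans (*-distribˡ-- (a ℚ.* b) x y) (cong₂ ℚ._-_
           (trans (ℚ.*-comm (a ℚ.* b) x) (sym (ℚ.*-assoc x a b)))
           (trans (ℚ.*-comm (a ℚ.* b) y)
             (trans (cong (y ℚ.*_) (ℚ.*-comm a b)) (sym (ℚ.*-assoc y b a)))))) ⟩
    ℚ.∣ (x ℚ.* a) ℚ.* b ℚ.- (y ℚ.* b) ℚ.* a ∣
      ≡⟨ cong ℚ.∣_∣ (cong₂ (λ u v → u ℚ.* b ℚ.- v ℚ.* a)
           (invℚ-inverseˡ a 0<a) (invℚ-inverseˡ b 0<b)) ⟩
    ℚ.∣ 1ℚ ℚ.* b ℚ.- 1ℚ ℚ.* a ∣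
      ≡⟨ cong ℚ.∣_∣ (trans (cong₂ ℚ._-_ (ℚ.*-identityˡ b) (ℚ.*-identityˡ a))
           (solve 2 (λ a b → b :- a := :- (a :- b)) refl a b)) ⟩
    ℚ.∣ ℚ.- (a ℚ.- b) ∣
      ≡⟨ ℚ.∣-p∣≡∣p∣ (a ℚ.- b) ⟩
    ℚ.∣ a ℚ.- b ∣
      <⟨ h ⟩
    (ε ℚ.* ε) ℚ.* η ∎)
  where
  open ℚ.≤-Reasoning
  open +-*-Solver
  x = invℚ a
  y = invℚ b
  d = ℚ.∣ x ℚ.- y ∣
  0<a = ℚ.<-trans 0<ε ε<a
  0<b = ℚ.<-trans 0<ε ε<b
  instance
    ε-pos : ℚ.Positive ε
    ε-pos = ℚ.positive 0<ε
    a-pos : ℚ.Positive a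
    a-pos = ℚ.positive 0<a
    b-pos : ℚ.Positive b
    b-pos = ℚ.positive 0<b
  ε²≤ab : ε ℚ.* ε ℚ.≤ a ℚ.* b
  ε²≤ab = ℚ.<⇒≤ (ℚ.<-trans (ℚ.*-monoʳ-<-pos ε ε<b) (ℚ.*-monoˡ-<-pos b ε<a))

inv-cauchy : ∀ {s} → IsCauchy s →
  (∃[ ε ] 0ℚ ℚ.< ε × Eventually (λ n → ε ℚ.< s n)) → IsCauchy (λ n → invℚ (s n))
inv-cauchy {s} cs (ε , 0<ε , M , hM) η 0<η
  with cs ((ε ℚ.* ε) ℚ.* η)
          (ℚ.positive⁻¹ _ {{ℚ.pos*pos⇒pos (ε ℚ.* ε)
             {{ℚ.pos*pos⇒pos ε {{ℚ.positive 0<ε}} ε {{ℚ.positive 0<ε}}}} η {{ℚ.positive 0<η}}}})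
... | N , hN = M ℕ.⊔ N , λ m n h k →
  inv-bound (s m) (s n) 0<ε
    (hM m (ℕ.m⊔n≤o⇒m≤o M N h)) (hM n (ℕ.m⊔n≤o⇒m≤o M N k))
    (hN m n (ℕ.m⊔n≤o⇒n≤o M N h) (ℕ.m⊔n≤o⇒n≤o M N k))

fromℚ : ℚ → ℝ
fromℚ p = mkℝ (λ _ → p) (const-cauchy p)

0ᴿ 1ᴿ : ℝ
0ᴿ = fromℚ 0ℚ
1ᴿ = fromℚ 1ℚ

infixl 6 _+ᴿ_ _-ᴿ_
infixl 7 _*ᴿ_
infix  8 -ᴿ_

_+ᴿ_ : ℝ → ℝ → ℝ
x +ᴿ y = mkℝ (λ n → seq x n ℚ.+ seq y n) (+-cauchy {seq x} {seq y} (cauchy x) (cauchy y))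

-ᴿ_ : ℝ → ℝ
-ᴿ x = mkℝ (λ n → ℚ.- seq x n) (neg-cauchy {seq x} (cauchy x))

_-ᴿ_ : ℝ → ℝ → ℝ
x -ᴿ y = x +ᴿ (-ᴿ y)

_*ᴿ_ : ℝ → ℝ → ℝ
x *ᴿ y = mkℝ (λ n → seq x n ℚ.* seq y n) (*-cauchy {seq x} {seq y} (cauchy x) (cauchy y))

invᴿ : (x : ℝ) → 0ᴿ <ᴿ x → ℝ
invᴿ x (ε , 0<ε , N , h) = mkℝ (λ n → invℚ (seq x n))
  (inv-cauchy {seq x} (cauchy x)
    (ε , 0<ε , N , λ n N≤n → subst (ℚ._< seq x n) (ℚ.+-identityˡ ε) (h n N≤n)))

infixr 5 _+i_

record ℂ : Set where
  constructor _+i_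
  field
    re im : ℝ

open ℂ public

infix  4 _≃_ _#_ ∣_∣<_
infixl 6 _+_ _-_
infixl 7 _*_ _/[_,_]
infix  8 -_

_≃_ : ℂ → ℂ → Set
z ≃ w = (re z ≃ᴿ re w) × (im z ≃ᴿ im w)

0ℂ 1ℂ : ℂ
0ℂ = 0ᴿ +i 0ᴿ
1ℂ = 1ᴿ +i 0ᴿ

_+_ : ℂ → ℂ → ℂ
z + w = (re z +ᴿ re w) +i (im z +ᴿ im w)

-_ : ℂ → ℂ
- z = (-ᴿ re z) +i (-ᴿ im z)

_-_ : ℂ → ℂ → ℂ
z - w = z + (- w)

_*_ : ℂ → ℂ → ℂ
z * w = (re z *ᴿ re w -ᴿ im z *ᴿ im w) +i (re z *ᴿ im w +ᴿ im z *ᴿ re w)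

∣_∣² : ℂ → ℝ
∣ z ∣² = re z *ᴿ re z +ᴿ im z *ᴿ im z

-- |z| < r, for r ≥ 0, stated without extracting a square root.
∣_∣<_ : ℂ → ℚ → Set
∣ z ∣< r = ∣ z ∣² <ᴿ fromℚ (r ℚ.* r)

-- |z - w| > 0: the constructive form of z ≠ w (classically equivalent to ¬ z ≃ w).
_#_ : ℂ → ℂ → Set
z # w = 0ᴿ <ᴿ ∣ z - w ∣²

#0⇒0<∣∣² : ∀ z → z # 0ℂ → 0ᴿ <ᴿ ∣ z ∣²
#0⇒0<∣∣² z (ε , 0<ε , N , h) = ε , 0<ε , N , λ n N≤n →
  subst (0ℚ ℚ.+ ε ℚ.<_)
    (cong₂ (λ a b → a ℚ.* a ℚ.+ b ℚ.* b)
      (ℚ.+-identityʳ (seq (re z) n)) (ℚ.+-identityʳ (seq (im z) n)))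
    (h n N≤n)

inv : (z : ℂ) → z # 0ℂ → ℂ
inv z z#0 = (re z *ᴿ r) +i ((-ᴿ im z) *ᴿ r)
  where r = invᴿ ∣ z ∣² (#0⇒0<∣∣² z z#0)

_/[_,_] : ℂ → (w : ℂ) → w # 0ℂ → ℂ
z /[ w , w#0 ] = z * inv w w#0

ℂ-rawRing : RawRing 0ℓ 0ℓ
ℂ-rawRing = record
  { Carrier = ℂ ; _≈_ = _≃_ ; _+_ = _+_ ; _*_ = _*_ ; -_ = -_ ; 0# = 0ℂ ; 1# = 1ℂ }

open RawSemiringDefs (RawRing.rawSemiring ℂ-rawRing) public using (_^_; sum; product)

zpow : (z : ℂ) → z # 0ℂ → ℤ → ℂ
zpow z z#0 (+ n)    = z ^ n
zpow z z#0 -[1+ n ] = inv z z#0 ^ suc n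

∑< ∏< : ℕ → (ℕ → ℂ) → ℂ
∑< n f = sum {n} (λ i → f (toℕ i))
∏< n f = product {n} (λ i → f (toℕ i))

syntax ∑< n (λ i → e) = ∑[ i < n ] e
syntax ∏< n (λ i → e) = ∏[ i < n ] e

Converges : (ℕ → ℂ) → ℂ → Set
Converges u L = ∀ ε → 0ℚ ℚ.< ε → Eventually (λ n → ∣ u n - L ∣< ε)

HasSum : (ℕ → ℂ) → ℂ → Set
HasSum f S = Converges (λ N → ∑[ n < N ] f n) S

qPoch : ℂ → ℂ → ℕ → ℂ
qPoch a q n = ∏[ i < n ] (1ℂ - a * q ^ i)

-- P = (a;q)_∞
IsQPoch∞ : ℂ → ℂ → ℂ → Set
IsQPoch∞ a q P = Converges (qPoch a q) P

g₂-numerator : ℂ → ℕ → ℂ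
g₂-numerator q n = qPoch (- q) q n * q ^ (n ℕ.* suc n ℕ./ 2)

g₂-denominator : (z : ℂ) → z # 0ℂ → ℂ → ℕ → ℂ
g₂-denominator z z#0 q n = qPoch z q (suc n) * qPoch (inv z z#0 * q) q (suc n)

-- G = g₂(z;q), which includes that no denominator vanishes.
Isg₂ : (z : ℂ) → z # 0ℂ → ℂ → ℂ → Set
Isg₂ z z#0 q G =
  Σ[ d#0 ∈ (∀ n → g₂-denominator z z#0 q n # 0ℂ) ]
    HasSum (λ n → g₂-numerator q n /[ g₂-denominator z z#0 q n , d#0 n ]) G

-- ½(n² - 2m²) + ½n, written as n(n+1)/2 - m² so that the halving is exact in ℕ.
hecke-exponent : ℕ → ℕ → ℤ
hecke-exponent n m = (n ℕ.* suc n ℕ./ 2) ⊖ (m ℕ.* m)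

-- The second sum runs over 1 ≤ m ≤ ⌊n/2⌋, with m = suc k.
hecke-term : (z : ℂ) → z # 0ℂ → (q : ℂ) → q # 0ℂ → ℕ → ℂ
hecke-term z z#0 q q#0 n =
    ∑[ m < suc (n ℕ./ 2) ]
      ((- 1ℂ) ^ (m ℕ.+ n) * zpow z z#0 (n ⊖ 2 ℕ.* m) * zpow q q#0 (hecke-exponent n m))
  + ∑[ k < n ℕ./ 2 ]
      ((- 1ℂ) ^ (suc k ℕ.+ n) * zpow z z#0 (2 ℕ.* suc k ⊖ suc n)
        * zpow q q#0 (hecke-exponent n (suc k)))

module Submission where

-- Put F(z) = (1 - z) (zq, q/z, q;q)_∞ g₂(z;q) = (q;q)_∞ ∑ u_n (zq^{n+1};q)_∞ (q^{n+2}/z;q)_∞, where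
-- u_n = (-q;q)_n q^{n(n+1)/2}, and let f_k be the coefficient of z^k in F.  Since u_{n+1} = u_n (1 + Q) Q for
-- Q = q^{n+1}, the difference F(z) - F(zq)/z telescopes to (zq, 1/z, q;q)_∞, whose coefficients are
-- θ_k = (-1)^k q^{k(k+1)/2} by the Jacobi triple product.  Hence f_k = θ_k + q^{k+1} f_{k+1}, and iterating this towards
-- k = ∞ gives f_k = ∑_m (-1)^{m+k} q^{m²+m+2mk+k(k+1)/2} for k ≥ 0; the symmetry z ↦ q/z gives the negative k.
-- Sorting the terms of this Laurent series by n = k + 2m yields the double sum.
--
-- To stay with finite sums, the products are truncated at N.  Then F(z) - F(1/z)/z telescopes exactly, the symmetry and
-- the triple product hold up to errors O(r^N y^{|k|}) with |q| < r < 1, and any weight y < 1 may be chosen because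
-- coefficients of the products decay faster than every y^{|k|}.  Since the field operations act termwise on Cauchy
-- sequences, all of this takes place in ℚ[i], at one index at a time, with constants that do not depend on the index.

open import Algebra.Bundles using (CommutativeRing)
import Algebra.Properties.AbelianGroup as AbelianGroupProperties
import Algebra.Properties.Ring as RingProperties
import Algebra.Properties.Semiring.Exp as SemiringExp
import Algebra.Properties.Semiring.Mult.TCOptimised as SemiringMult
import Algebra.Solver.Ring
open import Algebra.Solver.Ring.AlmostCommutativeRing
  using (fromCommutativeRing; _-Raw-AlmostCommutative⟶_)
open import Algebra.Structures using (IsCommutativeRing)
open import Data.Integer.Base as ℤ using (ℤ; +_; -[1+_]; _⊖_)
import Data.Integer.Properties as ℤ
open import Data.Maybe.Base using (Maybe; just; nothing)
open import Data.Nat.Base as ℕ using (ℕ; zero; suc; ⌊_/2⌋)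
import Data.Nat.DivMod as ℕ
import Data.Nat.Properties as ℕ
import Data.Nat.Solver as ℕSolver
open import Data.Product.Base using (_×_; ∃-syntax; _,_; proj₁; proj₂)
open import Data.Rational.Base as ℚ using (ℚ; 0ℚ; 1ℚ; ½)
import Data.Rational.Properties as ℚ
import Data.Rational.Unnormalised.Base as ℚᵘ
import Data.Rational.Unnormalised.Properties as ℚᵘ
open import Data.Sum.Base using (inj₁; inj₂)
open import Level using (0ℓ)
open import Relation.Binary.PropositionalEquality as ≡
  using (_≡_; refl; sym; trans; cong; cong₂; subst; subst₂; module ≡-Reasoning)
open import Relation.Nullary using (yes; no)
open import Data.Rational.Base using ()
  renaming (_+_ to _+ℚ_; _*_ to _*ℚ_; _-_ to _-ℚ_; _≤_ to _≤ℚ_)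

-- Truncation breaks one of the two symmetries. Cutting both products at the same N keeps z ↦ 1/z
-- exact, and with it the telescoping. But z ↦ q/z pairs 1 - z q^i with 1 - q^(i+1)/z, so the last
-- factor 1 - z q^N has no partner; supplying 1 - q^(N+1)/z produces an error term with the factor
-- q^(N+1). Errors do not pile up along the descent in k, because each step multiplies by q^(k+1).
-- Its norm is only known to be at most 2 r^(k+1), as |re| + |im| loses a constant against the
-- modulus. A weight y ≤ 1/2 absorbs the 2; a contraction by r remains, and its fixed point is the
-- constant of the whole descent. Choosing y = 1/(2b), with b bounding z and 1/z, also makes
-- evaluation at z a sum of powers of 1/2. Limits are diagonal: the n-th entry of a limit is the
-- n-th entry of the n-th partial product or sum. At index n both sides of the theorem are thus
-- truncations at N = n, and one estimate per index suffices. Besides this, the inverse denominators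
-- of g₂ must be bounded uniformly in the index and in the summation variable; this is where the
-- separation of z from the powers of q enters.

module IntegerCoefficientSolver (R : CommutativeRing 0ℓ 0ℓ) where
  open CommutativeRing R renaming (refl to ≈-refl; sym to ≈-sym; trans to ≈-trans)
  open RingProperties ring using (-‿distribˡ-*; -0#≈0#)
  open AbelianGroupProperties +-abelianGroup using (⁻¹-∙-comm; ⁻¹-involutive)
  open SemiringMult semiring using (1+×; ×-homo-+; ×1-homo-*) renaming (_×_ to _·_)
  open import Relation.Binary.Reasoning.Setoid setoid

  fromℤ : ℤ → Carrier
  fromℤ (+ n)    = n · 1#
  fromℤ -[1+ n ] = - (suc n · 1#)

  -‿homo : ∀ i → fromℤ (ℤ.- i) ≈ - fromℤ i
  -‿homo -[1+ n ]    = ≈-sym (⁻¹-involutive _)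
  -‿homo (+ zero)    = ≈-sym -0#≈0#
  -‿homo (+ (suc n)) = ≈-refl

  ⊖-homo : ∀ m n → fromℤ (m ⊖ n) ≈ m · 1# - n · 1#
  ⊖-homo m zero = begin
    m · 1#         ≈⟨ +-identityʳ _ ⟨
    m · 1# + 0#    ≈⟨ +-congˡ -0#≈0# ⟨
    m · 1# - 0#    ∎
  ⊖-homo zero (suc n) = ≈-sym (+-identityˡ _)
  ⊖-homo (suc m) (suc n) = begin
    fromℤ (suc m ⊖ suc n)                ≡⟨ ≡.cong fromℤ (ℤ.[1+m]⊖[1+n]≡m⊖n m n) ⟩
    fromℤ (m ⊖ n)                        ≈⟨ ⊖-homo m n ⟩
    a - b                                ≈⟨ +-congʳ (+-identityˡ a) ⟨
    0# + a - b                           ≈⟨ +-congʳ (+-congʳ (-‿inverseʳ 1#)) ⟨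
    1# - 1# + a - b                      ≈⟨ +-congʳ (+-assoc 1# (- 1#) a) ⟩
    1# + (- 1# + a) - b                  ≈⟨ +-congʳ (+-congˡ (+-comm (- 1#) a)) ⟩
    1# + (a - 1#) - b                    ≈⟨ +-congʳ (+-assoc 1# a (- 1#)) ⟨
    1# + a - 1# - b                      ≈⟨ +-assoc (1# + a) (- 1#) (- b) ⟩
    1# + a + (- 1# - b)                  ≈⟨ +-congˡ (⁻¹-∙-comm 1# b) ⟩
    1# + a - (1# + b)                    ≈⟨ +-cong (1+× m 1#) (-‿cong (1+× n 1#)) ⟨
    suc m · 1# - suc n · 1#              ∎
    where
    a = m · 1#
    b = n · 1#

  +-homo : ∀ i j → fromℤ (i ℤ.+ j) ≈ fromℤ i + fromℤ j
  +-homo (+ m)    (+ n)    = ×-homo-+ 1# m n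
  +-homo (+ m)    -[1+ n ] = ⊖-homo m (suc n)
  +-homo -[1+ m ] (+ n)    = ≈-trans (⊖-homo n (suc m)) (+-comm _ _)
  +-homo -[1+ m ] -[1+ n ] = begin
    - (suc (suc (m ℕ.+ n)) · 1#)          ≡⟨ ≡.cong (λ k → - (suc k · 1#)) (ℕ-+-suc m n) ⟨
    - ((suc m ℕ.+ suc n) · 1#)            ≈⟨ -‿cong (×-homo-+ 1# (suc m) (suc n)) ⟩
    - (suc m · 1# + suc n · 1#)           ≈⟨ ⁻¹-∙-comm _ _ ⟨
    - (suc m · 1#) - (suc n · 1#)         ∎
    where open import Data.Nat.Properties using () renaming (+-suc to ℕ-+-suc)

  *-homo-+ : ∀ m j → fromℤ (+ m ℤ.* j) ≈ fromℤ (+ m) * fromℤ j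
  *-homo-+ m (+ n) = ≈-trans (reflexive (≡.cong fromℤ (≡.sym (ℤ.pos-* m n)))) (×1-homo-* m n)
  *-homo-+ m -[1+ n ] = begin
    fromℤ (+ m ℤ.* (ℤ.- (+ suc n)))       ≡⟨ ≡.cong fromℤ (ℤ.neg-distribʳ-* (+ m) (+ suc n)) ⟨
    fromℤ (ℤ.- (+ m ℤ.* + suc n))         ≈⟨ -‿homo (+ m ℤ.* + suc n) ⟩
    - fromℤ (+ m ℤ.* + suc n)             ≈⟨ -‿cong (*-homo-+ m (+ suc n)) ⟩
    - (fromℤ (+ m) * fromℤ (+ suc n))     ≈⟨ RingProperties.-‿distribʳ-* ring _ _ ⟩
    fromℤ (+ m) * - fromℤ (+ suc n)       ∎

  *-homo : ∀ i j → fromℤ (i ℤ.* j) ≈ fromℤ i * fromℤ j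
  *-homo (+ m)    j = *-homo-+ m j
  *-homo -[1+ m ] j = begin
    fromℤ ((ℤ.- (+ suc m)) ℤ.* j)         ≡⟨ ≡.cong fromℤ (ℤ.neg-distribˡ-* (+ suc m) j) ⟨
    fromℤ (ℤ.- (+ suc m ℤ.* j))           ≈⟨ -‿homo (+ suc m ℤ.* j) ⟩
    - fromℤ (+ suc m ℤ.* j)               ≈⟨ -‿cong (*-homo-+ (suc m) j) ⟩
    - (fromℤ (+ suc m) * fromℤ j)         ≈⟨ -‿distribˡ-* _ _ ⟩
    - fromℤ (+ suc m) * fromℤ j           ∎

  morphism : CommutativeRing.rawRing ℤ.+-*-commutativeRing -Raw-AlmostCommutative⟶ fromCommutativeRing R
  morphism = record
    { ⟦_⟧    = fromℤ
    ; +-homo = +-homo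
    ; *-homo = *-homo
    ; -‿homo = -‿homo
    ; 0-homo = ≈-refl
    ; 1-homo = ≈-refl
    }

  weaklyDecide : ∀ i j → Maybe (fromℤ i ≈ fromℤ j)
  weaklyDecide i j with i ℤ.≟ j
  ... | yes i≡j = just (reflexive (≡.cong fromℤ i≡j))
  ... | no _    = nothing

  open Algebra.Solver.Ring (CommutativeRing.rawRing ℤ.+-*-commutativeRing) (fromCommutativeRing R)
    morphism weaklyDecide public
    using (solve; _:=_; _:+_; _:*_; _:-_; :-_; con)

-- Inequalities, powers and product majorants over the rationals.

triangular : ℕ → ℕ
triangular zero    = 0
triangular (suc n) = suc n ℕ.+ triangular n

module Rationals where
  open import Data.Rational.Base using (_+_; _*_; _-_; -_; _≤_; _<_) public
  open SemiringExp (CommutativeRing.semiring ℚ.+-*-commutativeRing) using (_^_; ^-homo-*) public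
  open IntegerCoefficientSolver ℚ.+-*-commutativeRing public
  open ℚ.≤-Reasoning

  *-mono-≤ : ∀ {a b c d} → 0ℚ ≤ a → a ≤ b → 0ℚ ≤ c → c ≤ d → a * c ≤ b * d
  *-mono-≤ {a} {b} {c} {d} 0≤a a≤b 0≤c c≤d = ℚ.≤-trans
    (ℚ.*-monoʳ-≤-nonNeg c {{ℚ.nonNegative 0≤c}} a≤b)
    (ℚ.*-monoˡ-≤-nonNeg b {{ℚ.nonNegative (ℚ.≤-trans 0≤a a≤b)}} c≤d)

  *-monoˡ : ∀ {a b} c → 0ℚ ≤ c → a ≤ b → c * a ≤ c * b
  *-monoˡ c 0≤c = ℚ.*-monoˡ-≤-nonNeg c {{ℚ.nonNegative 0≤c}}

  *-monoʳ : ∀ {a b} c → 0ℚ ≤ c → a ≤ b → a * c ≤ b * c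
  *-monoʳ c 0≤c = ℚ.*-monoʳ-≤-nonNeg c {{ℚ.nonNegative 0≤c}}

  0≤+ : ∀ {a b} → 0ℚ ≤ a → 0ℚ ≤ b → 0ℚ ≤ a + b
  0≤+ = ℚ.+-mono-≤

  0≤* : ∀ {a b} → 0ℚ ≤ a → 0ℚ ≤ b → 0ℚ ≤ a * b
  0≤* {a} {b} 0≤a 0≤b = subst (_≤ a * b) (ℚ.*-zeroˡ 0ℚ) (*-mono-≤ ℚ.≤-refl 0≤a ℚ.≤-refl 0≤b)

  0≤1 : 0ℚ ≤ 1ℚ
  0≤1 = ℚ.<⇒≤ (ℚ.positive⁻¹ 1ℚ)

  0<* : ∀ {a b} → 0ℚ < a → 0ℚ < b → 0ℚ < a * b
  0<* {a} {b} 0<a 0<b = ℚ.positive⁻¹ (a * b) {{ℚ.pos*pos⇒pos a {{ℚ.positive 0<a}} b {{ℚ.positive 0<b}}}}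

  ≤⇒0≤- : ∀ {a b} → a ≤ b → 0ℚ ≤ b - a
  ≤⇒0≤- {a} {b} a≤b = subst (_≤ b - a) (ℚ.+-inverseʳ a) (ℚ.+-monoˡ-≤ (- a) a≤b)

  <⇒0<- : ∀ {a b} → a < b → 0ℚ < b - a
  <⇒0<- {a} {b} a<b = subst (_< b - a) (ℚ.+-inverseʳ a) (ℚ.+-monoˡ-< (- a) a<b)

  0≤-⇒≤ : ∀ {a b} → 0ℚ ≤ b - a → a ≤ b
  0≤-⇒≤ {a} {b} 0≤b-a = subst₂ _≤_ (ℚ.+-identityˡ a)
    (solve 2 (λ a b → (b :- a) :+ a := b) refl a b) (ℚ.+-monoˡ-≤ a 0≤b-a)

  ≤+ : ∀ {a b} → 0ℚ ≤ b → a ≤ a + b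
  ≤+ {a} {b} 0≤b = subst (_≤ a + b) (ℚ.+-identityʳ a) (ℚ.+-monoʳ-≤ a 0≤b)

  +≤ : ∀ {a b} → 0ℚ ≤ b → a ≤ b + a
  +≤ {a} {b} 0≤b = subst (_≤ b + a) (ℚ.+-identityˡ a) (ℚ.+-monoˡ-≤ a 0≤b)

  ≤-cong₂ : ∀ {a b c d} → a ≡ b → c ≡ d → b ≤ d → a ≤ c
  ≤-cong₂ refl refl p = p

  *≤ : ∀ {a b} → 0ℚ ≤ b → a ≤ 1ℚ → a * b ≤ b
  *≤ {a} {b} 0≤b a≤1 = subst (a * b ≤_) (ℚ.*-identityˡ b) (*-monoʳ b 0≤b a≤1)

  ≤* : ∀ {a b} → 0ℚ ≤ b → 1ℚ ≤ a → b ≤ a * b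
  ≤* {a} {b} 0≤b 1≤a = subst (_≤ a * b) (ℚ.*-identityˡ b) (*-monoʳ b 0≤b 1≤a)

  reciprocal : ∀ {a} → 0ℚ < a → ∃[ b ] 0ℚ < b × a * b ≡ 1ℚ
  reciprocal {a} 0<a = (ℚ.1/ a) {{nz}} ,
    ℚ.positive⁻¹ _ {{ℚ.1/pos⇒pos a {{ℚ.positive 0<a}}}} , ℚ.*-inverseʳ a {{nz}}
    where nz = ℚ.pos⇒nonZero a {{ℚ.positive 0<a}}

  fromℕ : ℕ → ℚ
  fromℕ zero    = 0ℚ
  fromℕ (suc n) = 1ℚ + fromℕ n

  toℚᵘ-fromℕ : ∀ n → ℚ.toℚᵘ (fromℕ n) ℚᵘ.≃ ℚᵘ.mkℚᵘ (+ n) 0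
  toℚᵘ-fromℕ zero    = ℚᵘ.≃-refl
  toℚᵘ-fromℕ (suc n) = ℚᵘ.≃-trans (ℚ.toℚᵘ-homo-+ 1ℚ (fromℕ n))
    (ℚᵘ.≃-trans (ℚᵘ.+-congʳ (ℚ.toℚᵘ 1ℚ) (toℚᵘ-fromℕ n))
      (ℚᵘ.*≡* (cong (λ i → (+ 1 ℤ.+ i) ℤ.* + 1) (ℤ.*-identityʳ (+ n)))))

  archimedean : ∀ p → ∃[ n ] p ≤ fromℕ n
  archimedean p@(ℚ.mkℚ i d _) = ℤ.∣ i ∣ , ℚ.toℚᵘ-cancel-≤ (ℚᵘ.≤-respʳ-≃
    (ℚᵘ.≃-sym (toℚᵘ-fromℕ ℤ.∣ i ∣)) (ℚᵘ.*≤* (bound i)))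
    where
    bound : ∀ i → i ℤ.* + 1 ℤ.≤ + ℤ.∣ i ∣ ℤ.* + suc d
    bound (+ n)    = subst₂ ℤ._≤_ (ℤ.pos-* n 1) (ℤ.pos-* n (suc d)) (ℤ.+≤+ (ℕ.*-monoʳ-≤ n (ℕ.s≤s ℕ.z≤n)))
    bound -[1+ n ] = ℤ.-≤+

  ^-nonNeg : ∀ {r} → 0ℚ ≤ r → ∀ n → 0ℚ ≤ r ^ n
  ^-nonNeg 0≤r zero    = 0≤1
  ^-nonNeg 0≤r (suc n) = 0≤* 0≤r (^-nonNeg 0≤r n)

  ^-pos : ∀ {r} → 0ℚ < r → ∀ n → 0ℚ < r ^ n
  ^-pos 0<r zero    = ℚ.positive⁻¹ 1ℚ
  ^-pos 0<r (suc n) = 0<* 0<r (^-pos 0<r n)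

  ^-≤1 : ∀ {r} → 0ℚ ≤ r → r ≤ 1ℚ → ∀ n → r ^ n ≤ 1ℚ
  ^-≤1 0≤r r≤1 zero    = ℚ.≤-refl
  ^-≤1 0≤r r≤1 (suc n) = ℚ.≤-trans (*≤ (^-nonNeg 0≤r n) r≤1) (^-≤1 0≤r r≤1 n)

  ^-antimono : ∀ {r} → 0ℚ ≤ r → r ≤ 1ℚ → ∀ {m n} → m ℕ.≤ n → r ^ n ≤ r ^ m
  ^-antimono 0≤r r≤1 {n = n} ℕ.z≤n = ^-≤1 0≤r r≤1 n
  ^-antimono 0≤r r≤1 (ℕ.s≤s m≤n)   = *-monoˡ _ 0≤r (^-antimono 0≤r r≤1 m≤n)

  ^-mono-≤ : ∀ {a b} → 0ℚ ≤ a → a ≤ b → ∀ n → a ^ n ≤ b ^ n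
  ^-mono-≤ 0≤a a≤b zero    = ℚ.≤-refl
  ^-mono-≤ 0≤a a≤b (suc n) = *-mono-≤ 0≤a a≤b (^-nonNeg 0≤a n) (^-mono-≤ 0≤a a≤b n)

  *-^ : ∀ a b n → (a * b) ^ n ≡ a ^ n * b ^ n
  *-^ a b zero    = refl
  *-^ a b (suc n) = trans (cong (a * b *_) (*-^ a b n))
    (solve 4 (λ a b c d → a :* b :* (c :* d) := a :* c :* (b :* d)) refl a b (a ^ n) (b ^ n))

  1^ : ∀ n → 1ℚ ^ n ≡ 1ℚ
  1^ zero    = refl
  1^ (suc n) = trans (ℚ.*-identityˡ _) (1^ n)

  module Geometric (r : ℚ) (0<r : 0ℚ < r) (r<1 : r < 1ℚ) where

    0≤r : 0ℚ ≤ r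
    0≤r = ℚ.<⇒≤ 0<r

    r≤1 : r ≤ 1ℚ
    r≤1 = ℚ.<⇒≤ r<1

    0≤r^ : ∀ n → 0ℚ ≤ r ^ n
    0≤r^ = ^-nonNeg 0≤r

    r^≤1 : ∀ n → r ^ n ≤ 1ℚ
    r^≤1 = ^-≤1 0≤r r≤1

    r^-antimono : ∀ {m n} → m ℕ.≤ n → r ^ n ≤ r ^ m
    r^-antimono = ^-antimono 0≤r r≤1

    0<1-r : 0ℚ < 1ℚ - r
    0<1-r = <⇒0<- r<1

    0≤1-r : 0ℚ ≤ 1ℚ - r
    0≤1-r = ℚ.<⇒≤ 0<1-r

    -- 1 - r^n is (1 - r) times the sum of r^i over i < n, and each of these n powers is at least
    -- r^n.
    n*r^n-bound : ∀ n → fromℕ n * r ^ n * (1ℚ - r) ≤ 1ℚ - r ^ n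
    n*r^n-bound zero    = ℚ.≤-reflexive (trans (cong (_* (1ℚ - r)) (ℚ.*-zeroˡ 1ℚ)) (ℚ.*-zeroˡ (1ℚ - r)))
    n*r^n-bound (suc n) = begin
      (1ℚ + fromℕ n) * (r * r ^ n) * (1ℚ - r)
        ≡⟨ solve 3 (λ r s f → (con (+ 1) :+ f) :* (r :* s) :* (con (+ 1) :- r)
                      := r :* (f :* s :* (con (+ 1) :- r)) :+ r :* s :* (con (+ 1) :- r)) refl r (r ^ n) (fromℕ n) ⟩
      r * (fromℕ n * r ^ n * (1ℚ - r)) + r * r ^ n * (1ℚ - r)
        ≤⟨ ℚ.+-monoˡ-≤ _ (*-monoˡ r 0≤r (n*r^n-bound n)) ⟩
      r * (1ℚ - r ^ n) + r * r ^ n * (1ℚ - r)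
        ≤⟨ ≤+ (0≤* 0≤1-r (≤⇒0≤- (r^≤1 (suc n)))) ⟩
      r * (1ℚ - r ^ n) + r * r ^ n * (1ℚ - r) + (1ℚ - r) * (1ℚ - r ^ suc n)
        ≡⟨ solve 2 (λ r s → r :* (con (+ 1) :- s) :+ r :* s :* (con (+ 1) :- r)
                              :+ (con (+ 1) :- r) :* (con (+ 1) :- r :* s)
                      := con (+ 1) :- r :* s) refl r (r ^ n) ⟩
      1ℚ - r ^ suc n ∎

    -- With I ≥ B / (δ (1 - r)), `n*r^n-bound` gives B r^I ≤ δ I r^I (1 - r) ≤ δ, without
    -- logarithms.
    vanishing : ∀ B δ → 0ℚ ≤ B → 0ℚ < δ → ∃[ I ] (∀ n → I ℕ.≤ n → B * r ^ n ≤ δ)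
    vanishing B δ 0≤B 0<δ with reciprocal (0<* 0<δ 0<1-r)
    ... | c , 0<c , δc≡1 with archimedean (B * c)
    ...   | I , Bc≤I = I , λ n I≤n → ℚ.≤-trans (*-monoˡ B 0≤B (r^-antimono I≤n)) (begin
      B * r ^ I
        ≡⟨ trans (sym (ℚ.*-identityʳ _)) (trans (cong (B * r ^ I *_) (sym δc≡1))
             (solve 5 (λ B s d t c → B :* s :* (d :* t :* c) := d :* ((B :* c) :* s :* t)) refl
               B (r ^ I) δ (1ℚ - r) c)) ⟩
      δ * (B * c * r ^ I * (1ℚ - r))
        ≤⟨ *-monoˡ δ 0≤δ (*-monoʳ (1ℚ - r) 0≤1-r (*-monoʳ (r ^ I) (0≤r^ I) Bc≤I)) ⟩
      δ * (fromℕ I * r ^ I * (1ℚ - r))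
        ≤⟨ *-monoˡ δ 0≤δ (n*r^n-bound I) ⟩
      δ * (1ℚ - r ^ I)
        ≤⟨ *-monoˡ δ 0≤δ (0≤-⇒≤ (ℚ.≤-trans (0≤r^ I) (ℚ.≤-reflexive
             (solve 1 (λ s → s := con (+ 1) :- (con (+ 1) :- s)) refl (r ^ I))))) ⟩
      δ * 1ℚ
        ≡⟨ ℚ.*-identityʳ δ ⟩
      δ ∎)
      where 0≤δ = ℚ.<⇒≤ 0<δ

    -- bound s bounds every product of consecutive factors 1 + b r ^ i with i ≥ s.
    record Majorant (b : ℚ) : Set where
      field
        bound      : ℕ → ℚ
        1≤bound    : ∀ s → 1ℚ ≤ bound s
        bound-step : ∀ s → (1ℚ + b * r ^ s) * bound (suc s) ≤ bound s

      0≤bound : ∀ s → 0ℚ ≤ bound s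
      0≤bound s = ℚ.≤-trans 0≤1 (1≤bound s)

      bound-antimono : 0ℚ ≤ b → ∀ s → bound s ≤ bound 0
      bound-antimono 0≤b zero    = ℚ.≤-refl
      bound-antimono 0≤b (suc s) = ℚ.≤-trans
        (ℚ.≤-trans (≤* (0≤bound (suc s)) (≤+ (0≤* 0≤b (0≤r^ s)))) (bound-step s)) (bound-antimono 0≤b s)

    -- Put X = r^s. Going from 1 + κ r X to 1 + κ X gains κ (1 - r) X = 2 b X; one half pays for the
    -- factor 1 + b X, the other covers the mixed term b κ r X².
    majorant-small : ∀ b κ → 0ℚ ≤ b → 0ℚ ≤ κ → κ ≤ 1ℚ → b + b ≡ κ * (1ℚ - r) → Majorant b
    majorant-small b κ 0≤b 0≤κ κ≤1 2b≡κ[1-r] = record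
      { bound      = λ s → 1ℚ + κ * r ^ s
      ; 1≤bound    = λ s → ≤+ (0≤* 0≤κ (0≤r^ s))
      ; bound-step = λ s → 0≤-⇒≤ (ℚ.≤-trans
          (0≤* (0≤* 0≤b (0≤r^ s)) (≤⇒0≤- (≤-cong₂ refl (sym (ℚ.*-identityʳ 1ℚ))
            (*-mono-≤ 0≤κ κ≤1 (0≤r^ (suc s)) (r^≤1 (suc s))))))
          (ℚ.≤-reflexive (difference s)))
      }
      where
      difference : ∀ s → b * r ^ s * (1ℚ - κ * r ^ suc s) ≡
        (1ℚ + κ * r ^ s) - (1ℚ + b * r ^ s) * (1ℚ + κ * r ^ suc s)
      difference s = begin-equality
        b * x * (1ℚ - κ * (r * x))
          ≡⟨ solve 4 (λ b κ r x → b :* x :* (con (+ 1) :- κ :* (r :* x)) :=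
               (b :+ b) :* x :- b :* x :- b :* x :* (κ :* (r :* x))) refl b κ r x ⟩
        (b + b) * x - b * x - b * x * (κ * (r * x))
          ≡⟨ cong (λ t → t * x - b * x - b * x * (κ * (r * x))) 2b≡κ[1-r] ⟩
        κ * (1ℚ - r) * x - b * x - b * x * (κ * (r * x))
          ≡⟨ solve 4 (λ b κ r x → κ :* (con (+ 1) :- r) :* x :- b :* x :- b :* x :* (κ :* (r :* x)) :=
               (con (+ 1) :+ κ :* x) :- (con (+ 1) :+ b :* x) :* (con (+ 1) :+ κ :* (r :* x))) refl b κ r x ⟩
        (1ℚ + κ * x) - (1ℚ + b * x) * (1ℚ + κ * (r * x)) ∎
        where x = r ^ s

    -- The factors with i ≥ 1 are the factors for `b * r`, so only 1 + b has to be put in front.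
    majorant-shift : ∀ b → 0ℚ ≤ b → Majorant (b * r) → Majorant b
    majorant-shift b 0≤b m = record
      { bound      = bound′
      ; 1≤bound    = λ { zero → ℚ.≤-trans (1≤bound 0) (≤* (0≤bound 0) (≤+ 0≤b)) ; (suc s) → 1≤bound s }
      ; bound-step = λ { zero → ℚ.≤-reflexive (cong (λ t → (1ℚ + t) * bound 0) (ℚ.*-identityʳ b))
                       ; (suc s) → subst (λ t → (1ℚ + t) * bound (suc s) ≤ bound s) (ℚ.*-assoc b r (r ^ s)) (bound-step s) }
      }
      where
      open Majorant m
      bound′ : ℕ → ℚ
      bound′ zero    = (1ℚ + b) * bound 0
      bound′ (suc s) = bound s

    -- Here c = 1 / (1 - r); the last hypothesis says that after I shifts κ = 2 b c r^I is
    -- admissible in `majorant-small`.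
    majorant-shift^ : ∀ c I b → 0ℚ ≤ c → (1ℚ - r) * c ≡ 1ℚ → 0ℚ ≤ b → (b + b) * c * r ^ I ≤ 1ℚ → Majorant b
    majorant-shift^ c zero b 0≤c [1-r]c≡1 0≤b h = majorant-small b ((b + b) * c) 0≤b (0≤* (0≤+ 0≤b 0≤b) 0≤c)
      (subst (_≤ 1ℚ) (ℚ.*-identityʳ ((b + b) * c)) h) (begin-equality
        b + b                      ≡⟨ ℚ.*-identityʳ (b + b) ⟨
        (b + b) * 1ℚ               ≡⟨ cong ((b + b) *_) [1-r]c≡1 ⟨
        (b + b) * ((1ℚ - r) * c)   ≡⟨ solve 3 (λ b c t → b :* (t :* c) := b :* c :* t) refl (b + b) c (1ℚ - r) ⟩
        (b + b) * c * (1ℚ - r)     ∎)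
    majorant-shift^ c (suc I) b 0≤c [1-r]c≡1 0≤b h = majorant-shift b 0≤b
      (majorant-shift^ c I (b * r) 0≤c [1-r]c≡1 (0≤* 0≤b 0≤r) (begin
        (b * r + b * r) * c * r ^ I
          ≡⟨ solve 4 (λ b c r s → (b :* r :+ b :* r) :* c :* s := (b :+ b) :* c :* (r :* s)) refl b c r (r ^ I) ⟩
        (b + b) * c * r ^ suc I     ≤⟨ h ⟩
        1ℚ ∎))

    majorant : ∀ b → 0ℚ ≤ b → Majorant b
    majorant b 0≤b =
      let c , 0<c , [1-r]c≡1 = reciprocal 0<1-r
          I , small = vanishing ((b + b) * c) 1ℚ (0≤* (0≤+ 0≤b 0≤b) (ℚ.<⇒≤ 0<c)) (ℚ.positive⁻¹ 1ℚ)
      in majorant-shift^ c I b (ℚ.<⇒≤ 0<c) [1-r]c≡1 0≤b (small I ℕ.≤-refl)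

    -- r ^ k eventually drops below t, so r ^ triangular k eventually decays faster than t ^ k.
    triangular-decay : ∀ t v → 0ℚ < t → t ≤ 1ℚ → 0ℚ ≤ v → t * v ≡ 1ℚ → ∃[ C ] 0ℚ ≤ C × (∀ k → r ^ triangular k ≤ C * t ^ k)
    triangular-decay t v 0<t t≤1 0≤v tv≡1 =
      let I , small = vanishing 1ℚ t 0≤1 0<t
      in v ^ I , ^-nonNeg 0≤v I , bound I (λ n I≤n → ℚ.≤-trans (ℚ.≤-reflexive (sym (ℚ.*-identityˡ (r ^ n)))) (small n I≤n))
      where
      0≤t = ℚ.<⇒≤ 0<t
      1≤v : 1ℚ ≤ v
      1≤v = ℚ.≤-trans (ℚ.≤-reflexive (sym tv≡1)) (*≤ 0≤v t≤1)
      v^*t^ : ∀ k → v ^ k * t ^ k ≡ 1ℚ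
      v^*t^ k = begin-equality
        v ^ k * t ^ k    ≡⟨ *-^ v t k ⟨
        (v * t) ^ k      ≡⟨ cong (_^ k) (trans (ℚ.*-comm v t) tv≡1) ⟩
        1ℚ ^ k           ≡⟨ 1^ k ⟩
        1ℚ ∎
      grow : ∀ k j → v ^ k ≤ v ^ (j ℕ.+ k)
      grow k zero    = ℚ.≤-refl
      grow k (suc j) = ℚ.≤-trans (grow k j) (≤* (^-nonNeg 0≤v (j ℕ.+ k)) 1≤v)
      below : ∀ I k → k ℕ.≤ I → 1ℚ ≤ v ^ I * t ^ k
      below I k k≤I = begin
        1ℚ                       ≡⟨ v^*t^ k ⟨
        v ^ k * t ^ k            ≤⟨ *-monoʳ (t ^ k) (^-nonNeg 0≤t k) (grow k (I ℕ.∸ k)) ⟩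
        v ^ (I ℕ.∸ k ℕ.+ k) * t ^ k ≡⟨ cong (λ i → v ^ i * t ^ k) (ℕ.m∸n+n≡m k≤I) ⟩
        v ^ I * t ^ k ∎
      bound : ∀ I → (∀ n → I ℕ.≤ n → r ^ n ≤ t) → ∀ k → r ^ triangular k ≤ v ^ I * t ^ k
      bound I small zero    = ℚ.≤-trans (r^≤1 0) (below I 0 ℕ.z≤n)
      bound I small (suc k) with ℕ.≤-total (suc k) I
      ... | inj₁ k≤I = ℚ.≤-trans (r^≤1 (triangular (suc k))) (below I (suc k) k≤I)
      ... | inj₂ I≤k = begin
        r ^ (suc k ℕ.+ triangular k)        ≡⟨ ^-homo-* r (suc k) (triangular k) ⟩
        r ^ suc k * r ^ triangular k        ≤⟨ *-mono-≤ (0≤r^ (suc k)) (small (suc k) I≤k) (0≤r^ (triangular k)) (bound I small k) ⟩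
        t * (v ^ I * t ^ k)                 ≡⟨ solve 3 (λ a b c → a :* (b :* c) := b :* (a :* c)) refl t (v ^ I) (t ^ k) ⟩
        v ^ I * (t * t ^ k)                 ∎

-- Laurent polynomials over a normed commutative ring.

-- The algebra and the estimates use nothing of ℚ[i] beyond this interface. The norm is only
-- submultiplicative, because it must take rational values.
record NormedRing : Set₁ where
  infix  8 -_
  infixl 7 _*_
  infixl 6 _+_
  field
    Carrier           : Set
    _+_ _*_           : Carrier → Carrier → Carrier
    -_                : Carrier → Carrier
    0# 1#             : Carrier
    isCommutativeRing : IsCommutativeRing _≡_ _+_ _*_ -_ 0# 1#
    ‖_‖               : Carrier → ℚ
    ‖‖-nonNeg         : ∀ a → 0ℚ ℚ.≤ ‖ a ‖
    ‖0‖               : ‖ 0# ‖ ≡ 0ℚ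
    ‖1‖               : ‖ 1# ‖ ≡ 1ℚ
    ‖-‖               : ∀ a → ‖ - a ‖ ≡ ‖ a ‖
    ‖+‖               : ∀ a b → ‖ a + b ‖ ℚ.≤ ‖ a ‖ ℚ.+ ‖ b ‖
    ‖*‖               : ∀ a b → ‖ a * b ‖ ℚ.≤ ‖ a ‖ ℚ.* ‖ b ‖

  commutativeRing : CommutativeRing 0ℓ 0ℓ
  commutativeRing = record { isCommutativeRing = isCommutativeRing }

module Laurent (R : NormedRing) where
  open NormedRing R hiding (_+_; _*_; -_; 0#; 1#; Carrier; isCommutativeRing)
  open CommutativeRing (NormedRing.commutativeRing R) public
    using (_+_; _*_; _-_; -_; 0#; 1#; Carrier; *-assoc; +-comm; +-assoc; *-identityˡ; *-identityʳ;
           +-identityˡ; +-identityʳ; zeroˡ; zeroʳ; distribˡ; distribʳ; -‿inverseʳ)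
  open SemiringExp (CommutativeRing.semiring (NormedRing.commutativeRing R)) public
    using (_^_; ^-homo-*)
  open IntegerCoefficientSolver (NormedRing.commutativeRing R) public
  open ≡-Reasoning

  ∑ : ℕ → (ℕ → Carrier) → Carrier
  ∑ zero    f = 0#
  ∑ (suc n) f = ∑ n f + f n

  ∑-cong : ∀ n {f g} → (∀ i → i ℕ.< n → f i ≡ g i) → ∑ n f ≡ ∑ n g
  ∑-cong zero    f≡g = refl
  ∑-cong (suc n) f≡g = cong₂ _+_ (∑-cong n (λ i i<n → f≡g i (ℕ.m<n⇒m<1+n i<n))) (f≡g n (ℕ.n<1+n n))

  ∑-distribˡ : ∀ n a f → a * ∑ n f ≡ ∑ n (λ i → a * f i)
  ∑-distribˡ zero    a f = zeroʳ a
  ∑-distribˡ (suc n) a f = trans (distribˡ a (∑ n f) (f n)) (cong (_+ a * f n) (∑-distribˡ n a f))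

  ∑-head : ∀ n f → ∑ (suc n) f ≡ f 0 + ∑ n (λ i → f (suc i))
  ∑-head zero    f = +-comm 0# (f 0)
  ∑-head (suc n) f = trans (cong (_+ f (suc n)) (∑-head n f)) (+-assoc (f 0) (∑ n (λ i → f (suc i))) (f (suc n)))

  ∑-+ : ∀ n f g → ∑ n f + ∑ n g ≡ ∑ n (λ i → f i + g i)
  ∑-+ zero    f g = +-identityˡ 0#
  ∑-+ (suc n) f g = trans
    (solve 4 (λ a b c d → (a :+ b) :+ (c :+ d) := (a :+ c) :+ (b :+ d)) refl (∑ n f) (f n) (∑ n g) (g n))
    (cong (_+ (f n + g n)) (∑-+ n f g))

  -1*-1≡1 : - 1# * - 1# ≡ 1#
  -1*-1≡1 = solve 0 (:- con (+ 1) :* :- con (+ 1) := con (+ 1)) refl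

  -- A sequence a : ℤ → Carrier of finite support stands for the Laurent polynomial ∑ a k z ^ k.

  LaurentSeq : Set
  LaurentSeq = ℤ → Carrier

  infix 4 _≗_
  _≗_ : LaurentSeq → LaurentSeq → Set
  a ≗ b = ∀ k → a k ≡ b k

  unit : LaurentSeq
  unit (+ zero)    = 1#
  unit (+ (suc _)) = 0#
  unit -[1+ _ ]    = 0#

  -- Multiplication by 1 - Q z, by 1 - Q / z and by (1 - Q z) (1 - Q / z).

  mul⁺ mul⁻ mul : Carrier → LaurentSeq → LaurentSeq
  mul⁺ Q a k = a k - Q * a (ℤ.pred k)
  mul⁻ Q a k = a k - Q * a (ℤ.suc k)
  mul  Q a k = (1# + Q * Q) * a k - Q * a (ℤ.pred k) - Q * a (ℤ.suc k)

  mul⁺-cong : ∀ Q {a b} → a ≗ b → mul⁺ Q a ≗ mul⁺ Q b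
  mul⁺-cong Q a≗b k = cong₂ (λ x y → x - Q * y) (a≗b k) (a≗b (ℤ.pred k))

  mul⁻-cong : ∀ Q {a b} → a ≗ b → mul⁻ Q a ≗ mul⁻ Q b
  mul⁻-cong Q a≗b k = cong₂ (λ x y → x - Q * y) (a≗b k) (a≗b (ℤ.suc k))

  mul-cong : ∀ Q {a b} → a ≗ b → mul Q a ≗ mul Q b
  mul-cong Q a≗b k = cong₂ (λ x y → x - Q * y)
    (cong₂ (λ x y → (1# + Q * Q) * x - Q * y) (a≗b k) (a≗b (ℤ.pred k))) (a≗b (ℤ.suc k))

  mul⁺-comm : ∀ P Q a → mul⁺ P (mul⁺ Q a) ≗ mul⁺ Q (mul⁺ P a)
  mul⁺-comm P Q a k = solve 5 (λ P Q x y t → (x :- Q :* y) :- P :* (y :- Q :* t) := (x :- P :* y) :- Q :* (y :- P :* t))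
    refl P Q (a k) (a (ℤ.pred k)) (a (ℤ.pred (ℤ.pred k)))

  mul⁻-comm : ∀ P Q a → mul⁻ P (mul⁻ Q a) ≗ mul⁻ Q (mul⁻ P a)
  mul⁻-comm P Q a k = solve 5 (λ P Q x y t → (x :- Q :* y) :- P :* (y :- Q :* t) := (x :- P :* y) :- Q :* (y :- P :* t))
    refl P Q (a k) (a (ℤ.suc k)) (a (ℤ.suc (ℤ.suc k)))

  mul⁺-mul⁻-comm : ∀ P Q a → mul⁺ P (mul⁻ Q a) ≗ mul⁻ Q (mul⁺ P a)
  mul⁺-mul⁻-comm P Q a k rewrite ℤ.suc-pred k | ℤ.pred-suc k =
    solve 5 (λ P Q x y t → (x :- Q :* t) :- P :* (y :- Q :* x) := (x :- P :* y) :- Q :* (t :- P :* x))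
      refl P Q (a k) (a (ℤ.pred k)) (a (ℤ.suc k))

  mul-factor : ∀ Q a → mul Q a ≗ mul⁺ Q (mul⁻ Q a)
  mul-factor Q a k rewrite ℤ.suc-pred k =
    solve 4 (λ Q x y t → (con (+ 1) :+ Q :* Q) :* x :- Q :* y :- Q :* t := (x :- Q :* t) :- Q :* (y :- Q :* x))
      refl Q (a k) (a (ℤ.pred k)) (a (ℤ.suc k))

  mul-comm : ∀ P Q a → mul P (mul Q a) ≗ mul Q (mul P a)
  mul-comm P Q a k rewrite ℤ.suc-pred k | ℤ.pred-suc k =
    solve 7 (λ P Q x x⁻ x⁺ x⁻⁻ x⁺⁺ →
      let m = λ Q x y t → (con (+ 1) :+ Q :* Q) :* x :- Q :* y :- Q :* t in
      m P (m Q x x⁻ x⁺) (m Q x⁻ x⁻⁻ x) (m Q x⁺ x x⁺⁺) := m Q (m P x x⁻ x⁺) (m P x⁻ x⁻⁻ x) (m P x⁺ x x⁺⁺))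
      refl P Q (a k) (a (ℤ.pred k)) (a (ℤ.suc k)) (a (ℤ.pred (ℤ.pred k))) (a (ℤ.suc (ℤ.suc k)))

  mul-mul⁻-comm : ∀ P Q a → mul P (mul⁻ Q a) ≗ mul⁻ Q (mul P a)
  mul-mul⁻-comm P Q a k = begin
    mul P (mul⁻ Q a) k              ≡⟨ mul-factor P (mul⁻ Q a) k ⟩
    mul⁺ P (mul⁻ P (mul⁻ Q a)) k    ≡⟨ mul⁺-cong P (mul⁻-comm P Q a) k ⟩
    mul⁺ P (mul⁻ Q (mul⁻ P a)) k    ≡⟨ mul⁺-mul⁻-comm P Q (mul⁻ P a) k ⟩
    mul⁻ Q (mul⁺ P (mul⁻ P a)) k    ≡⟨ mul⁻-cong Q (λ k → sym (mul-factor P a k)) k ⟩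
    mul⁻ Q (mul P a) k              ∎

  -- Coefficients of the truncated products, telescoping, and the symmetry z ↦ q/z.

  module Coefficients (q : Carrier) where

    -- D c s is the product of (1 - z q ^ i) (1 - q ^ i / z) over s ≤ i < s + c.
    D : ℕ → ℕ → LaurentSeq
    D zero    s = unit
    D (suc c) s = mul (q ^ s) (D c (suc s))

    D-snoc : ∀ c s → D (suc c) s ≗ mul (q ^ (s ℕ.+ c)) (D c s)
    D-snoc zero s k = cong (λ i → mul (q ^ i) unit k) (sym (ℕ.+-identityʳ s))
    D-snoc (suc c) s k = begin
      mul (q ^ s) (D (suc c) (suc s)) k
        ≡⟨ mul-cong (q ^ s) (D-snoc c (suc s)) k ⟩
      mul (q ^ s) (mul (q ^ (suc s ℕ.+ c)) (D c (suc s))) k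
        ≡⟨ mul-comm (q ^ s) (q ^ (suc s ℕ.+ c)) (D c (suc s)) k ⟩
      mul (q ^ (suc s ℕ.+ c)) (D (suc c) s) k
        ≡⟨ cong (λ i → mul (q ^ i) (D (suc c) s) k) (ℕ.+-suc s c) ⟨
      mul (q ^ (s ℕ.+ suc c)) (D (suc c) s) k ∎

    -- Each pair (1 - z q^i)(1 - q^i/z) is fixed by z ↦ 1/z.
    D-reflect : ∀ c s n → D c s -[1+ n ] ≡ D c s (+ suc n)
    D-reflect zero    s n       = refl
    D-reflect (suc c) s zero
      rewrite D-reflect c (suc s) 0 | D-reflect c (suc s) 1 =
      solve 4 (λ Q x y t → (con (+ 1) :+ Q :* Q) :* x :- Q :* t :- Q :* y := (con (+ 1) :+ Q :* Q) :* x :- Q :* y :- Q :* t)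
        refl (q ^ s) (D c (suc s) (+ 1)) (D c (suc s) (+ 0)) (D c (suc s) (+ 2))
    D-reflect (suc c) s (suc n)
      rewrite D-reflect c (suc s) n | D-reflect c (suc s) (suc n) | D-reflect c (suc s) (suc (suc n)) =
      solve 4 (λ Q x y t → (con (+ 1) :+ Q :* Q) :* x :- Q :* t :- Q :* y := (con (+ 1) :+ Q :* Q) :* x :- Q :* y :- Q :* t)
        refl (q ^ s) (D c (suc s) (+ suc (suc n))) (D c (suc s) (+ suc n)) (D c (suc s) (+ suc (suc (suc n))))

    mul-zero : ∀ Q {x y t} → x ≡ 0# → y ≡ 0# → t ≡ 0# → (1# + Q * Q) * x - Q * y - Q * t ≡ 0#
    mul-zero Q refl refl refl = solve 1 (λ Q → (con (+ 1) :+ Q :* Q) :* con (+ 0) :- Q :* con (+ 0) :- Q :* con (+ 0) := con (+ 0)) refl Q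

    D-support : ∀ c s n → c ℕ.< n → D c s (+ n) ≡ 0#
    D-support zero    s (suc n) _ = refl
    D-support (suc c) s (suc n) (ℕ.s≤s c<n) = mul-zero (q ^ s)
      (D-support c (suc s) (suc n) (ℕ.m<n⇒m<1+n c<n)) (D-support c (suc s) n c<n)
      (D-support c (suc s) (suc (suc n)) (ℕ.m<n⇒m<1+n (ℕ.m<n⇒m<1+n c<n)))

    -- The coefficients (-q;q)_n q ^ (n (n + 1) / 2) of g₂.
    u : ℕ → Carrier
    u zero    = 1#
    u (suc n) = u n * ((1# + q ^ suc n) * q ^ suc n)

    -- ψ c s is the sum of u n (1 - z q ^ (n + 1)) ∏ (1 - z q ^ i) (1 - q ^ i / z) over s ≤ n < s + c,
    -- where the product is over n + 2 ≤ i ≤ s + c.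
    ψ : ℕ → ℕ → LaurentSeq
    ψ zero    s k = 0#
    ψ (suc c) s k = u s * mul⁺ (q ^ suc s) (D c (suc (suc s))) k + ψ c (suc s) k

    -- For F = ψ c s this is F(z) - F(1/z) / z, which telescopes to two boundary terms.
    ψ-telescope : ∀ c s n → ψ c s (+ n) - ψ c s -[1+ n ] ≡
      u s * mul⁻ 1# (D c (suc s)) (+ n) - u (s ℕ.+ c) * mul⁻ 1# unit (+ n)
    ψ-telescope zero s n rewrite ℕ.+-identityʳ s =
      solve 2 (λ a b → con (+ 0) :- con (+ 0) := a :* b :- a :* b) refl (u s) (mul⁻ 1# unit (+ n))
    ψ-telescope (suc c) s n
      rewrite D-reflect c (suc (suc s)) n | D-reflect c (suc (suc s)) (suc n) | ℕ.+-suc s c = begin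
      (u s * (x - Q * y) + f) - (u s * (x⁺ - Q * x⁺⁺) + g)
        ≡⟨ solve 8 (λ v Q x y x⁺ x⁺⁺ f g → (v :* (x :- Q :* y) :+ f) :- (v :* (x⁺ :- Q :* x⁺⁺) :+ g) :=
             v :* ((x :- Q :* y) :- (x⁺ :- Q :* x⁺⁺)) :+ (f :- g)) refl (u s) Q x y x⁺ x⁺⁺ f g ⟩
      u s * ((x - Q * y) - (x⁺ - Q * x⁺⁺)) + (f - g)
        ≡⟨ cong (λ e → u s * ((x - Q * y) - (x⁺ - Q * x⁺⁺)) + e) (ψ-telescope c (suc s) n) ⟩
      u s * ((x - Q * y) - (x⁺ - Q * x⁺⁺)) + (u s * ((1# + Q) * Q) * (x - 1# * x⁺) - B)
        -- In degree n this is (1 - Qz) - (1 - Q/z)/z + Q(1 + Q)(1 - 1/z) = (1 - Qz)(1 - Q/z)(1 -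
        -- 1/z); the third summand carries `u (suc s)` and comes from the induction hypothesis.
        ≡⟨ solve 7 (λ v Q x y x⁺ x⁺⁺ B →
             let m = λ x y t → (con (+ 1) :+ Q :* Q) :* x :- Q :* y :- Q :* t in
             v :* ((x :- Q :* y) :- (x⁺ :- Q :* x⁺⁺)) :+ (v :* ((con (+ 1) :+ Q) :* Q) :* (x :- con (+ 1) :* x⁺) :- B) :=
             v :* (m x y x⁺ :- con (+ 1) :* m x⁺ x x⁺⁺) :- B) refl (u s) Q x y x⁺ x⁺⁺ B ⟩
      u s * (mul Q E (+ n) - 1# * mul Q E (+ suc n)) - B ∎
      where
      Q = q ^ suc s
      E = D c (suc (suc s))
      x = E (+ n)
      y = E (ℤ.pred (+ n))
      x⁺ = E (+ suc n)
      x⁺⁺ = E (+ suc (suc n))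
      f = ψ c (suc s) (+ n)
      g = ψ c (suc s) -[1+ n ]
      B = u (suc (s ℕ.+ c)) * mul⁻ 1# unit (+ n)

    -- Invariance of the Laurent polynomial under z ↦ q / z.
    Invariant : LaurentSeq → Set
    Invariant a = ∀ n → a -[1+ n ] ≡ q ^ suc n * a (+ suc n)

    -- z ↦ q/z exchanges the factors 1 - Qz and 1 - qQ/z.
    Invariant-twist : ∀ Q a → Invariant a → Invariant (mul⁺ Q (mul⁻ (q * Q) a))
    Invariant-twist Q a inv zero rewrite inv 0 | inv 1 =
      solve 5 (λ q Q x y t → ((q :* con (+ 1)) :* x :- (q :* Q) :* y) :- Q :* ((q :* (q :* con (+ 1))) :* t :- (q :* Q) :* ((q :* con (+ 1)) :* x)) :=
        (q :* con (+ 1)) :* ((x :- (q :* Q) :* t) :- Q :* (y :- (q :* Q) :* x))) refl q Q (a (+ 1)) (a (+ 0)) (a (+ 2))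
    Invariant-twist Q a inv (suc n) rewrite inv n | inv (suc n) | inv (suc (suc n)) =
      solve 6 (λ q p Q x y t → ((q :* (q :* p)) :* x :- (q :* Q) :* ((q :* p) :* y)) :- Q :* ((q :* (q :* (q :* p))) :* t :- (q :* Q) :* ((q :* (q :* p)) :* x)) :=
        (q :* (q :* p)) :* ((x :- (q :* Q) :* t) :- Q :* (y :- (q :* Q) :* x))) refl q (q ^ n) Q
        (a (+ suc (suc n))) (a (+ suc n)) (a (+ suc (suc (suc n))))

    Invariant-cong : ∀ {a b} → a ≗ b → Invariant a → Invariant b
    Invariant-cong a≗b inv n = trans (sym (a≗b -[1+ n ])) (trans (inv n) (cong (q ^ suc n *_) (a≗b (+ suc n))))

    Invariant-unit : Invariant unit
    Invariant-unit n = sym (zeroʳ (q ^ suc n))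

    -- The factors pair off as 1 - z q^i with 1 - q^(i+1)/z for s < i ≤ s + c + 1; the outer `mul⁻`
    -- supplies the partner of the last one.
    invariant-product : ∀ c s → Invariant (mul⁻ (q ^ suc (suc (s ℕ.+ c))) (mul⁺ (q ^ suc s) (D c (suc (suc s)))))
    invariant-product zero s rewrite ℕ.+-identityʳ s =
      Invariant-cong (mul⁺-mul⁻-comm (q ^ suc s) (q ^ suc (suc s)) unit) (Invariant-twist (q ^ suc s) unit Invariant-unit)
    invariant-product (suc c) s = Invariant-cong eq
      (Invariant-twist Q (mul⁻ Q (mul⁺ P E)) (invariant-product c s))
      where
      P = q ^ suc s
      Q = q ^ suc (suc (s ℕ.+ c))
      E = D c (suc (suc s))
      eq : mul⁺ Q (mul⁻ (q * Q) (mul⁻ Q (mul⁺ P E))) ≗ mul⁻ (q ^ suc (suc (s ℕ.+ suc c))) (mul⁺ P (D (suc c) (suc (suc s))))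
      eq k = begin
        mul⁺ Q (mul⁻ (q * Q) (mul⁻ Q (mul⁺ P E))) k   ≡⟨ mul⁺-mul⁻-comm Q (q * Q) (mul⁻ Q (mul⁺ P E)) k ⟩
        mul⁻ (q * Q) (mul⁺ Q (mul⁻ Q (mul⁺ P E))) k   ≡⟨ mul⁻-cong (q * Q) (mul⁺-cong Q (mul⁺-mul⁻-comm P Q E)) k ⟨
        mul⁻ (q * Q) (mul⁺ Q (mul⁺ P (mul⁻ Q E))) k   ≡⟨ mul⁻-cong (q * Q) (mul⁺-comm Q P (mul⁻ Q E)) k ⟩
        mul⁻ (q * Q) (mul⁺ P (mul⁺ Q (mul⁻ Q E))) k   ≡⟨ mul⁻-cong (q * Q) (mul⁺-cong P (mul-factor Q E)) k ⟨
        mul⁻ (q * Q) (mul⁺ P (mul Q E)) k             ≡⟨ mul⁻-cong (q * Q) (mul⁺-cong P (D-snoc c (suc (suc s)))) k ⟨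
        mul⁻ (q * Q) (mul⁺ P (D (suc c) (suc (suc s)))) k
          ≡⟨ cong (λ i → mul⁻ (q ^ suc (suc i)) (mul⁺ P (D (suc c) (suc (suc s)))) k) (ℕ.+-suc s c) ⟨
        mul⁻ (q ^ suc (suc (s ℕ.+ suc c))) (mul⁺ P (D (suc c) (suc (suc s)))) k ∎

    -- All summands of `ψ c s` end at the same exponent s + c, so one factor completes every one of
    -- them.
    invariant-ψ : ∀ c s → Invariant (mul⁻ (q ^ suc (s ℕ.+ c)) (ψ c s))
    invariant-ψ zero s n = solve 2 (λ a b → con (+ 0) :- a :* con (+ 0) := b :* (con (+ 0) :- a :* con (+ 0)))
      refl (q ^ suc (s ℕ.+ 0)) (q ^ suc n)
    invariant-ψ (suc c) s n rewrite ℕ.+-suc s c = begin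
      (u s * e + f) - Q * (u s * e⁺ + f⁺)
        ≡⟨ solve 6 (λ v Q e e⁺ f f⁺ → (v :* e :+ f) :- Q :* (v :* e⁺ :+ f⁺) := v :* (e :- Q :* e⁺) :+ (f :- Q :* f⁺))
             refl (u s) Q e e⁺ f f⁺ ⟩
      u s * (e - Q * e⁺) + (f - Q * f⁺)
        ≡⟨ cong₂ (λ a b → u s * a + b) (invariant-product c s n) (invariant-ψ c (suc s) n) ⟩
      u s * (X * (d - Q * d⁺)) + X * (h - Q * h⁺)
        ≡⟨ solve 7 (λ v Q e e⁺ f f⁺ X → v :* (X :* (e :- Q :* e⁺)) :+ X :* (f :- Q :* f⁺) := X :* ((v :* e :+ f) :- Q :* (v :* e⁺ :+ f⁺)))
             refl (u s) Q d d⁺ h h⁺ X ⟩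
      X * ((u s * d + h) - Q * (u s * d⁺ + h⁺)) ∎
      where
      X = q ^ suc n
      Q = q ^ suc (suc (s ℕ.+ c))
      E = mul⁺ (q ^ suc s) (D c (suc (suc s)))
      e = E -[1+ n ]
      e⁺ = E (ℤ.suc -[1+ n ])
      f = ψ c (suc s) -[1+ n ]
      f⁺ = ψ c (suc s) (ℤ.suc -[1+ n ])
      d = E (+ suc n)
      d⁺ = E (+ suc (suc n))
      h = ψ c (suc s) (+ suc n)
      h⁺ = ψ c (suc s) (+ suc (suc n))

    -- The finite Jacobi triple product.

    θ : ℕ → Carrier
    θ zero    = 1#
    θ (suc n) = - (q ^ suc n * θ n)

    qq : ℕ → Carrier
    qq zero    = 1#
    qq (suc n) = qq n * (1# - q ^ suc n)

    -- The coefficients of ∏ (1 - z q ^ i) (1 - q ^ (i - 1) / z), 1 ≤ i ≤ N, times 1 - q ^ N / z.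
    J : ℕ → LaurentSeq
    J N = mul⁻ 1# (D N 1)

    J-suc : ∀ N → J (suc N) ≗ mul (q ^ suc N) (J N)
    J-suc N k = trans (mul⁻-cong 1# (D-snoc N 1) k) (sym (mul-mul⁻-comm (q ^ suc N) 1# (D N 1) k))

    J-support : ∀ N n → N ℕ.< n → J N (+ n) ≡ 0#
    J-support N n N<n rewrite D-support N 1 n N<n | D-support N 1 (suc n) (ℕ.m<n⇒m<1+n N<n) =
      solve 0 (con (+ 0) :- con (+ 1) :* con (+ 0) := con (+ 0)) refl

    -- 1 - z = -z (1 - 1/z), while `D` is symmetric. This keeps the induction below within n ≥ 0.
    J-reflect : ∀ N → J N -[1+ 0 ] ≡ - J N (+ 0)
    J-reflect N rewrite D-reflect N 1 0 =
      solve 2 (λ x y → y :- con (+ 1) :* x := :- (x :- con (+ 1) :* y)) refl (D N 1 (+ 0)) (D N 1 (+ 1))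

    -- Division-free form of J N (n) = θ n times the q-binomial coefficient of 2N + 1 over l = N -
    -- n. In the induction step, with α = q^l and β = q^(N+n+1), so that αβ = Q², the recurrence
    -- `J-suc` becomes (1 + αβ)(1 - α)(1 - qβ) + α(1 - β)(1 - qβ) + β(1 - α)(q - α) = (1 - αβ)(1 -
    -- qαβ).
    triple-product : ∀ N n l → n ℕ.+ l ≡ N → J N (+ n) * (qq l * qq (suc (N ℕ.+ n))) ≡ θ n * qq (suc (N ℕ.+ N))
    triple-product zero zero zero refl =
      solve 1 (λ q → let f = con (+ 1) :* (con (+ 1) :- q :* con (+ 1)) in
        (con (+ 1) :- con (+ 1) :* con (+ 0)) :* (con (+ 1) :* f) := con (+ 1) :* f) refl q
    triple-product (suc N) n l n+l≡1+N = begin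
      J (suc N) (+ n) * X
        ≡⟨ cong (_* X) (J-suc N (+ n)) ⟩
      ((1# + Q * Q) * J N (+ n) - Q * J N (ℤ.pred (+ n)) - Q * J N (+ suc n)) * X
        ≡⟨ solve 5 (λ Q a b c X → ((con (+ 1) :+ Q :* Q) :* a :- Q :* b :- Q :* c) :* X :=
             (con (+ 1) :+ Q :* Q) :* (a :* X) :+ (:- (Q :* b :* X)) :+ (:- (Q :* c :* X))) refl Q (J N (+ n)) (J N (ℤ.pred (+ n))) (J N (+ suc n)) X ⟩
      (1# + Q * Q) * (J N (+ n) * X) + - (Q * J N (ℤ.pred (+ n)) * X) + - (Q * J N (+ suc n) * X)
        ≡⟨ cong₂ _+_ (cong₂ (λ a b → (1# + a) * b + - (Q * J N (ℤ.pred (+ n)) * X)) Q²≡αβ (middle n l n+l≡1+N)) refl ⟩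
      (1# + α * β) * (t * (1# - α) * (1# - q * β)) + - (Q * J N (ℤ.pred (+ n)) * X) + - (Q * J N (+ suc n) * X)
        ≡⟨ cong₂ (λ a b → (1# + α * β) * (t * (1# - α) * (1# - q * β)) + a + b) (left n l n+l≡1+N) (right n l n+l≡1+N) ⟩
      (1# + α * β) * (t * (1# - α) * (1# - q * β)) + α * t * (1# - β) * (1# - q * β) + β * t * (1# - α) * (q - α)
        ≡⟨ solve 4 (λ q t α β →
             (con (+ 1) :+ α :* β) :* (t :* (con (+ 1) :- α) :* (con (+ 1) :- q :* β))
               :+ α :* t :* (con (+ 1) :- β) :* (con (+ 1) :- q :* β) :+ β :* t :* (con (+ 1) :- α) :* (q :- α) :=
             t :* (con (+ 1) :- α :* β) :* (con (+ 1) :- q :* (α :* β))) refl q t α β ⟩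
      t * (1# - α * β) * (1# - q * (α * β))
        ≡⟨ cong (λ a → t * (1# - a) * (1# - q * a)) αβ≡ ⟩
      θ n * qq (suc (N ℕ.+ N)) * (1# - q ^ suc (suc (N ℕ.+ N))) * (1# - q ^ suc (suc (suc (N ℕ.+ N))))
        ≡⟨ solve 4 (λ a b c d → a :* b :* c :* d := a :* (b :* c :* d)) refl (θ n) (qq (suc (N ℕ.+ N))) _ _ ⟩
      θ n * qq (suc (suc (suc (N ℕ.+ N))))
        ≡⟨ cong (λ i → θ n * qq (suc (suc i))) (ℕ.+-suc N N) ⟨
      θ n * qq (suc (suc N ℕ.+ suc N)) ∎
      where
      Q = q ^ suc N
      X = qq l * qq (suc (suc N ℕ.+ n))
      t = θ n * qq (suc (N ℕ.+ N))
      α = q ^ l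
      β = q ^ suc (N ℕ.+ n)

      exponent : l ℕ.+ suc (N ℕ.+ n) ≡ suc N ℕ.+ suc N
      exponent = begin
        l ℕ.+ suc (N ℕ.+ n)      ≡⟨ ℕ.+-suc l (N ℕ.+ n) ⟩
        suc (l ℕ.+ (N ℕ.+ n))    ≡⟨ cong suc (ℕ.+-comm l (N ℕ.+ n)) ⟩
        suc (N ℕ.+ n ℕ.+ l)      ≡⟨ cong suc (ℕ.+-assoc N n l) ⟩
        suc (N ℕ.+ (n ℕ.+ l))    ≡⟨ cong (λ i → suc (N ℕ.+ i)) n+l≡1+N ⟩
        suc (N ℕ.+ suc N)        ∎

      Q²≡αβ : Q * Q ≡ α * β
      Q²≡αβ = begin
        Q * Q                        ≡⟨ ^-homo-* q (suc N) (suc N) ⟨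
        q ^ (suc N ℕ.+ suc N)        ≡⟨ cong (q ^_) exponent ⟨
        q ^ (l ℕ.+ suc (N ℕ.+ n))    ≡⟨ ^-homo-* q l (suc (N ℕ.+ n)) ⟩
        α * β                        ∎

      αβ≡ : α * β ≡ q ^ suc (suc (N ℕ.+ N))
      αβ≡ = trans (sym Q²≡αβ) (trans (sym (^-homo-* q (suc N) (suc N))) (cong (λ i → q ^ suc i) (ℕ.+-suc N N)))

      -- For l = 0 the degree n = N + 1 lies outside the support, which matches 1 - q^l = 0.
      middle : ∀ n l → n ℕ.+ l ≡ suc N → J N (+ n) * (qq l * qq (suc (suc N ℕ.+ n))) ≡
        θ n * qq (suc (N ℕ.+ N)) * (1# - q ^ l) * (1# - q * q ^ suc (N ℕ.+ n))
      middle n zero n+0≡1+N rewrite J-support N n (ℕ.≤-reflexive (sym (trans (sym (ℕ.+-identityʳ n)) n+0≡1+N))) =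
        solve 3 (λ x a b → con (+ 0) :* x := a :* (con (+ 1) :- con (+ 1)) :* b) refl _ _ _
      middle n (suc l) n+1+l≡1+N = begin
        j * (qq l * a * (b * c))      ≡⟨ solve 5 (λ j l a b c → j :* (l :* a :* (b :* c)) := j :* (l :* b) :* a :* c) refl j (qq l) a b c ⟩
        j * (qq l * b) * a * c        ≡⟨ cong (λ e → e * a * c) (triple-product N n l (ℕ.suc-injective (trans (sym (ℕ.+-suc n l)) n+1+l≡1+N))) ⟩
        θ n * qq (suc (N ℕ.+ N)) * a * c ∎
        where
        j = J N (+ n)
        a = 1# - q ^ suc l
        b = qq (suc (N ℕ.+ n))
        c = 1# - q * q ^ suc (N ℕ.+ n)

      left : ∀ n l → n ℕ.+ l ≡ suc N → - (Q * J N (ℤ.pred (+ n)) * (qq l * qq (suc (suc N ℕ.+ n)))) ≡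
        q ^ l * (θ n * qq (suc (N ℕ.+ N))) * (1# - q ^ suc (N ℕ.+ n)) * (1# - q * q ^ suc (N ℕ.+ n))
      left zero l refl = begin
        - (Q * J N -[1+ 0 ] * (qq N * (1# - Q) * (b * c)))
          ≡⟨ cong (λ j → - (Q * j * (qq N * (1# - Q) * (b * c)))) (J-reflect N) ⟩
        - (Q * (- j) * (qq N * (1# - Q) * (b * c)))
          ≡⟨ solve 5 (λ Q j n b c → :- (Q :* (:- j) :* (n :* (con (+ 1) :- Q) :* (b :* c))) := Q :* (j :* (n :* b)) :* (con (+ 1) :- Q) :* c)
               refl Q j (qq N) b c ⟩
        Q * (j * (qq N * b)) * (1# - Q) * c
          ≡⟨ cong₂ (λ e i → Q * e * (1# - q ^ suc i) * c) (triple-product N 0 N refl) (sym (ℕ.+-identityʳ N)) ⟩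
        Q * (θ 0 * qq (suc (N ℕ.+ N))) * (1# - q ^ suc (N ℕ.+ 0)) * c ∎
        where
        j = J N (+ 0)
        b = qq (suc (N ℕ.+ 0))
        c = 1# - q * q ^ suc (N ℕ.+ 0)
      left (suc n) l 1+n+l≡1+N rewrite ℕ.+-suc N n = begin
        - (Q * j * (qq l * (b * c * d)))
          ≡⟨ cong (λ p → - (p * j * (qq l * (b * c * d)))) Q≡ ⟩
        - (q ^ suc n * q ^ l * j * (qq l * (b * c * d)))
          ≡⟨ solve 7 (λ p α j l b c d → :- (p :* α :* j :* (l :* (b :* c :* d))) := α :* (:- p :* (j :* (l :* b))) :* c :* d)
               refl (q ^ suc n) (q ^ l) j (qq l) b c d ⟩
        q ^ l * (- q ^ suc n * (j * (qq l * b))) * c * d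
          ≡⟨ cong (λ e → q ^ l * (- q ^ suc n * e) * c * d) (triple-product N n l n+l≡N) ⟩
        q ^ l * (- q ^ suc n * (θ n * qq (suc (N ℕ.+ N)))) * c * d
          ≡⟨ cong (λ e → q ^ l * e * c * d) (solve 3 (λ a b c → :- a :* (b :* c) := :- (a :* b) :* c) refl (q ^ suc n) (θ n) (qq (suc (N ℕ.+ N)))) ⟩
        q ^ l * (θ (suc n) * qq (suc (N ℕ.+ N))) * c * d ∎
        where
        j = J N (+ n)
        b = qq (suc (N ℕ.+ n))
        c = 1# - q ^ suc (suc (N ℕ.+ n))
        d = 1# - q ^ suc (suc (suc (N ℕ.+ n)))
        n+l≡N = ℕ.suc-injective 1+n+l≡1+N
        Q≡ : Q ≡ q ^ suc n * q ^ l
        Q≡ = trans (cong (q ^_) (sym 1+n+l≡1+N)) (^-homo-* q (suc n) l)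

      -- The two degrees outside the support, l = 0 and l = 1, are the zeros of (1 - a)(q - a) at a
      -- = q^l.
      right-zero : ∀ {j} x y v a → j ≡ 0# → (1# - a) * (q - a) ≡ 0# → - (Q * j * x) ≡ y * v * (1# - a) * (q - a)
      right-zero x y v a refl e = begin
        - (Q * 0# * x)                 ≡⟨ solve 2 (λ Q x → :- (Q :* con (+ 0) :* x) := con (+ 0)) refl Q x ⟩
        0#                             ≡⟨ zeroʳ (y * v) ⟨
        y * v * 0#                     ≡⟨ cong (y * v *_) e ⟨
        y * v * ((1# - a) * (q - a))   ≡⟨ *-assoc (y * v) (1# - a) (q - a) ⟨
        y * v * (1# - a) * (q - a)     ∎

      right : ∀ n l → n ℕ.+ l ≡ suc N → - (Q * J N (+ suc n) * (qq l * qq (suc (suc N ℕ.+ n)))) ≡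
        q ^ suc (N ℕ.+ n) * (θ n * qq (suc (N ℕ.+ N))) * (1# - q ^ l) * (q - q ^ l)
      right n zero n+0≡1+N = right-zero _ _ _ _
        (J-support N (suc n) (ℕ.m<n⇒m<1+n (ℕ.≤-reflexive (sym (trans (sym (ℕ.+-identityʳ n)) n+0≡1+N)))))
        (solve 1 (λ q → (con (+ 1) :- con (+ 1)) :* (q :- con (+ 1)) := con (+ 0)) refl q)
      right n (suc zero) n+1≡1+N = right-zero _ _ _ _
        (J-support N (suc n) (ℕ.≤-reflexive (sym (trans (ℕ.+-comm 1 n) n+1≡1+N))))
        (solve 1 (λ q → (con (+ 1) :- q :* con (+ 1)) :* (q :- q :* con (+ 1)) := con (+ 0)) refl q)
      right n (suc (suc l)) n+2+l≡1+N = begin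
        - (Q * j * (qq l * (1# - q * p) * (1# - q * (q * p)) * b))
          ≡⟨ cong (λ i → - (Q * j * (qq l * (1# - q * p) * (1# - q * (q * p)) * qq (suc i)))) (ℕ.+-suc N n) ⟨
        - (Q * j * (qq l * (1# - q * p) * (1# - q * (q * p)) * b′))
          ≡⟨ solve 6 (λ Q j l b q p → :- (Q :* j :* (l :* (con (+ 1) :- q :* p) :* (con (+ 1) :- q :* (q :* p)) :* b)) :=
               :- (Q :* (j :* (l :* b)) :* (con (+ 1) :- q :* p) :* (con (+ 1) :- q :* (q :* p)))) refl Q j (qq l) b′ q p ⟩
        - (Q * (j * (qq l * b′)) * (1# - q * p) * (1# - q * (q * p)))
          ≡⟨ cong (λ e → - (Q * e * (1# - q * p) * (1# - q * (q * p)))) (triple-product N (suc n) l n+l≡N) ⟩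
        - (Q * (- (q ^ suc n * θ n) * v) * (1# - q * p) * (1# - q * (q * p)))
          ≡⟨ solve 6 (λ Q m h v q p → :- (Q :* (:- (q :* m :* h) :* v) :* (con (+ 1) :- q :* p) :* (con (+ 1) :- q :* (q :* p))) :=
               (Q :* m) :* (h :* v) :* (con (+ 1) :- q :* (q :* p)) :* (q :- q :* (q :* p))) refl Q (q ^ n) (θ n) v q p ⟩
        (Q * q ^ n) * (θ n * v) * (1# - q * (q * p)) * (q - q * (q * p))
          ≡⟨ cong (λ e → e * (θ n * v) * (1# - q * (q * p)) * (q - q * (q * p))) (sym (^-homo-* q (suc N) n)) ⟩
        q ^ suc (N ℕ.+ n) * (θ n * v) * (1# - q * (q * p)) * (q - q * (q * p)) ∎
        where
        j = J N (+ suc n)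
        p = q ^ l
        b = qq (suc (suc N ℕ.+ n))
        b′ = qq (suc (N ℕ.+ suc n))
        v = qq (suc (N ℕ.+ N))
        n+l≡N : suc n ℕ.+ l ≡ N
        n+l≡N = ℕ.suc-injective (trans (sym (trans (ℕ.+-suc n (suc l)) (cong suc (ℕ.+-suc n l)))) n+2+l≡1+N)

    -- δ (2 m) k is the coefficient of z ^ k in the term n = k + 2 m of the Hecke-type sum.
    δ : ℕ → ℕ → Carrier
    δ zero          k = θ k
    δ (suc zero)    k = 0#
    δ (suc (suc j)) k = q ^ suc k * δ j (suc k)

    -- The coefficient of z^k, k ≥ 0, collected from the Hecke terms with n < j + k.
    ρ : ℕ → ℕ → Carrier
    ρ zero    k = 0#
    ρ (suc j) k = ρ j k + δ j k

    -- One round of f_k = θ_k + q^(k+1) f_(k+1); it extends the truncation by two because m grows by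
    -- one and n - k = 2m.
    ρ-step : ∀ j k → ρ (suc (suc j)) k ≡ θ k + q ^ suc k * ρ j (suc k)
    ρ-step zero    k = solve 2 (λ t x → con (+ 0) :+ t :+ con (+ 0) := t :+ x :* con (+ 0)) refl (θ k) (q ^ suc k)
    ρ-step (suc j) k = trans (cong (_+ q ^ suc k * δ j (suc k)) (ρ-step j k))
      (solve 4 (λ t x a b → (t :+ x :* a) :+ x :* b := t :+ x :* (a :+ b)) refl (θ k) (q ^ suc k) (ρ j (suc k)) (δ j (suc k)))

    δ-odd : ∀ m k → δ (suc (m ℕ.+ m)) k ≡ 0#
    δ-odd zero    k = refl
    δ-odd (suc m) k rewrite ℕ.+-suc m m = trans (cong (q ^ suc k *_) (δ-odd m (suc k))) (zeroʳ (q ^ suc k))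

    θ-closed : ∀ n → θ n ≡ (- 1#) ^ n * q ^ triangular n
    θ-closed zero    = sym (*-identityˡ 1#)
    θ-closed (suc n) = begin
      - (q ^ suc n * θ n)
        ≡⟨ cong (λ t → - (q ^ suc n * t)) (θ-closed n) ⟩
      - (q ^ suc n * ((- 1#) ^ n * q ^ triangular n))
        ≡⟨ solve 3 (λ a s t → :- (a :* (s :* t)) := (:- con (+ 1)) :* s :* (a :* t)) refl (q ^ suc n) ((- 1#) ^ n) (q ^ triangular n) ⟩
      (- 1#) ^ suc n * (q ^ suc n * q ^ triangular n)
        ≡⟨ cong ((- 1#) ^ suc n *_) (^-homo-* q (suc n) (triangular n)) ⟨
      (- 1#) ^ suc n * q ^ triangular (suc n) ∎

    poch : Carrier → ℕ → Carrier
    poch a zero    = 1#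
    poch a (suc n) = poch a n * (1# - a * q ^ n)

    poch-head : ∀ a n → poch a (suc n) ≡ (1# - a) * poch (a * q) n
    poch-head a zero    = solve 1 (λ a → con (+ 1) :* (con (+ 1) :- a :* con (+ 1)) := (con (+ 1) :- a) :* con (+ 1)) refl a
    poch-head a (suc n) = trans (cong (_* (1# - a * (q * q ^ n))) (poch-head a n))
      (solve 4 (λ a b q p → (con (+ 1) :- a) :* b :* (con (+ 1) :- a :* (q :* p)) := (con (+ 1) :- a) :* (b :* (con (+ 1) :- a :* q :* p)))
        refl a (poch (a * q) n) q (q ^ n))

    qq≡poch : ∀ n → qq n ≡ poch q n
    qq≡poch zero    = refl
    qq≡poch (suc n) = cong (_* (1# - q ^ suc n)) (qq≡poch n)

    u≡poch : ∀ n → u n ≡ poch (- q) n * q ^ triangular n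
    u≡poch zero    = sym (*-identityˡ 1#)
    u≡poch (suc n) = begin
      u n * ((1# + q ^ suc n) * q ^ suc n)
        ≡⟨ cong (_* ((1# + q ^ suc n) * q ^ suc n)) (u≡poch n) ⟩
      poch (- q) n * q ^ triangular n * ((1# + q ^ suc n) * q ^ suc n)
        ≡⟨ solve 4 (λ a t q p → a :* t :* ((con (+ 1) :+ q :* p) :* (q :* p)) := a :* (con (+ 1) :- (:- q) :* p) :* ((q :* p) :* t))
             refl (poch (- q) n) (q ^ triangular n) q (q ^ n) ⟩
      poch (- q) (suc n) * (q ^ suc n * q ^ triangular n)
        ≡⟨ cong (poch (- q) (suc n) *_) (^-homo-* q (suc n) (triangular n)) ⟨
      poch (- q) (suc n) * q ^ triangular (suc n) ∎

    -- For s ≥ 1 the quotient of (q;q)_(s+c-1) by (q;q)_(s-1), available without division.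
    seg : ℕ → ℕ → Carrier
    seg zero    s = 1#
    seg (suc c) s = seg c s * (1# - q ^ (s ℕ.+ c))

    qq-seg : ∀ m c → qq (m ℕ.+ c) ≡ qq m * seg c (suc m)
    qq-seg m zero    = trans (cong qq (ℕ.+-identityʳ m)) (sym (*-identityʳ (qq m)))
    qq-seg m (suc c) = trans (cong qq (ℕ.+-suc m c))
      (trans (cong (_* (1# - q ^ suc (m ℕ.+ c))) (qq-seg m c)) (*-assoc (qq m) (seg c (suc m)) (1# - q ^ suc (m ℕ.+ c))))

    ψ-support : ∀ c s n → c ℕ.< n → ψ c s (+ n) ≡ 0#
    ψ-support zero    s n       _           = refl
    ψ-support (suc c) s (suc n) (ℕ.s≤s c<n)
      rewrite D-support c (suc (suc s)) (suc n) (ℕ.m<n⇒m<1+n c<n) | D-support c (suc (suc s)) n c<n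
            | ψ-support c (suc s) (suc n) (ℕ.m<n⇒m<1+n c<n) =
      solve 2 (λ v Q → v :* (con (+ 0) :- Q :* con (+ 0)) :+ con (+ 0) := con (+ 0)) refl (u s) (q ^ suc s)

    -- The telescoping identity together with the invariance under z ↦ q / z, up to an error of order q ^ N.
    ψ-recurrence : ∀ N k → ψ N 0 (+ k) - q ^ suc k * ψ N 0 (+ suc k) ≡
      J N (+ k) - u N * mul⁻ 1# unit (+ k) + q ^ suc N * (ψ N 0 (ℤ.suc -[1+ k ]) - q ^ suc k * ψ N 0 (+ suc (suc k)))
    ψ-recurrence N k = begin
      f - X * f₁
        ≡⟨ solve 6 (λ f f₁ f₂ g h X → f :- X :* f₁ := (f :- g) :+ g :- X :* f₁) refl f f₁ f₂ g h X ⟩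
      (f - g) + g - X * f₁
        ≡⟨ solve 7 (λ f f₁ f₂ g h X P → (f :- g) :+ g :- X :* f₁ := (f :- g) :+ (g :- P :* h) :+ P :* h :- X :* f₁) refl f f₁ f₂ g h X P ⟩
      (f - g) + (g - P * h) + P * h - X * f₁
        ≡⟨ cong₂ (λ a c → a + c + P * h - X * f₁) (ψ-telescope N 0 k) (invariant-ψ N 0 k) ⟩
      (1# * J N (+ k) - u N * m) + X * (f₁ - P * f₂) + P * h - X * f₁
        ≡⟨ solve 7 (λ j e f₁ f₂ h X P → (con (+ 1) :* j :- e) :+ X :* (f₁ :- P :* f₂) :+ P :* h :- X :* f₁ :=
             j :- e :+ P :* (h :- X :* f₂)) refl (J N (+ k)) (u N * m) f₁ f₂ h X P ⟩
      J N (+ k) - u N * m + P * (h - X * f₂) ∎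
      where
      X = q ^ suc k
      P = q ^ suc N
      m = mul⁻ 1# unit (+ k)
      f = ψ N 0 (+ k)
      f₁ = ψ N 0 (+ suc k)
      f₂ = ψ N 0 (+ suc (suc k))
      g = ψ N 0 -[1+ k ]
      h = ψ N 0 (ℤ.suc -[1+ k ])

    -- Five errors: the inherited one at k + 1, the triple product, the boundary term of the
    -- telescoping, the missing factor for z ↦ q/z, and the cut-off of `ρ`. C will be (q;q)_N.
    positive-split : ∀ C N i k → let X = q ^ suc k; um = u N * mul⁻ 1# unit (+ k) in
      C * ψ N 0 (+ k) - ρ (suc i) k ≡
      X * (C * ψ N 0 (+ suc k) - ρ i (suc k)) + (C * J N (+ k) - θ k) - C * um
        + C * (q ^ suc N * (ψ N 0 (ℤ.suc -[1+ k ]) - X * ψ N 0 (+ suc (suc k)))) + (θ k + X * ρ i (suc k) - ρ (suc i) k)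
    positive-split C N i k = begin
      C * f - ρ (suc i) k
        ≡⟨ solve 5 (λ C f f₁ X r → C :* f :- r := C :* (f :- X :* f₁) :+ C :* (X :* f₁) :- r) refl C f f₁ X (ρ (suc i) k) ⟩
      C * (f - X * f₁) + C * (X * f₁) - ρ (suc i) k
        ≡⟨ cong (λ e → C * e + C * (X * f₁) - ρ (suc i) k) (ψ-recurrence N k) ⟩
      C * (j - um + h) + C * (X * f₁) - ρ (suc i) k
        ≡⟨ solve 9 (λ C j e h X f₁ r₁ r t → C :* (j :- e :+ h) :+ C :* (X :* f₁) :- r :=
             X :* (C :* f₁ :- r₁) :+ (C :* j :- t) :- C :* e :+ C :* h :+ (t :+ X :* r₁ :- r)) refl C j um h X f₁ (ρ i (suc k)) (ρ (suc i) k) (θ k) ⟩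
      X * (C * f₁ - ρ i (suc k)) + (C * j - θ k) - C * um + C * h + (θ k + X * ρ i (suc k) - ρ (suc i) k) ∎
      where
      X = q ^ suc k
      f = ψ N 0 (+ k)
      f₁ = ψ N 0 (+ suc k)
      j = J N (+ k)
      um = u N * mul⁻ 1# unit (+ k)
      h = q ^ suc N * (ψ N 0 (ℤ.suc -[1+ k ]) - X * ψ N 0 (+ suc (suc k)))

    -- The exact telescoping expresses ψ at -k - 1 through ψ at k, so the negative degrees need no
    -- second descent.
    negative-split : ∀ C N i k → C * ψ N 0 -[1+ k ] - (ρ (suc i) k - θ k) ≡
      (C * ψ N 0 (+ k) - ρ (suc i) k) - ((C * J N (+ k) - θ k) - C * (u N * mul⁻ 1# unit (+ k)))
    negative-split C N i k = begin
      C * g - (ρ (suc i) k - θ k)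
        ≡⟨ solve 5 (λ C g f r t → C :* g :- (r :- t) := (C :* f :- r) :- (C :* (f :- g) :- t)) refl C g f (ρ (suc i) k) (θ k) ⟩
      (C * f - ρ (suc i) k) - (C * (f - g) - θ k)
        ≡⟨ cong (λ e → (C * f - ρ (suc i) k) - (C * e - θ k)) (ψ-telescope N 0 k) ⟩
      (C * f - ρ (suc i) k) - (C * (1# * j - um) - θ k)
        ≡⟨ solve 6 (λ C f r j e t → (C :* f :- r) :- (C :* (con (+ 1) :* j :- e) :- t) := (C :* f :- r) :- ((C :* j :- t) :- C :* e)) refl
             C f (ρ (suc i) k) j um (θ k) ⟩
      (C * f - ρ (suc i) k) - ((C * j - θ k) - C * um) ∎
      where
      f = ψ N 0 (+ k)
      g = ψ N 0 -[1+ k ]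
      j = J N (+ k)
      um = u N * mul⁻ 1# unit (+ k)

    module Cancellation (cancel : ∀ i {a c} → a * (1# - q ^ suc i) ≡ c * (1# - q ^ suc i) → a ≡ c) where

      cancel-qq : ∀ n {a c} → a * qq n ≡ c * qq n → a ≡ c
      cancel-qq zero    {a} {c} e = trans (sym (*-identityʳ a)) (trans e (*-identityʳ c))
      cancel-qq (suc n) {a} {c} e = cancel-qq n (cancel n (trans (*-assoc a (qq n) (1# - q ^ suc n)) (trans e (sym (*-assoc c (qq n) (1# - q ^ suc n))))))

      -- The triple product divided by (q;q)_(N+n+1). Both segments differ from 1 by O(r^l), which
      -- is how `θ` emerges as the limit.
      J-closed : ∀ l n → qq (l ℕ.+ n) * J (l ℕ.+ n) (+ n) ≡ θ n * (seg n (suc l) * seg l (suc (suc (l ℕ.+ n ℕ.+ n))))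
      J-closed l n = begin
        qq N * j                             ≡⟨ cong (_* j) (qq-seg l n) ⟩
        qq l * seg n (suc l) * j             ≡⟨ solve 3 (λ a b c → a :* b :* c := (c :* a) :* b) refl (qq l) (seg n (suc l)) j ⟩
        (j * qq l) * seg n (suc l)           ≡⟨ cong (_* seg n (suc l)) (cancel-qq (suc (N ℕ.+ n)) j*qq) ⟩
        (θ n * s) * seg n (suc l)            ≡⟨ solve 3 (λ a b c → (a :* b) :* c := a :* (c :* b)) refl (θ n) s (seg n (suc l)) ⟩
        θ n * (seg n (suc l) * s)            ∎
        where
        N = l ℕ.+ n
        j = J N (+ n)
        s = seg l (suc (suc (N ℕ.+ n)))
        index : suc (N ℕ.+ N) ≡ suc (N ℕ.+ n) ℕ.+ l
        index = cong suc (trans (cong (N ℕ.+_) (ℕ.+-comm l n)) (sym (ℕ.+-assoc N n l)))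
        j*qq : (j * qq l) * qq (suc (N ℕ.+ n)) ≡ (θ n * s) * qq (suc (N ℕ.+ n))
        j*qq = begin
          (j * qq l) * qq (suc (N ℕ.+ n))      ≡⟨ *-assoc j (qq l) (qq (suc (N ℕ.+ n))) ⟩
          j * (qq l * qq (suc (N ℕ.+ n)))      ≡⟨ triple-product N n l (ℕ.+-comm n l) ⟩
          θ n * qq (suc (N ℕ.+ N))             ≡⟨ cong (λ i → θ n * qq i) index ⟩
          θ n * qq (suc (N ℕ.+ n) ℕ.+ l)       ≡⟨ cong (θ n *_) (qq-seg (suc (N ℕ.+ n)) l) ⟩
          θ n * (qq (suc (N ℕ.+ n)) * s)       ≡⟨ solve 3 (λ a b c → a :* (b :* c) := (a :* c) :* b) refl (θ n) (qq (suc (N ℕ.+ n))) s ⟩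
          (θ n * s) * qq (suc (N ℕ.+ n))       ∎

-- Makes `triangular n ∸ m * m` a true difference whenever 2m ≤ n. In the step the square grows by
-- 2m + 1, and one of the two added triangular rows already covers that.
square≤triangular : ∀ m j → m ℕ.* m ℕ.≤ triangular (j ℕ.+ (m ℕ.+ m))
square≤triangular zero    j = ℕ.z≤n
square≤triangular (suc m) j rewrite ℕ.+-suc m m | ℕ.+-suc j (suc (m ℕ.+ m)) | ℕ.+-suc j (m ℕ.+ m) = begin
  suc m ℕ.* suc m
    ≡⟨ solve 1 (λ m → (con 1 :+ m) :* (con 1 :+ m) := (con 1 :+ (m :+ m)) :+ m :* m) refl m ⟩
  suc (m ℕ.+ m) ℕ.+ m ℕ.* m
    ≤⟨ ℕ.+-mono-≤ (ℕ.≤-trans (ℕ.s≤s (ℕ.m≤n+m (m ℕ.+ m) j)) (ℕ.n≤1+n _))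
         (ℕ.≤-trans (square≤triangular m j) (ℕ.m≤n+m _ _)) ⟩
  suc (suc k) ℕ.+ (suc k ℕ.+ triangular k) ∎
  where
  open ℕ.≤-Reasoning
  open ℕSolver.+-*-Solver
  k = j ℕ.+ (m ℕ.+ m)

m≤⌊n/2⌋⇒m+m≤n : ∀ {m n} → m ℕ.≤ ⌊ n /2⌋ → m ℕ.+ m ℕ.≤ n
m≤⌊n/2⌋⇒m+m≤n {m} {n} h = subst (m ℕ.+ m ℕ.≤_) (ℕ.⌊n/2⌋+⌈n/2⌉≡n n)
  (ℕ.+-mono-≤ h (ℕ.≤-trans h (ℕ.⌊n/2⌋≤⌈n/2⌉ n)))

-- Evaluation at z, and the Hecke sum sorted by powers of z.

module Evaluation (R : NormedRing) (q z w : NormedRing.Carrier R)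
  (zw≡1 : NormedRing._*_ R z w ≡ NormedRing.1# R) where
  open Laurent R
  open Coefficients q
  open ≡-Reasoning

  -- The value at z, with w = 1 / z, of the part of a in degrees -K, …, K - 1.
  ev : ℕ → LaurentSeq → Carrier
  ev K a = ∑ K (λ k → a (+ k) * z ^ k + a -[1+ k ] * w ^ suc k)

  ev-cong : ∀ K {a b} → a ≗ b → ev K a ≡ ev K b
  ev-cong K a≗b = ∑-cong K (λ k _ → cong₂ (λ x y → x * z ^ k + y * w ^ suc k) (a≗b (+ k)) (a≗b -[1+ k ]))

  private
    cancel-zw : ∀ a → z * (w * a) ≡ a
    cancel-zw a = trans (sym (*-assoc z w a)) (trans (cong (_* a) zw≡1) (*-identityˡ a))

    cancel-wz : ∀ a → w * (z * a) ≡ a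
    cancel-wz a = trans (solve 3 (λ z w a → w :* (z :* a) := z :* (w :* a)) refl z w a) (cancel-zw a)

  -- The shift moves one term across each end of the window; keeping both as boundary terms makes
  -- the induction close, with zw = 1 turning z w^(k+1) into w^k.
  ev-pred : ∀ K a → z * ev K a + a -[1+ K ] * w ^ K ≡ ev K (λ k → a (ℤ.pred k)) + a (ℤ.pred (+ K)) * z ^ K
  ev-pred zero a = solve 2 (λ z x → z :* con (+ 0) :+ x :* con (+ 1) := con (+ 0) :+ x :* con (+ 1)) refl z (a -[1+ 0 ])
  ev-pred (suc K) a = begin
    z * (ev K a + (x * Z + y * (w * W))) + y⁻ * (w * W)
      ≡⟨ solve 8 (λ z w e x Z y W y⁻ → z :* (e :+ (x :* Z :+ y :* (w :* W))) :+ y⁻ :* (w :* W) :=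
           (z :* e :+ y :* W) :+ (y⁻ :* (w :* W) :+ x :* (z :* Z) :+ y :* (z :* (w :* W) :- W)))
           refl z w (ev K a) x Z y W y⁻ ⟩
    (z * ev K a + y * W) + (y⁻ * (w * W) + x * (z * Z) + y * (z * (w * W) - W))
      ≡⟨ cong₂ (λ e f → e + (y⁻ * (w * W) + x * (z * Z) + y * (f - W))) (ev-pred K a) (cancel-zw W) ⟩
    (e′ + x⁻ * Z) + (y⁻ * (w * W) + x * (z * Z) + y * (W - W))
      ≡⟨ solve 9 (λ z w e x Z y W y⁻ x⁻ → (e :+ x⁻ :* Z) :+ (y⁻ :* (w :* W) :+ x :* (z :* Z) :+ y :* (W :- W)) :=
           (e :+ (x⁻ :* Z :+ y⁻ :* (w :* W))) :+ x :* (z :* Z)) refl z w e′ x Z y W y⁻ x⁻ ⟩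
    (e′ + (x⁻ * Z + y⁻ * (w * W))) + x * (z * Z) ∎
    where
    x = a (+ K)
    y = a -[1+ K ]
    x⁻ = a (ℤ.pred (+ K))
    y⁻ = a -[1+ suc K ]
    Z = z ^ K
    W = w ^ K
    e′ = ev K (λ k → a (ℤ.pred k))

  ev-suc : ∀ K a → w * ev K a + a (+ K) * (w * z ^ K) ≡ ev K (λ k → a (ℤ.suc k)) + a (ℤ.suc -[1+ K ]) * w ^ suc K
  ev-suc zero a = solve 2 (λ w x → w :* con (+ 0) :+ x :* (w :* con (+ 1)) := con (+ 0) :+ x :* (w :* con (+ 1))) refl w (a (+ 0))
  ev-suc (suc K) a = begin
    w * (ev K a + (x * Z + y * (w * W))) + x⁺ * (w * (z * Z))
      ≡⟨ solve 7 (λ w e x Z y W f → w :* (e :+ (x :* Z :+ y :* (w :* W))) :+ f :=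
           (w :* e :+ x :* (w :* Z)) :+ (f :+ y :* (w :* (w :* W)))) refl w (ev K a) x Z y W (x⁺ * (w * (z * Z))) ⟩
    (w * ev K a + x * (w * Z)) + (x⁺ * (w * (z * Z)) + y * (w * (w * W)))
      ≡⟨ cong₂ (λ e f → e + (x⁺ * f + y * (w * (w * W)))) (ev-suc K a) (cancel-wz Z) ⟩
    (e′ + y⁺ * (w * W)) + (x⁺ * Z + y * (w * (w * W)))
      ≡⟨ solve 7 (λ w e x⁺ Z y W y⁺ → (e :+ y⁺ :* (w :* W)) :+ (x⁺ :* Z :+ y :* (w :* (w :* W))) :=
           (e :+ (x⁺ :* Z :+ y⁺ :* (w :* W))) :+ y :* (w :* (w :* W))) refl w e′ x⁺ Z y W y⁺ ⟩
    (e′ + (x⁺ * Z + y⁺ * (w * W))) + y * (w * (w * W)) ∎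
    where
    x = a (+ K)
    y = a -[1+ K ]
    x⁺ = a (+ suc K)
    y⁺ = a (ℤ.suc -[1+ K ])
    Z = z ^ K
    W = w ^ K
    e′ = ev K (λ k → a (ℤ.suc k))

  -- Three summands are what `mul` needs; shorter combinations are padded with a zero coefficient.
  ev-combine : ∀ K α β γ a b c →
    ev K (λ k → α * a k - β * b k - γ * c k) ≡ α * ev K a - β * ev K b - γ * ev K c
  ev-combine zero α β γ a b c = solve 3 (λ α β γ → con (+ 0) := α :* con (+ 0) :- β :* con (+ 0) :- γ :* con (+ 0)) refl α β γ
  ev-combine (suc K) α β γ a b c = trans
    (cong (_+ ((α * a (+ K) - β * b (+ K) - γ * c (+ K)) * z ^ K
             + (α * a -[1+ K ] - β * b -[1+ K ] - γ * c -[1+ K ]) * w ^ suc K)) (ev-combine K α β γ a b c))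
    (solve 14 (λ α β γ ea eb ec a a′ b b′ c c′ Z W →
      (α :* ea :- β :* eb :- γ :* ec) :+ ((α :* a :- β :* b :- γ :* c) :* Z :+ (α :* a′ :- β :* b′ :- γ :* c′) :* W) :=
      α :* (ea :+ (a :* Z :+ a′ :* W)) :- β :* (eb :+ (b :* Z :+ b′ :* W)) :- γ :* (ec :+ (c :* Z :+ c′ :* W)))
      refl α β γ (ev K a) (ev K b) (ev K c) (a (+ K)) (a -[1+ K ]) (b (+ K)) (b -[1+ K ]) (c (+ K)) (c -[1+ K ]) (z ^ K) (w ^ suc K))

  private
    drop-zero : ∀ {e f x y X Y} → e + x * X ≡ f + y * Y → x ≡ 0# → y ≡ 0# → f ≡ e
    drop-zero {e} {f} {X = X} {Y = Y} eq refl refl = begin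
      f             ≡⟨ solve 2 (λ f Y → f := f :+ con (+ 0) :* Y) refl f Y ⟩
      f + 0# * Y    ≡⟨ eq ⟨
      e + 0# * X    ≡⟨ solve 2 (λ f Y → f :+ con (+ 0) :* Y := f) refl e X ⟩
      e             ∎

  ev-mul⁺ : ∀ K Q a → a -[1+ suc K ] ≡ 0# → a (+ K) ≡ 0# → ev (suc K) (mul⁺ Q a) ≡ (1# - z * Q) * ev (suc K) a
  ev-mul⁺ K Q a a⁻ a⁺ = begin
    ev (suc K) (mul⁺ Q a)
      ≡⟨ ev-cong (suc K) (λ k → solve 3 (λ x y Q → x :- Q :* y := con (+ 1) :* x :- Q :* y :- con (+ 0) :* x) refl (a k) (a (ℤ.pred k)) Q) ⟩
    ev (suc K) (λ k → 1# * a k - Q * a (ℤ.pred k) - 0# * a k)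
      ≡⟨ ev-combine (suc K) 1# Q 0# a (λ k → a (ℤ.pred k)) a ⟩
    1# * e - Q * ev (suc K) (λ k → a (ℤ.pred k)) - 0# * e
      ≡⟨ cong (λ f → 1# * e - Q * f - 0# * e) (drop-zero (ev-pred (suc K) a) a⁻ a⁺) ⟩
    1# * e - Q * (z * e) - 0# * e
      ≡⟨ solve 3 (λ e Q z → con (+ 1) :* e :- Q :* (z :* e) :- con (+ 0) :* e := (con (+ 1) :- z :* Q) :* e) refl e Q z ⟩
    (1# - z * Q) * e ∎
    where e = ev (suc K) a

  -- The vanishing coefficients are the boundary terms of the two shifts; zw = 1 makes 1 + Q² - Qz -
  -- Qw factor.
  ev-mul : ∀ K Q a → a -[1+ suc K ] ≡ 0# → a -[1+ K ] ≡ 0# → a (+ K) ≡ 0# → a (+ suc K) ≡ 0# →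
    ev (suc K) (mul Q a) ≡ (1# - z * Q) * (1# - w * Q) * ev (suc K) a
  ev-mul K Q a a⁻⁻ a⁻ a⁺ a⁺⁺ = begin
    ev (suc K) (mul Q a)
      ≡⟨ ev-combine (suc K) (1# + Q * Q) Q Q a (λ k → a (ℤ.pred k)) (λ k → a (ℤ.suc k)) ⟩
    (1# + Q * Q) * e - Q * ev (suc K) (λ k → a (ℤ.pred k)) - Q * ev (suc K) (λ k → a (ℤ.suc k))
      ≡⟨ cong₂ (λ f g → (1# + Q * Q) * e - Q * f - Q * g) (drop-zero (ev-pred (suc K) a) a⁻⁻ a⁺) (drop-zero (ev-suc (suc K) a) a⁺⁺ a⁻) ⟩
    (1# + Q * Q) * e - Q * (z * e) - Q * (w * e)
      ≡⟨ solve 4 (λ Q e z w → (con (+ 1) :+ Q :* Q) :* e :- Q :* (z :* e) :- Q :* (w :* e) :=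
           (con (+ 1) :- z :* Q) :* (con (+ 1) :- w :* Q) :* e :+ (con (+ 1) :- z :* w) :* (Q :* Q :* e)) refl Q e z w ⟩
    (1# - z * Q) * (1# - w * Q) * e + (1# - z * w) * (Q * Q * e)
      ≡⟨ cong (λ p → (1# - z * Q) * (1# - w * Q) * e + (1# - p) * (Q * Q * e)) zw≡1 ⟩
    (1# - z * Q) * (1# - w * Q) * e + (1# - 1#) * (Q * Q * e)
      ≡⟨ solve 2 (λ a b → a :+ (con (+ 1) :- con (+ 1)) :* b := a) refl ((1# - z * Q) * (1# - w * Q) * e) (Q * Q * e) ⟩
    (1# - z * Q) * (1# - w * Q) * e ∎
    where e = ev (suc K) a

  V : ℕ → ℕ → Carrier
  V zero    s = 1#
  V (suc c) s = (1# - z * q ^ s) * (1# - w * q ^ s) * V c (suc s)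

  Ψ : ℕ → ℕ → Carrier
  Ψ zero    s = 0#
  Ψ (suc c) s = u s * ((1# - z * q ^ suc s) * V c (suc (suc s))) + Ψ c (suc s)

  D-support⁻ : ∀ c s n → c ℕ.≤ n → D c s -[1+ n ] ≡ 0#
  D-support⁻ c s n c≤n = trans (D-reflect c s n) (D-support c s (suc n) (ℕ.s≤s c≤n))

  ev-D : ∀ K c s → c ℕ.< K → ev K (D c s) ≡ V c s
  ev-D (suc K) zero s _ = begin
    ev (suc K) unit                                               ≡⟨ ∑-head K _ ⟩
    1# * 1# + 0# * (w * 1#) + ∑ K (λ k → 0# * z ^ suc k + 0# * w ^ suc (suc k))
      ≡⟨ cong (λ x → 1# * 1# + 0# * (w * 1#) + x) (trans (∑-cong K (λ k _ →
           solve 2 (λ a b → con (+ 0) :* a :+ con (+ 0) :* b := con (+ 0) :* a) refl (z ^ suc k) (w ^ suc (suc k))))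
           (sym (∑-distribˡ K 0# (λ k → z ^ suc k)))) ⟩
    1# * 1# + 0# * (w * 1#) + 0# * ∑ K (λ k → z ^ suc k)
      ≡⟨ solve 2 (λ w x → con (+ 1) :* con (+ 1) :+ con (+ 0) :* (w :* con (+ 1)) :+ con (+ 0) :* x := con (+ 1)) refl w (∑ K (λ k → z ^ suc k)) ⟩
    1# ∎
  ev-D (suc K) (suc c) s (ℕ.s≤s c<K) = begin
    ev (suc K) (mul (q ^ s) (D c (suc s)))
      ≡⟨ ev-mul K (q ^ s) (D c (suc s)) (D-support⁻ c (suc s) (suc K) (ℕ.m≤n⇒m≤1+n c≤K)) (D-support⁻ c (suc s) K c≤K)
           (D-support c (suc s) K c<K) (D-support c (suc s) (suc K) (ℕ.m<n⇒m<1+n c<K)) ⟩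
    (1# - z * q ^ s) * (1# - w * q ^ s) * ev (suc K) (D c (suc s))
      ≡⟨ cong ((1# - z * q ^ s) * (1# - w * q ^ s) *_) (ev-D (suc K) c (suc s) (ℕ.m<n⇒m<1+n c<K)) ⟩
    V (suc c) s ∎
    where c≤K = ℕ.<⇒≤ c<K

  ev-ψ : ∀ K c s → c ℕ.< K → ev K (ψ c s) ≡ Ψ c s
  ev-ψ K zero s _ = begin
    ev K (λ _ → 0#)                         ≡⟨ ∑-cong K (λ k _ → solve 2 (λ a b → con (+ 0) :* a :+ con (+ 0) :* b := con (+ 0) :* con (+ 0)) refl (z ^ k) (w ^ suc k)) ⟩
    ∑ K (λ _ → 0# * 0#)                     ≡⟨ ∑-distribˡ K 0# (λ _ → 0#) ⟨
    0# * ∑ K (λ _ → 0#)                     ≡⟨ zeroˡ _ ⟩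
    0#                                      ∎
  ev-ψ (suc K) (suc c) s (ℕ.s≤s c<K) = begin
    ev (suc K) (ψ (suc c) s)
      ≡⟨ ev-cong (suc K) (λ k → solve 3 (λ v a b → v :* a :+ b := v :* a :- (:- con (+ 1)) :* b :- con (+ 0) :* b) refl (u s) (E k) (ψ c (suc s) k)) ⟩
    ev (suc K) (λ k → u s * E k - (- 1#) * ψ c (suc s) k - 0# * ψ c (suc s) k)
      ≡⟨ ev-combine (suc K) (u s) (- 1#) 0# E (ψ c (suc s)) (ψ c (suc s)) ⟩
    u s * ev (suc K) E - (- 1#) * ev (suc K) (ψ c (suc s)) - 0# * ev (suc K) (ψ c (suc s))
      ≡⟨ solve 3 (λ v a b → v :* a :- (:- con (+ 1)) :* b :- con (+ 0) :* b := v :* a :+ b) refl (u s) (ev (suc K) E) (ev (suc K) (ψ c (suc s))) ⟩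
    u s * ev (suc K) E + ev (suc K) (ψ c (suc s))
      ≡⟨ cong₂ (λ a b → u s * a + b)
           (trans (ev-mul⁺ K (q ^ suc s) (D c (suc (suc s))) (D-support⁻ c (suc (suc s)) (suc K) (ℕ.m≤n⇒m≤1+n (ℕ.<⇒≤ c<K)))
             (D-support c (suc (suc s)) K c<K)) (cong ((1# - z * q ^ suc s) *_) (ev-D (suc K) c (suc (suc s)) (ℕ.m<n⇒m<1+n c<K))))
           (ev-ψ (suc K) c (suc s) (ℕ.m<n⇒m<1+n c<K)) ⟩
    Ψ (suc c) s ∎
    where E = mul⁺ (q ^ suc s) (D c (suc (suc s)))

  poch-split : ∀ c n → poch (z * q) (n ℕ.+ c) * poch (w * q) (n ℕ.+ c) ≡ poch (z * q) n * poch (w * q) n * V c (suc n)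
  poch-split zero n rewrite ℕ.+-identityʳ n = sym (*-identityʳ _)
  poch-split (suc c) n rewrite ℕ.+-suc n c = trans (poch-split c (suc n))
    (solve 7 (λ a b z w q p v → a :* (con (+ 1) :- z :* q :* p) :* (b :* (con (+ 1) :- w :* q :* p)) :* v :=
       a :* b :* ((con (+ 1) :- z :* (q :* p)) :* (con (+ 1) :- w :* (q :* p)) :* v))
       refl (poch (z * q) n) (poch (w * q) n) z w q (q ^ n) (V c (suc (suc n))))

  module _ (v : ℕ → Carrier) (v-inverse : ∀ n → v n * (poch z (suc n) * poch (w * q) (suc n)) ≡ 1#) where

    product-summand : ∀ c n → (1# - z) * (poch (z * q) (suc n ℕ.+ c) * poch (w * q) (suc n ℕ.+ c)) * v n ≡
      (1# - z * q ^ suc n) * V c (suc (suc n))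
    product-summand c n = begin
      (1# - z) * (poch (z * q) (suc n ℕ.+ c) * poch (w * q) (suc n ℕ.+ c)) * v n
        ≡⟨ cong (λ e → (1# - z) * e * v n) (poch-split c (suc n)) ⟩
      (1# - z) * (a * (1# - z * q * q ^ n) * b * x) * v n
        ≡⟨ solve 7 (λ z q p a b x v → (con (+ 1) :- z) :* (a :* (con (+ 1) :- z :* q :* p) :* b :* x) :* v :=
             v :* ((con (+ 1) :- z) :* a :* b) :* ((con (+ 1) :- z :* (q :* p)) :* x)) refl z q (q ^ n) a b x (v n) ⟩
      v n * ((1# - z) * a * b) * ((1# - z * q ^ suc n) * x)
        ≡⟨ cong (λ e → v n * (e * b) * ((1# - z * q ^ suc n) * x)) (poch-head z n) ⟨
      v n * (poch z (suc n) * b) * ((1# - z * q ^ suc n) * x)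
        ≡⟨ cong (_* ((1# - z * q ^ suc n) * x)) (v-inverse n) ⟩
      1# * ((1# - z * q ^ suc n) * x)
        ≡⟨ *-identityˡ _ ⟩
      (1# - z * q ^ suc n) * x ∎
      where
      a = poch (z * q) n
      b = poch (w * q) (suc n)
      x = V c (suc (suc n))

    -- The truncated product contains every denominator of the partial sum, so there is no error
    -- here. The case s = 0 is the one of interest; general s serves the induction.
    product-sum : ∀ c s → (1# - z) * (poch (z * q) (s ℕ.+ c) * poch (w * q) (s ℕ.+ c)) * ∑ c (λ i → u (s ℕ.+ i) * v (s ℕ.+ i)) ≡ Ψ c s
    product-sum zero s = zeroʳ _
    product-sum (suc c) s rewrite ℕ.+-suc s c = begin
      X * ∑ (suc c) (λ i → u (s ℕ.+ i) * v (s ℕ.+ i))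
        ≡⟨ cong (X *_) (∑-head c _) ⟩
      X * (u (s ℕ.+ 0) * v (s ℕ.+ 0) + ∑ c (λ i → u (s ℕ.+ suc i) * v (s ℕ.+ suc i)))
        ≡⟨ cong₂ (λ i e → X * (u i * v i + e)) (ℕ.+-identityʳ s) (∑-cong c (λ i _ → cong (λ j → u j * v j) (ℕ.+-suc s i))) ⟩
      X * (u s * v s + e)
        ≡⟨ solve 4 (λ X a b e → X :* (a :* b :+ e) := a :* (X :* b) :+ X :* e) refl X (u s) (v s) e ⟩
      u s * (X * v s) + X * e
        ≡⟨ cong₂ (λ a b → u s * a + b) (product-summand c s) (product-sum c (suc s)) ⟩
      Ψ (suc c) s ∎
      where
      X = (1# - z) * (poch (z * q) (suc s ℕ.+ c) * poch (w * q) (suc s ℕ.+ c))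
      e = ∑ c (λ i → u (suc s ℕ.+ i) * v (suc s ℕ.+ i))

  -- In the step the triangular number grows by k + 2m + 2 and the square by 2m + 1; the difference
  -- k + 1 is the exponent in the recursion of `δ`.
  δ-even : ∀ m k → δ (m ℕ.+ m) k ≡ (- 1#) ^ (m ℕ.+ (k ℕ.+ (m ℕ.+ m))) * q ^ (triangular (k ℕ.+ (m ℕ.+ m)) ℕ.∸ m ℕ.* m)
  δ-even zero    k rewrite ℕ.+-identityʳ k = θ-closed k
  δ-even (suc m) k rewrite ℕ.+-suc m m = begin
    q ^ suc k * δ (m ℕ.+ m) (suc k)
      ≡⟨ cong (q ^ suc k *_) (δ-even m (suc k)) ⟩
    q ^ suc k * ((- 1#) ^ (m ℕ.+ suc i) * q ^ (triangular (suc i) ℕ.∸ m ℕ.* m))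
      ≡⟨ solve 3 (λ a s t → a :* (s :* t) := (:- con (+ 1)) :* ((:- con (+ 1)) :* s) :* (a :* t)) refl
           (q ^ suc k) ((- 1#) ^ (m ℕ.+ suc i)) (q ^ (triangular (suc i) ℕ.∸ m ℕ.* m)) ⟩
    (- 1#) ^ suc (suc (m ℕ.+ suc i)) * (q ^ suc k * q ^ (triangular (suc i) ℕ.∸ m ℕ.* m))
      ≡⟨ cong₂ (λ a b → (- 1#) ^ suc a * b) sign (sym (^-homo-* q (suc k) (triangular (suc i) ℕ.∸ m ℕ.* m))) ⟩
    (- 1#) ^ (suc m ℕ.+ suc (suc i)) * q ^ (suc k ℕ.+ (triangular (suc i) ℕ.∸ m ℕ.* m))
      ≡⟨ cong₂ (λ a b → (- 1#) ^ (suc m ℕ.+ a) * q ^ b) (sym index) exponent ⟩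
    (- 1#) ^ (suc m ℕ.+ (k ℕ.+ suc (suc (m ℕ.+ m)))) * q ^ (triangular (k ℕ.+ suc (suc (m ℕ.+ m))) ℕ.∸ suc m ℕ.* suc m) ∎
    where
    i = k ℕ.+ (m ℕ.+ m)
    index : k ℕ.+ suc (suc (m ℕ.+ m)) ≡ suc (suc i)
    index = trans (ℕ.+-suc k (suc (m ℕ.+ m))) (cong suc (ℕ.+-suc k (m ℕ.+ m)))
    sign : suc (m ℕ.+ suc i) ≡ m ℕ.+ suc (suc i)
    sign = sym (ℕ.+-suc m (suc i))
    t = triangular (suc i)
    exponent : suc k ℕ.+ (t ℕ.∸ m ℕ.* m) ≡ triangular (k ℕ.+ suc (suc (m ℕ.+ m))) ℕ.∸ suc m ℕ.* suc m
    exponent = begin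
      suc k ℕ.+ (t ℕ.∸ m ℕ.* m)
        ≡⟨ ℕ.+-∸-assoc (suc k) (square≤triangular m (suc k)) ⟨
      suc k ℕ.+ t ℕ.∸ m ℕ.* m
        ≡⟨ ℕ.[m+n]∸[m+o]≡n∸o (suc (m ℕ.+ m)) (suc k ℕ.+ t) (m ℕ.* m) ⟨
      (suc (m ℕ.+ m) ℕ.+ (suc k ℕ.+ t)) ℕ.∸ (suc (m ℕ.+ m) ℕ.+ m ℕ.* m)
        ≡⟨ cong₂ ℕ._∸_
             (S.solve 3 (λ k m t → (S.con 1 S.:+ (m S.:+ m)) S.:+ ((S.con 1 S.:+ k) S.:+ t) S.:= (S.con 2 S.:+ (k S.:+ (m S.:+ m))) S.:+ t) refl k m t)
             (S.solve 1 (λ m → (S.con 1 S.:+ (m S.:+ m)) S.:+ m S.:* m S.:= (S.con 1 S.:+ m) S.:* (S.con 1 S.:+ m)) refl m) ⟩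
      triangular (suc (suc i)) ℕ.∸ suc m ℕ.* suc m
        ≡⟨ cong (λ j → triangular j ℕ.∸ suc m ℕ.* suc m) index ⟨
      triangular (k ℕ.+ suc (suc (m ℕ.+ m))) ℕ.∸ suc m ℕ.* suc m ∎
      where module S = ℕSolver.+-*-Solver

  -- The two largest k have offsets n - k equal to 1 and 0: the odd one drops out, the even one is
  -- the summand m = 0.
  ∑-diagonal : ∀ n (E : ℕ → ℕ → Carrier) → (∀ m k → E (suc (m ℕ.+ m)) k ≡ 0#) →
    ∑ (suc n) (λ k → E (n ℕ.∸ k) k) ≡ ∑ (suc ⌊ n /2⌋) (λ m → E (m ℕ.+ m) (n ℕ.∸ (m ℕ.+ m)))
  ∑-diagonal zero          E odd = refl
  ∑-diagonal (suc zero)    E odd = trans (cong (λ e → 0# + e + E 0 1) (odd 0 0)) (cong (_+ E 0 1) (+-identityˡ 0#))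
  ∑-diagonal (suc (suc n)) E odd = begin
    ∑ (suc n) (λ k → E (suc (suc n) ℕ.∸ k) k) + E (suc n ℕ.∸ n) (suc n) + E (n ℕ.∸ n) (suc (suc n))
      ≡⟨ cong₂ _+_ (cong₂ _+_ (∑-cong (suc n) (λ k k<1+n → cong (λ j → E j k) (ℕ.+-∸-assoc 2 (ℕ.≤-pred k<1+n))))
           (trans (cong (λ j → E j (suc n)) (ℕ.m+n∸n≡m 1 n)) (odd 0 (suc n)))) (cong (λ j → E j (suc (suc n))) (ℕ.n∸n≡0 n)) ⟩
    ∑ (suc n) (λ k → E (suc (suc (n ℕ.∸ k))) k) + 0# + E 0 (suc (suc n))
      ≡⟨ solve 2 (λ a b → a :+ con (+ 0) :+ b := b :+ a) refl _ (E 0 (suc (suc n))) ⟩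
    E 0 (suc (suc n)) + ∑ (suc n) (λ k → E (suc (suc (n ℕ.∸ k))) k)
      ≡⟨ cong (λ e → E 0 (suc (suc n)) + e) (∑-diagonal n (λ j k → E (suc (suc j)) k)
           (λ m k → trans (cong (λ j → E (suc j) k) (cong suc (sym (ℕ.+-suc m m)))) (odd (suc m) k))) ⟩
    E 0 (suc (suc n)) + ∑ (suc ⌊ n /2⌋) (λ m → E (suc (suc (m ℕ.+ m))) (n ℕ.∸ (m ℕ.+ m)))
      ≡⟨ cong (λ e → E 0 (suc (suc n)) + e) (∑-cong (suc ⌊ n /2⌋) (λ m _ → cong (λ j → E (suc j) (suc n ℕ.∸ j)) (sym (ℕ.+-suc m m)))) ⟩
    E 0 (suc (suc n)) + ∑ (suc ⌊ n /2⌋) (λ m → E (suc m ℕ.+ suc m) (suc (suc n) ℕ.∸ (suc m ℕ.+ suc m)))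
      ≡⟨ ∑-head (suc ⌊ n /2⌋) (λ m → E (m ℕ.+ m) (suc (suc n) ℕ.∸ (m ℕ.+ m))) ⟨
    ∑ (suc (suc ⌊ n /2⌋)) (λ m → E (m ℕ.+ m) (suc (suc n) ℕ.∸ (m ℕ.+ m))) ∎

  hecke : ℕ → Carrier
  hecke n =
      ∑ (suc ⌊ n /2⌋) (λ m → (- 1#) ^ (m ℕ.+ n) * z ^ (n ℕ.∸ (m ℕ.+ m)) * q ^ (triangular n ℕ.∸ m ℕ.* m))
    + ∑ ⌊ n /2⌋ (λ k → (- 1#) ^ (suc k ℕ.+ n) * w ^ suc (n ℕ.∸ (suc k ℕ.+ suc k)) * q ^ (triangular n ℕ.∸ suc k ℕ.* suc k))

  δ-row : ∀ n (g : ℕ → Carrier) → ∑ (suc n) (λ k → δ (n ℕ.∸ k) k * g k) ≡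
    ∑ (suc ⌊ n /2⌋) (λ m → (- 1#) ^ (m ℕ.+ n) * g (n ℕ.∸ (m ℕ.+ m)) * q ^ (triangular n ℕ.∸ m ℕ.* m))
  δ-row n g = trans
    (∑-diagonal n (λ j k → δ j k * g k) (λ m k → trans (cong (_* g k) (δ-odd m k)) (zeroˡ (g k))))
    (∑-cong (suc ⌊ n /2⌋) (λ m m<1+n/2 → begin
      δ (m ℕ.+ m) (n ℕ.∸ (m ℕ.+ m)) * g (n ℕ.∸ (m ℕ.+ m))
        ≡⟨ cong (_* g (n ℕ.∸ (m ℕ.+ m))) (δ-even m (n ℕ.∸ (m ℕ.+ m))) ⟩
      (- 1#) ^ (m ℕ.+ (n ℕ.∸ (m ℕ.+ m) ℕ.+ (m ℕ.+ m))) * q ^ (triangular (n ℕ.∸ (m ℕ.+ m) ℕ.+ (m ℕ.+ m)) ℕ.∸ m ℕ.* m) * g (n ℕ.∸ (m ℕ.+ m))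
        ≡⟨ cong (λ i → (- 1#) ^ (m ℕ.+ i) * q ^ (triangular i ℕ.∸ m ℕ.* m) * g (n ℕ.∸ (m ℕ.+ m)))
             (ℕ.m∸n+n≡m (m≤⌊n/2⌋⇒m+m≤n (ℕ.≤-pred m<1+n/2))) ⟩
      (- 1#) ^ (m ℕ.+ n) * q ^ (triangular n ℕ.∸ m ℕ.* m) * g (n ℕ.∸ (m ℕ.+ m))
        ≡⟨ solve 3 (λ a b c → a :* b :* c := a :* c :* b) refl _ _ _ ⟩
      (- 1#) ^ (m ℕ.+ n) * g (n ℕ.∸ (m ℕ.+ m)) * q ^ (triangular n ℕ.∸ m ℕ.* m) ∎))

  -- Adding the missing m = 0 term to the second sum gives both sums the same range, so that z^k and
  -- w^(k+1) share the coefficient `δ`; the added term is then subtracted.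
  hecke-row : ∀ n → hecke n ≡ ∑ (suc n) (λ k → δ (n ℕ.∸ k) k * (z ^ k + w ^ suc k)) - θ n * w ^ suc n
  hecke-row n = begin
    A + B
      ≡⟨ solve 3 (λ a b t → a :+ b := (a :+ (t :+ b)) :- t) refl A B t ⟩
    (A + (t + B)) - t
      ≡⟨ cong₂ (λ x y → (A + (x + B)) - y) (trans t≡ (solve 3 (λ a b c → a :* b :* c := a :* c :* b) refl _ _ _)) refl ⟩
    (A + ((- 1#) ^ n * w ^ suc n * q ^ triangular n + B)) - θ n * w ^ suc n
      ≡⟨ cong (λ e → (A + e) - θ n * w ^ suc n) (∑-head ⌊ n /2⌋ (λ m → (- 1#) ^ (m ℕ.+ n) * w ^ suc (n ℕ.∸ (m ℕ.+ m)) * q ^ (triangular n ℕ.∸ m ℕ.* m))) ⟨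
    (A + ∑ (suc ⌊ n /2⌋) (λ m → (- 1#) ^ (m ℕ.+ n) * w ^ suc (n ℕ.∸ (m ℕ.+ m)) * q ^ (triangular n ℕ.∸ m ℕ.* m))) - θ n * w ^ suc n
      ≡⟨ cong₂ (λ a b → (a + b) - θ n * w ^ suc n) (δ-row n (λ k → z ^ k)) (δ-row n (λ k → w ^ suc k)) ⟨
    (∑ (suc n) (λ k → δ (n ℕ.∸ k) k * z ^ k) + ∑ (suc n) (λ k → δ (n ℕ.∸ k) k * w ^ suc k)) - θ n * w ^ suc n
      ≡⟨ cong (_- θ n * w ^ suc n) (trans (∑-+ (suc n) _ _) (∑-cong (suc n) (λ k _ → sym (distribˡ (δ (n ℕ.∸ k) k) (z ^ k) (w ^ suc k))))) ⟩
    ∑ (suc n) (λ k → δ (n ℕ.∸ k) k * (z ^ k + w ^ suc k)) - θ n * w ^ suc n ∎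
    where
    A = ∑ (suc ⌊ n /2⌋) (λ m → (- 1#) ^ (m ℕ.+ n) * z ^ (n ℕ.∸ (m ℕ.+ m)) * q ^ (triangular n ℕ.∸ m ℕ.* m))
    B = ∑ ⌊ n /2⌋ (λ k → (- 1#) ^ (suc k ℕ.+ n) * w ^ suc (n ℕ.∸ (suc k ℕ.+ suc k)) * q ^ (triangular n ℕ.∸ suc k ℕ.* suc k))
    t = θ n * w ^ suc n
    t≡ : t ≡ (- 1#) ^ n * q ^ triangular n * w ^ suc n
    t≡ = cong (_* w ^ suc n) (θ-closed n)

  -- `K ∸ k` counts the rows n with k ≤ n < K. The correction `θ k` is the m = 0 term, absent in
  -- negative degrees.
  heckeSeq : ℕ → LaurentSeq
  heckeSeq K (+ k)    = ρ (K ℕ.∸ k) k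
  heckeSeq K -[1+ k ] = ρ (K ℕ.∸ k) k - θ k

  -- Interchange of summation over the triangle k ≤ n < K.
  ∑-hecke : ∀ K → ∑ K hecke ≡ ev K (heckeSeq K)
  ∑-hecke K = trans (rows K) (∑-cong K (λ k _ →
    solve 4 (λ r Z W t → r :* (Z :+ W) :- t :* W := r :* Z :+ (r :- t) :* W) refl (ρ (K ℕ.∸ k) k) (z ^ k) (w ^ suc k) (θ k)))
    where
    g : ℕ → Carrier
    g k = z ^ k + w ^ suc k
    ∑-sub : ∀ n f h → ∑ n (λ i → f i - h i) ≡ ∑ n f - ∑ n h
    ∑-sub zero    f h = solve 0 (con (+ 0) := con (+ 0) :- con (+ 0)) refl
    ∑-sub (suc n) f h = trans (cong (_+ (f n - h n)) (∑-sub n f h))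
      (solve 4 (λ a b c d → (a :- b) :+ (c :- d) := (a :+ c) :- (b :+ d)) refl (∑ n f) (∑ n h) (f n) (h n))
    columns : ∀ K → ∑ K (λ n → ∑ (suc n) (λ k → δ (n ℕ.∸ k) k * g k)) ≡ ∑ K (λ k → ρ (K ℕ.∸ k) k * g k)
    columns zero    = refl
    columns (suc K) = begin
      ∑ K (λ n → ∑ (suc n) (λ k → δ (n ℕ.∸ k) k * g k)) + ∑ (suc K) (λ k → δ (K ℕ.∸ k) k * g k)
        ≡⟨ cong (_+ ∑ (suc K) (λ k → δ (K ℕ.∸ k) k * g k)) (trans (columns K) (sym last-zero)) ⟩
      ∑ (suc K) (λ k → ρ (K ℕ.∸ k) k * g k) + ∑ (suc K) (λ k → δ (K ℕ.∸ k) k * g k)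
        ≡⟨ ∑-+ (suc K) _ _ ⟩
      ∑ (suc K) (λ k → ρ (K ℕ.∸ k) k * g k + δ (K ℕ.∸ k) k * g k)
        ≡⟨ ∑-cong (suc K) (λ k k<1+K → trans (sym (distribʳ (g k) (ρ (K ℕ.∸ k) k) (δ (K ℕ.∸ k) k)))
             (cong (λ j → ρ j k * g k) (sym (ℕ.+-∸-assoc 1 (ℕ.≤-pred k<1+K))))) ⟩
      ∑ (suc K) (λ k → ρ (suc K ℕ.∸ k) k * g k) ∎
      where
      last-zero : ∑ (suc K) (λ k → ρ (K ℕ.∸ k) k * g k) ≡ ∑ K (λ k → ρ (K ℕ.∸ k) k * g k)
      last-zero = trans (cong (λ j → ∑ K (λ k → ρ (K ℕ.∸ k) k * g k) + ρ j K * g K) (ℕ.n∸n≡0 K))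
        (solve 2 (λ a b → a :+ con (+ 0) :* b := a) refl _ (g K))
    rows : ∀ K → ∑ K hecke ≡ ∑ K (λ k → ρ (K ℕ.∸ k) k * g k - θ k * w ^ suc k)
    rows K = begin
      ∑ K hecke
        ≡⟨ ∑-cong K (λ n _ → hecke-row n) ⟩
      ∑ K (λ n → ∑ (suc n) (λ k → δ (n ℕ.∸ k) k * g k) - θ n * w ^ suc n)
        ≡⟨ ∑-sub K _ _ ⟩
      ∑ K (λ n → ∑ (suc n) (λ k → δ (n ℕ.∸ k) k * g k)) - ∑ K (λ n → θ n * w ^ suc n)
        ≡⟨ cong (_- ∑ K (λ n → θ n * w ^ suc n)) (columns K) ⟩
      ∑ K (λ k → ρ (K ℕ.∸ k) k * g k) - ∑ K (λ n → θ n * w ^ suc n)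
        ≡⟨ ∑-sub K _ _ ⟨
      ∑ K (λ k → ρ (K ℕ.∸ k) k * g k - θ k * w ^ suc k) ∎

-- Weights and constants.

n≤triangular : ∀ n → n ℕ.≤ triangular n
n≤triangular zero    = ℕ.z≤n
n≤triangular (suc n) = ℕ.m≤m+n (suc n) (triangular n)

-- Laurent sequences are measured against the weights y ^ ∣ k ∣, with x = 1 / y
-- twice a bound b for the norms of z and 1 / z.
record Scale (r b : ℚ) : Set where
  open Rationals
  field
    0<r   : 0ℚ < r
    r<1   : r < 1ℚ
    1≤b   : 1ℚ ≤ b
  open Geometric r 0<r r<1 public
  field
    x y   : ℚ
    0≤y   : 0ℚ ≤ y
    1≤x   : 1ℚ ≤ x
    xy≡1  : x * y ≡ 1ℚ
    2y≤1  : y + y ≤ 1ℚ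
    2yb≡1 : y * b + y * b ≡ 1ℚ
    κ     : ℚ
    0≤κ   : 0ℚ ≤ κ
    κ-inv : κ * (1ℚ - r) ≡ 1ℚ
    C₀    : ℚ
    0≤C₀  : 0ℚ ≤ C₀
    -- The base is r y, not y: the extra r^k later lifts an error O(r^l) to O(r^(l+k)).
    decay : ∀ k → r ^ triangular k ≤ C₀ * (r * y) ^ k
    majorant₂ : Majorant (1ℚ + 1ℚ)
    -- The parameter 4 (1 + x) is the growth per factor found in `mul-bound`.
    majorantₓ : Majorant ((1ℚ + x) + (1ℚ + x) + ((1ℚ + x) + (1ℚ + x)))

  y≤1 : y ≤ 1ℚ
  y≤1 = ℚ.≤-trans (≤+ 0≤y) 2y≤1

  0≤x : 0ℚ ≤ x
  0≤x = ℚ.≤-trans 0≤1 1≤x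

  0≤b : 0ℚ ≤ b
  0≤b = ℚ.≤-trans 0≤1 1≤b

  0≤y^ : ∀ n → 0ℚ ≤ y ^ n
  0≤y^ = ^-nonNeg 0≤y

  module M₂ = Majorant majorant₂
  module Mₓ = Majorant majorantₓ

  -- `Cq` bounds products of consecutive factors 1 ± q^i, `CD` the coefficients of `D`, `D₁` the
  -- distance of `seg` from 1. The four summands of `Ce` belong to the last four errors of
  -- `positive-split`, and `Ce′` solves e = r e + `Ce`. `Ce⁻` is for negative degrees, `Ch` for
  -- single Hecke terms.
  2ℚ Cq CD D₁ Cu Cψ Cθ CJ C∂ Ce Ce′ Ce⁻ Ch Cmain : ℚ
  2ℚ = 1ℚ + 1ℚ
  Cq = M₂.bound 0
  CD = Mₓ.bound 0
  D₁ = Cq * 2ℚ * κ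
  Cu = Cq * 2ℚ
  Cψ = Cu * (CD * (1ℚ + x * 2ℚ)) * κ
  Cθ = C₀ * 2ℚ
  CJ = Cθ * (D₁ * Cq + D₁)
  C∂ = Cq * (Cu * (1ℚ * (1ℚ + x * 1ℚ)))
  Ce = CJ + C∂ + Cq * (2ℚ * (Cψ + 2ℚ * Cψ)) + Cθ
  Ce′ = Ce * κ
  Ce⁻ = Ce′ + (CJ + C∂)
  Ch = Cθ * (1ℚ + b) * 2ℚ + Cθ * b
  Cmain = (Ce′ + Ce⁻ * b) * 2ℚ + Ch

  0≤2 : 0ℚ ≤ 2ℚ
  0≤2 = 0≤+ 0≤1 0≤1
  0≤Cq : 0ℚ ≤ Cq
  0≤Cq = M₂.0≤bound 0
  0≤CD : 0ℚ ≤ CD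
  0≤CD = Mₓ.0≤bound 0
  0≤D₁ : 0ℚ ≤ D₁
  0≤D₁ = 0≤* (0≤* 0≤Cq 0≤2) 0≤κ
  0≤Cu : 0ℚ ≤ Cu
  0≤Cu = 0≤* 0≤Cq 0≤2
  0≤Cψ : 0ℚ ≤ Cψ
  0≤Cψ = 0≤* (0≤* 0≤Cu (0≤* 0≤CD (0≤+ 0≤1 (0≤* 0≤x 0≤2)))) 0≤κ
  0≤Cθ : 0ℚ ≤ Cθ
  0≤Cθ = 0≤* 0≤C₀ 0≤2
  0≤CJ : 0ℚ ≤ CJ
  0≤CJ = 0≤* 0≤Cθ (0≤+ (0≤* 0≤D₁ 0≤Cq) 0≤D₁)
  0≤C∂ : 0ℚ ≤ C∂
  0≤C∂ = 0≤* 0≤Cq (0≤* 0≤Cu (0≤* 0≤1 (0≤+ 0≤1 (0≤* 0≤x 0≤1))))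
  0≤Ce : 0ℚ ≤ Ce
  0≤Ce = 0≤+ (0≤+ (0≤+ 0≤CJ 0≤C∂) (0≤* 0≤Cq (0≤* 0≤2 (0≤+ 0≤Cψ (0≤* 0≤2 0≤Cψ))))) 0≤Cθ
  0≤Ce′ : 0ℚ ≤ Ce′
  0≤Ce′ = 0≤* 0≤Ce 0≤κ
  0≤Ce⁻ : 0ℚ ≤ Ce⁻
  0≤Ce⁻ = 0≤+ 0≤Ce′ (0≤+ 0≤CJ 0≤C∂)
  0≤Ch : 0ℚ ≤ Ch
  0≤Ch = 0≤+ (0≤* (0≤* 0≤Cθ (0≤+ 0≤1 0≤b)) 0≤2) (0≤* 0≤Cθ 0≤b)
  0≤Cmain : 0ℚ ≤ Cmain
  0≤Cmain = 0≤+ (0≤* (0≤+ 0≤Ce′ (0≤* 0≤Ce⁻ 0≤b)) 0≤2) 0≤Ch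

scale : ∀ r b → 0ℚ Rationals.< r → r Rationals.< 1ℚ → 1ℚ Rationals.≤ b → Scale r b
scale r b 0<r r<1 1≤b = record
  { 0<r = 0<r ; r<1 = r<1 ; 1≤b = 1≤b
  ; x = b + b ; y = y ; 0≤y = 0≤y
  ; 1≤x = ℚ.≤-trans 1≤b (≤+ 0≤b)
  ; xy≡1 = xy≡1
  ; 2y≤1 = 2y≤1
  ; 2yb≡1 = 2yb≡1
  ; κ = proj₁ rκ ; 0≤κ = ℚ.<⇒≤ (proj₁ (proj₂ rκ))
  ; κ-inv = trans (ℚ.*-comm (proj₁ rκ) (1ℚ - r)) (proj₂ (proj₂ rκ))
  ; C₀ = proj₁ d ; 0≤C₀ = proj₁ (proj₂ d) ; decay = proj₂ (proj₂ d)
  ; majorant₂ = majorant (1ℚ + 1ℚ) (0≤+ 0≤1 0≤1)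
  ; majorantₓ = majorant _ (0≤+ (0≤+ 0≤1+x 0≤1+x) (0≤+ 0≤1+x 0≤1+x))
  }
  where
  open Rationals
  open Geometric r 0<r r<1
  0<b : 0ℚ < b
  0<b = ℚ.<-≤-trans (ℚ.positive⁻¹ 1ℚ) 1≤b
  0≤b = ℚ.<⇒≤ 0<b
  rx = reciprocal (ℚ.+-mono-< 0<b 0<b)
  rr = reciprocal 0<r
  rκ = reciprocal 0<1-r
  y = proj₁ rx
  0<y = proj₁ (proj₂ rx)
  0≤y = ℚ.<⇒≤ 0<y
  xy≡1 = proj₂ (proj₂ rx)
  0≤1+x : 0ℚ ≤ 1ℚ + (b + b)
  0≤1+x = 0≤+ 0≤1 (0≤+ 0≤b 0≤b)
  2yb≡1 : y * b + y * b ≡ 1ℚ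
  2yb≡1 = trans (solve 2 (λ y b → y :* b :+ y :* b := (b :+ b) :* y) refl y b) xy≡1
  open ℚ.≤-Reasoning
  2y≤1 : y + y ≤ 1ℚ
  2y≤1 = begin
    y + y            ≡⟨ solve 1 (λ y → y :+ y := y :* con (+ 1) :+ y :* con (+ 1)) refl y ⟩
    y * 1ℚ + y * 1ℚ  ≤⟨ ℚ.+-mono-≤ (*-monoˡ y 0≤y 1≤b) (*-monoˡ y 0≤y 1≤b) ⟩
    y * b + y * b    ≡⟨ 2yb≡1 ⟩
    1ℚ               ∎
  ry-inverse : r * y * (proj₁ rr * (b + b)) ≡ 1ℚ
  ry-inverse = begin-equality
    r * y * (proj₁ rr * (b + b))     ≡⟨ solve 4 (λ r y s b → r :* y :* (s :* (b :+ b)) := (r :* s) :* ((b :+ b) :* y)) refl r y (proj₁ rr) b ⟩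
    (r * proj₁ rr) * ((b + b) * y)   ≡⟨ cong₂ _*_ (proj₂ (proj₂ rr)) xy≡1 ⟩
    1ℚ * 1ℚ                          ≡⟨⟩
    1ℚ                               ∎
  d = triangular-decay (r * y) (proj₁ rr * (b + b)) (0<* 0<r 0<y)
        (ℚ.≤-trans (*≤ 0≤y r≤1) (ℚ.≤-trans (≤+ 0≤y) 2y≤1))
        (0≤* (ℚ.<⇒≤ (proj₁ (proj₂ rr))) (0≤+ 0≤b 0≤b)) ry-inverse

module Inequalities where
  open Rationals
  open ℚ.≤-Reasoning

  -- One factor pair with |Q| ≤ 2s, where each neighbouring coefficient costs a factor x: 1 + 4s² +
  -- 4sx ≤ 1 + 4(1 + x)s because s ≤ 1.
  mul-bound : ∀ M W x s → 0ℚ ≤ M → 0ℚ ≤ W → 0ℚ ≤ s → s ≤ 1ℚ →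
    (1ℚ + (s + s) * (s + s)) * (M * W) + (s + s) * (M * (x * W)) + (s + s) * (M * (x * W)) ≤
    ((1ℚ + ((1ℚ + x) + (1ℚ + x) + ((1ℚ + x) + (1ℚ + x))) * s) * M) * W
  mul-bound M W x s 0≤M 0≤W 0≤s s≤1 = 0≤-⇒≤ (ℚ.≤-trans (0≤* (0≤* 0≤M 0≤W) (0≤* (0≤+ 0≤2s 0≤2s) (≤⇒0≤- s≤1)))
    (ℚ.≤-reflexive (solve 4 (λ M W x s → (M :* W) :* (((s :+ s) :+ (s :+ s)) :* (con (+ 1) :- s)) :=
      ((con (+ 1) :+ ((con (+ 1) :+ x) :+ (con (+ 1) :+ x) :+ ((con (+ 1) :+ x) :+ (con (+ 1) :+ x))) :* s) :* M) :* W
      :- ((con (+ 1) :+ (s :+ s) :* (s :+ s)) :* (M :* W) :+ (s :+ s) :* (M :* (x :* W)) :+ (s :+ s) :* (M :* (x :* W)))) refl M W x s)))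
    where
    0≤2s : 0ℚ ≤ s + s
    0≤2s = 0≤+ 0≤s 0≤s

  factor-bound : ∀ M W x p → M * W + p * (M * (x * W)) ≡ M * (1ℚ + x * p) * W
  factor-bound = solve 4 (λ M W x p → M :* W :+ p :* (M :* (x :* W)) := M :* (con (+ 1) :+ x :* p) :* W) refl

  -- Geometric sums are kept in the closed form C κ (r^m - r^n) with κ = 1 / (1 - r). This appends a
  -- last term to such a sum; the primed version prepends a first one.
  telescoping-bound : ∀ r κ C s t → κ * (1ℚ - r) ≡ 1ℚ → C * κ * (s - t) + C * t ≡ C * κ * (s - r * t)
  telescoping-bound r κ C s t e = begin-equality
    C * κ * (s - t) + C * t                    ≡⟨ solve 4 (λ C κ s t → C :* κ :* (s :- t) :+ C :* t := C :* κ :* (s :- t) :+ C :* con (+ 1) :* t) refl C κ s t ⟩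
    C * κ * (s - t) + C * 1ℚ * t               ≡⟨ cong (λ u → C * κ * (s - t) + C * u * t) e ⟨
    C * κ * (s - t) + C * (κ * (1ℚ - r)) * t   ≡⟨ solve 5 (λ C κ s t r → C :* κ :* (s :- t) :+ C :* (κ :* (con (+ 1) :- r)) :* t := C :* κ :* (s :- r :* t)) refl C κ s t r ⟩
    C * κ * (s - r * t)                        ∎

  telescoping-bound′ : ∀ r κ C s t → κ * (1ℚ - r) ≡ 1ℚ → C * s + C * κ * (r * s - t) ≡ C * κ * (s - t)
  telescoping-bound′ r κ C s t e = begin-equality
    C * s + C * κ * (r * s - t)                    ≡⟨ solve 5 (λ C κ s t r → C :* s :+ C :* κ :* (r :* s :- t) := C :* con (+ 1) :* s :+ C :* κ :* (r :* s :- t)) refl C κ s t r ⟩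
    C * 1ℚ * s + C * κ * (r * s - t)               ≡⟨ cong (λ u → C * u * s + C * κ * (r * s - t)) e ⟨
    C * (κ * (1ℚ - r)) * s + C * κ * (r * s - t)   ≡⟨ solve 5 (λ C κ s t r → C :* (κ :* (con (+ 1) :- r)) :* s :+ C :* κ :* (r :* s :- t) := C :* κ :* (s :- t)) refl C κ s t r ⟩
    C * κ * (s - t)                                ∎

-- Norm estimates for the coefficients.

module Estimates (R : NormedRing) {r b : ℚ} (S : Scale r b) (q : NormedRing.Carrier R)
  where
  open NormedRing R using (‖_‖; ‖‖-nonNeg; ‖0‖; ‖1‖; ‖-‖; ‖+‖; ‖*‖)
  open Laurent R
  open Coefficients q
  open Scale S
  open Rationals using (*-mono-≤; *-monoˡ; *-monoʳ; 0≤+; 0≤*; 0≤1; ≤⇒0≤-; 0≤-⇒≤; *≤; ≤*; *-^)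
    renaming (_^_ to _^ℚ_; ^-homo-* to ^ℚ-homo-*)
  open Inequalities
  open ℚ.≤-Reasoning

  module QS = Rationals

  norm-+ : ∀ {a c α γ} → ‖ a ‖ ≤ℚ α → ‖ c ‖ ≤ℚ γ → ‖ a + c ‖ ≤ℚ α +ℚ γ
  norm-+ {a} {c} a≤α c≤γ = ℚ.≤-trans (‖+‖ a c) (ℚ.+-mono-≤ a≤α c≤γ)

  norm-neg : ∀ {a α} → ‖ a ‖ ≤ℚ α → ‖ - a ‖ ≤ℚ α
  norm-neg {a} a≤α = ℚ.≤-trans (ℚ.≤-reflexive (‖-‖ a)) a≤α

  norm-- : ∀ {a c α γ} → ‖ a ‖ ≤ℚ α → ‖ c ‖ ≤ℚ γ → ‖ a - c ‖ ≤ℚ α +ℚ γ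
  norm-- a≤α c≤γ = norm-+ a≤α (norm-neg c≤γ)

  norm-* : ∀ {a c α γ} → ‖ a ‖ ≤ℚ α → ‖ c ‖ ≤ℚ γ → ‖ a * c ‖ ≤ℚ α *ℚ γ
  norm-* {a} {c} a≤α c≤γ = ℚ.≤-trans (‖*‖ a c) (*-mono-≤ (‖‖-nonNeg a) a≤α (‖‖-nonNeg c) c≤γ)

  norm-1 : ‖ 1# ‖ ≤ℚ 1ℚ
  norm-1 = ℚ.≤-reflexive ‖1‖

  norm-≡ : ∀ {a c α} → a ≡ c → ‖ c ‖ ≤ℚ α → ‖ a ‖ ≤ℚ α
  norm-≡ refl c≤α = c≤α

  norm-0 : ∀ {a α} → a ≡ 0# → 0ℚ ≤ℚ α → ‖ a ‖ ≤ℚ α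
  norm-0 refl 0≤α = ℚ.≤-trans (ℚ.≤-reflexive ‖0‖) 0≤α

  norm-^ : ∀ {a} → ‖ a ‖ ≤ℚ 1ℚ → ∀ n → ‖ a ^ n ‖ ≤ℚ 1ℚ
  norm-^ a≤1 zero    = norm-1
  norm-^ a≤1 (suc n) = norm-* a≤1 (norm-^ a≤1 n)

  norm-^ℚ : ∀ {a α} → ‖ a ‖ ≤ℚ α → ∀ n → ‖ a ^ n ‖ ≤ℚ α ^ℚ n
  norm-^ℚ a≤α zero    = norm-1
  norm-^ℚ a≤α (suc n) = norm-* a≤α (norm-^ℚ a≤α n)

  -- The quantity ‖P n‖ · `bound n` never increases, since `bound n` reserves room for the factors
  -- still to come.
  product-bound : ∀ {β} (m : Majorant β) (P f : ℕ → Carrier) → P 0 ≡ 1# → (∀ n → P (suc n) ≡ P n * f n) →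
    (∀ n → ‖ f n ‖ ≤ℚ 1ℚ +ℚ β *ℚ r ^ℚ n) → ∀ n → ‖ P n ‖ ≤ℚ Majorant.bound m 0
  product-bound {β} m P f P₀ P₊ f≤ n = begin
    ‖ P n ‖                ≡⟨ ℚ.*-identityʳ ‖ P n ‖ ⟨
    ‖ P n ‖ *ℚ 1ℚ          ≤⟨ *-monoˡ ‖ P n ‖ (‖‖-nonNeg (P n)) (1≤bound n) ⟩
    ‖ P n ‖ *ℚ bound n     ≤⟨ weighted n ⟩
    bound 0                ∎
    where
    open Majorant m
    weighted : ∀ n → ‖ P n ‖ *ℚ bound n ≤ℚ bound 0
    weighted zero = begin
      ‖ P 0 ‖ *ℚ bound 0     ≡⟨ cong (λ a → ‖ a ‖ *ℚ bound 0) P₀ ⟩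
      ‖ 1# ‖ *ℚ bound 0      ≡⟨ cong (_*ℚ bound 0) ‖1‖ ⟩
      1ℚ *ℚ bound 0          ≡⟨ ℚ.*-identityˡ (bound 0) ⟩
      bound 0                ∎
    weighted (suc n) = begin
      ‖ P (suc n) ‖ *ℚ bound (suc n)                              ≤⟨ *-monoʳ (bound (suc n)) (0≤bound (suc n)) (norm-≡ (P₊ n) (norm-* ℚ.≤-refl (f≤ n))) ⟩
      ‖ P n ‖ *ℚ (1ℚ +ℚ β *ℚ r ^ℚ n) *ℚ bound (suc n)             ≡⟨ ℚ.*-assoc ‖ P n ‖ (1ℚ +ℚ β *ℚ r ^ℚ n) (bound (suc n)) ⟩
      ‖ P n ‖ *ℚ ((1ℚ +ℚ β *ℚ r ^ℚ n) *ℚ bound (suc n))           ≤⟨ *-monoˡ ‖ P n ‖ (‖‖-nonNeg (P n)) (bound-step n) ⟩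
      ‖ P n ‖ *ℚ bound n                                          ≤⟨ weighted n ⟩
      bound 0                                                     ∎

  weight : ℤ → ℚ
  weight k = y ^ℚ ℤ.∣ k ∣

  0≤weight : ∀ k → 0ℚ ≤ℚ weight k
  0≤weight k = 0≤y^ ℤ.∣ k ∣

  y^-down : ∀ n → y ^ℚ suc n ≤ℚ y ^ℚ n
  y^-down n = *≤ (0≤y^ n) y≤1

  y^-grow : ∀ n → y ^ℚ suc n ≤ℚ x *ℚ y ^ℚ n
  y^-grow n = ℚ.≤-trans (y^-down n) (≤* (0≤y^ n) 1≤x)

  y^-back : ∀ n → y ^ℚ n ≡ x *ℚ y ^ℚ suc n
  y^-back n = begin-equality
    y ^ℚ n                   ≡⟨ ℚ.*-identityˡ (y ^ℚ n) ⟨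
    1ℚ *ℚ y ^ℚ n             ≡⟨ cong (_*ℚ y ^ℚ n) xy≡1 ⟨
    x *ℚ y *ℚ y ^ℚ n         ≡⟨ ℚ.*-assoc x y (y ^ℚ n) ⟩
    x *ℚ y ^ℚ suc n          ∎

  weight-pred : ∀ k → weight (ℤ.pred k) ≤ℚ x *ℚ weight k
  weight-pred (+ zero)    = y^-grow 0
  weight-pred (+ (suc n)) = ℚ.≤-reflexive (y^-back n)
  weight-pred -[1+ n ]    = y^-grow (suc n)

  weight-suc : ∀ k → weight (ℤ.suc k) ≤ℚ x *ℚ weight k
  weight-suc (+ n)           = y^-grow n
  weight-suc -[1+ zero ]     = ℚ.≤-reflexive (y^-back 0)
  weight-suc -[1+ (suc n) ]  = ℚ.≤-reflexive (y^-back (suc n))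

  Bounded : LaurentSeq → ℚ → Set
  Bounded a M = ∀ k → ‖ a k ‖ ≤ℚ M *ℚ weight k

  Bounded-mono : ∀ {a M M′} → M ≤ℚ M′ → Bounded a M → Bounded a M′
  Bounded-mono M≤M′ a≤M k = ℚ.≤-trans (a≤M k) (*-monoʳ (weight k) (0≤weight k) M≤M′)

  Bounded-unit : Bounded unit 1ℚ
  Bounded-unit (+ zero)    = norm-1
  Bounded-unit (+ (suc n)) = norm-0 refl (0≤* 0≤1 (0≤y^ (suc n)))
  Bounded-unit -[1+ n ]    = norm-0 refl (0≤* 0≤1 (0≤y^ (suc n)))

  module _ {a M} (0≤M : 0ℚ ≤ℚ M) (a≤M : Bounded a M) where

    Bounded-pred : ∀ k → ‖ a (ℤ.pred k) ‖ ≤ℚ M *ℚ (x *ℚ weight k)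
    Bounded-pred k = ℚ.≤-trans (a≤M (ℤ.pred k)) (*-monoˡ M 0≤M (weight-pred k))

    Bounded-suc : ∀ k → ‖ a (ℤ.suc k) ‖ ≤ℚ M *ℚ (x *ℚ weight k)
    Bounded-suc k = ℚ.≤-trans (a≤M (ℤ.suc k)) (*-monoˡ M 0≤M (weight-suc k))

    Bounded-mul⁺ : ∀ {Q p} → ‖ Q ‖ ≤ℚ p → Bounded (mul⁺ Q a) (M *ℚ (1ℚ +ℚ x *ℚ p))
    Bounded-mul⁺ {Q} {p} Q≤p k = ℚ.≤-trans (norm-- (a≤M k) (norm-* Q≤p (Bounded-pred k)))
      (ℚ.≤-reflexive (factor-bound M (weight k) x p))

    Bounded-mul⁻ : ∀ {Q p} → ‖ Q ‖ ≤ℚ p → Bounded (mul⁻ Q a) (M *ℚ (1ℚ +ℚ x *ℚ p))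
    Bounded-mul⁻ {Q} {p} Q≤p k = ℚ.≤-trans (norm-- (a≤M k) (norm-* Q≤p (Bounded-suc k)))
      (ℚ.≤-reflexive (factor-bound M (weight k) x p))

    Bounded-mul : ∀ {Q s} → 0ℚ ≤ℚ s → s ≤ℚ 1ℚ → ‖ Q ‖ ≤ℚ s +ℚ s →
      Bounded (mul Q a) ((1ℚ +ℚ ((1ℚ +ℚ x) +ℚ (1ℚ +ℚ x) +ℚ ((1ℚ +ℚ x) +ℚ (1ℚ +ℚ x))) *ℚ s) *ℚ M)
    Bounded-mul {Q} {s} 0≤s s≤1 Q≤2s k = ℚ.≤-trans
      (norm-- (norm-- (norm-* (norm-+ norm-1 (norm-* Q≤2s Q≤2s)) (a≤M k)) (norm-* Q≤2s (Bounded-pred k))) (norm-* Q≤2s (Bounded-suc k)))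
      (mul-bound M (weight k) x s 0≤M (0≤weight k) 0≤s s≤1)

  double : ∀ s → s +ℚ s ≡ 2ℚ *ℚ s
  double s = QS.solve 1 (λ s → s QS.:+ s QS.:= (QS.con (+ 1) QS.:+ QS.con (+ 1)) QS.:* s) refl s

  module _ (q^≤ : ∀ n → ‖ q ^ n ‖ ≤ℚ r ^ℚ n +ℚ r ^ℚ n) where

    q^≤2 : ∀ n → ‖ q ^ n ‖ ≤ℚ 2ℚ
    q^≤2 n = ℚ.≤-trans (q^≤ n) (ℚ.+-mono-≤ (r^≤1 n) (r^≤1 n))

    q^-mono : ∀ {m n} → m ℕ.≤ n → ‖ q ^ n ‖ ≤ℚ r ^ℚ m +ℚ r ^ℚ m
    q^-mono {m} {n} m≤n = ℚ.≤-trans (q^≤ n) (ℚ.+-mono-≤ (r^-antimono m≤n) (r^-antimono m≤n))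

    factor-norm : ∀ i n → n ℕ.≤ i → ‖ 1# - q ^ i ‖ ≤ℚ 1ℚ +ℚ 2ℚ *ℚ r ^ℚ n
    factor-norm i n n≤i = ℚ.≤-trans (norm-- norm-1 (q^-mono n≤i)) (ℚ.≤-reflexive (cong (1ℚ +ℚ_) (double (r ^ℚ n))))

    qq-bound : ∀ n → ‖ qq n ‖ ≤ℚ Cq
    qq-bound = product-bound majorant₂ qq (λ n → 1# - q ^ suc n) refl (λ _ → refl) (λ n → factor-norm (suc n) n (ℕ.n≤1+n n))

    -- Each factor multiplies the bound by at most 1 + 4(1 + x) r^s, and the majorant caps these
    -- products independently of c.
    D-bound : ∀ c s → Bounded (D c s) (Mₓ.bound s)
    D-bound zero    s = Bounded-mono (Mₓ.1≤bound s) Bounded-unit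
    D-bound (suc c) s = Bounded-mono (Mₓ.bound-step s)
      (Bounded-mul (Mₓ.0≤bound (suc s)) (D-bound c (suc s)) (0≤r^ s) (r^≤1 s) (q^≤ s))

    Bounded-D : ∀ c s → Bounded (D c s) CD
    Bounded-D c s = Bounded-mono (Mₓ.bound-antimono (0≤+ (0≤+ 0≤1+x 0≤1+x) (0≤+ 0≤1+x 0≤1+x)) s) (D-bound c s)
      where 0≤1+x = 0≤+ 0≤1 0≤x

    u-bound : ∀ n → ‖ u n ‖ ≤ℚ Cu *ℚ r ^ℚ n
    u-bound n = ℚ.≤-trans (norm-≡ (u≡poch n) (norm-*
      (product-bound majorant₂ (poch (- q)) (λ n → 1# - (- q) * q ^ n) refl (λ _ → refl)
        (λ n → ℚ.≤-trans (norm-≡ (solve 2 (λ q p → con (+ 1) :- (:- q) :* p := con (+ 1) :+ q :* p) refl q (q ^ n))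
          (norm-+ norm-1 (q^-mono (ℕ.n≤1+n n)))) (ℚ.≤-reflexive (cong (1ℚ +ℚ_) (double (r ^ℚ n))))) n)
      (ℚ.≤-trans (q^-mono (n≤triangular n)) (ℚ.≤-reflexive (double (r ^ℚ n))))))
      (ℚ.≤-reflexive (sym (ℚ.*-assoc Cq 2ℚ (r ^ℚ n))))

    -- A geometric sum over s ≤ n < s + c: `u n` decays like r^n and the products beside it are
    -- uniformly bounded.
    ψ-bound : ∀ c s k → ‖ ψ c s k ‖ ≤ℚ Cψ *ℚ (r ^ℚ s -ℚ r ^ℚ (s ℕ.+ c)) *ℚ weight k
    ψ-bound zero s k = norm-0 refl (0≤* (0≤* 0≤Cψ (≤⇒0≤- (r^-antimono (ℕ.m≤m+n s 0)))) (0≤weight k))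
    ψ-bound (suc c) s k = begin
      ‖ ψ (suc c) s k ‖
        ≤⟨ norm-+ (norm-* (u-bound s) (Bounded-mul⁺ 0≤CD (Bounded-D c (suc (suc s))) (q^≤2 (suc s)) k)) (ψ-bound c (suc s) k) ⟩
      Cu *ℚ r ^ℚ s *ℚ (CD *ℚ (1ℚ +ℚ x *ℚ 2ℚ) *ℚ weight k) +ℚ Cψ *ℚ (r *ℚ r ^ℚ s -ℚ r ^ℚ (suc s ℕ.+ c)) *ℚ weight k
        ≡⟨ QS.solve 5 (λ u s d w p → u QS.:* s QS.:* (d QS.:* w) QS.:+ p QS.:* w QS.:= (u QS.:* d QS.:* s QS.:+ p) QS.:* w) refl
             Cu (r ^ℚ s) (CD *ℚ (1ℚ +ℚ x *ℚ 2ℚ)) (weight k) (Cψ *ℚ (r *ℚ r ^ℚ s -ℚ r ^ℚ (suc s ℕ.+ c))) ⟩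
      (Cu *ℚ (CD *ℚ (1ℚ +ℚ x *ℚ 2ℚ)) *ℚ r ^ℚ s +ℚ Cψ *ℚ (r *ℚ r ^ℚ s -ℚ r ^ℚ (suc s ℕ.+ c))) *ℚ weight k
        ≡⟨ cong (_*ℚ weight k) (telescoping-bound′ r κ (Cu *ℚ (CD *ℚ (1ℚ +ℚ x *ℚ 2ℚ))) (r ^ℚ s) (r ^ℚ (suc s ℕ.+ c)) κ-inv) ⟩
      Cψ *ℚ (r ^ℚ s -ℚ r ^ℚ (suc s ℕ.+ c)) *ℚ weight k
        ≡⟨ cong (λ i → Cψ *ℚ (r ^ℚ s -ℚ r ^ℚ i) *ℚ weight k) (ℕ.+-suc s c) ⟨
      Cψ *ℚ (r ^ℚ s -ℚ r ^ℚ (s ℕ.+ suc c)) *ℚ weight k ∎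

    difference-≤ : ∀ m n → r ^ℚ m -ℚ r ^ℚ n ≤ℚ r ^ℚ m
    difference-≤ m n = 0≤-⇒≤ (ℚ.≤-trans (0≤r^ n) (ℚ.≤-reflexive
      (QS.solve 2 (λ a b → b QS.:= a QS.:- (a QS.:- b)) refl (r ^ℚ m) (r ^ℚ n))))

    Bounded-ψ : ∀ N → Bounded (ψ N 0) Cψ
    Bounded-ψ N k = ℚ.≤-trans (ψ-bound N 0 k) (*-monoʳ (weight k) (0≤weight k)
      (ℚ.≤-trans (*-monoˡ Cψ 0≤Cψ (difference-≤ 0 N)) (ℚ.≤-reflexive (ℚ.*-identityʳ Cψ))))

    θ-bound : ∀ n → ‖ θ n ‖ ≤ℚ Cθ *ℚ (r ^ℚ n *ℚ y ^ℚ n)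
    θ-bound n = begin
      ‖ θ n ‖
        ≤⟨ norm-≡ (θ-closed n) (norm-* (norm-^ (norm-neg norm-1) n) (q^≤ (triangular n))) ⟩
      1ℚ *ℚ (r ^ℚ triangular n +ℚ r ^ℚ triangular n)
        ≤⟨ *-monoˡ 1ℚ 0≤1 (ℚ.+-mono-≤ (decay n) (decay n)) ⟩
      1ℚ *ℚ (C₀ *ℚ (r *ℚ y) ^ℚ n +ℚ C₀ *ℚ (r *ℚ y) ^ℚ n)
        ≡⟨ QS.solve 2 (λ c d → QS.con (+ 1) QS.:* (c QS.:* d QS.:+ c QS.:* d) QS.:= c QS.:* (QS.con (+ 1) QS.:+ QS.con (+ 1)) QS.:* d) refl C₀ ((r *ℚ y) ^ℚ n) ⟩
      Cθ *ℚ (r *ℚ y) ^ℚ n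
        ≡⟨ cong (Cθ *ℚ_) (*-^ r y n) ⟩
      Cθ *ℚ (r ^ℚ n *ℚ y ^ℚ n) ∎

    0≤ry : ∀ m n → 0ℚ ≤ℚ r ^ℚ m *ℚ y ^ℚ n
    0≤ry m n = 0≤* (0≤r^ m) (0≤y^ n)

    -- The factor 2 in the bound for q ^ suc k is absorbed by y ≤ ½.
    gain : ∀ {a B} N k → 0ℚ ≤ℚ B → ‖ a ‖ ≤ℚ B *ℚ (r ^ℚ N *ℚ y ^ℚ suc k) → ‖ q ^ suc k * a ‖ ≤ℚ r *ℚ (B *ℚ (r ^ℚ N *ℚ y ^ℚ k))
    gain {a} {B} N k 0≤B a≤ = begin
      ‖ q ^ suc k * a ‖
        ≤⟨ norm-* (q^≤ (suc k)) a≤ ⟩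
      (r *ℚ r ^ℚ k +ℚ r *ℚ r ^ℚ k) *ℚ (B *ℚ (r ^ℚ N *ℚ (y *ℚ y ^ℚ k)))
        ≡⟨ QS.solve 6 (λ r s B t y Y → (r QS.:* s QS.:+ r QS.:* s) QS.:* (B QS.:* (t QS.:* (y QS.:* Y))) QS.:=
             (s QS.:* (y QS.:+ y)) QS.:* (r QS.:* (B QS.:* (t QS.:* Y)))) refl r (r ^ℚ k) B (r ^ℚ N) y (y ^ℚ k) ⟩
      (r ^ℚ k *ℚ (y +ℚ y)) *ℚ (r *ℚ (B *ℚ (r ^ℚ N *ℚ y ^ℚ k)))
        ≤⟨ *≤ (0≤* 0≤r (0≤* 0≤B (0≤ry N k))) (ℚ.≤-trans (*≤ (0≤+ 0≤y 0≤y) (r^≤1 k)) 2y≤1) ⟩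
      r *ℚ (B *ℚ (r ^ℚ N *ℚ y ^ℚ k)) ∎

    -- Two steps in j yield r²: one factor comes from `gain`, the other from the exponent j + (k +
    -- 1) at the next degree.
    δ-bound : ∀ j k → ‖ δ j k ‖ ≤ℚ Cθ *ℚ (r ^ℚ (j ℕ.+ k) *ℚ y ^ℚ k)
    δ-bound zero          k = θ-bound k
    δ-bound (suc zero)    k = norm-0 refl (0≤* 0≤Cθ (0≤ry (suc k) k))
    δ-bound (suc (suc j)) k = begin
      ‖ q ^ suc k * δ j (suc k) ‖                        ≤⟨ gain (j ℕ.+ suc k) k 0≤Cθ (δ-bound j (suc k)) ⟩
      r *ℚ (Cθ *ℚ (r ^ℚ (j ℕ.+ suc k) *ℚ y ^ℚ k))        ≡⟨ cong (λ i → r *ℚ (Cθ *ℚ (r ^ℚ i *ℚ y ^ℚ k))) (ℕ.+-suc j k) ⟩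
      r *ℚ (Cθ *ℚ (r ^ℚ suc (j ℕ.+ k) *ℚ y ^ℚ k))        ≡⟨ QS.solve 4 (λ r c s y → r QS.:* (c QS.:* (s QS.:* y)) QS.:= c QS.:* (r QS.:* s QS.:* y)) refl r Cθ (r ^ℚ suc (j ℕ.+ k)) (y ^ℚ k) ⟩
      Cθ *ℚ (r ^ℚ suc (suc (j ℕ.+ k)) *ℚ y ^ℚ k)         ∎

    seg-bound : ∀ c s → ‖ seg c s ‖ ≤ℚ Cq
    seg-bound c s = product-bound majorant₂ (λ c → seg c s) (λ c → 1# - q ^ (s ℕ.+ c)) refl (λ _ → refl)
      (λ n → factor-norm (s ℕ.+ n) n (ℕ.m≤n+m n s)) c

    seg-1-bound : ∀ c s → ‖ seg c s - 1# ‖ ≤ℚ D₁ *ℚ (r ^ℚ s -ℚ r ^ℚ (s ℕ.+ c))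
    seg-1-bound zero s = norm-0 (-‿inverseʳ 1#) (0≤* 0≤D₁ (≤⇒0≤- (r^-antimono (ℕ.m≤m+n s 0))))
    seg-1-bound (suc c) s = begin
      ‖ seg c s * (1# - q ^ (s ℕ.+ c)) - 1# ‖
        ≤⟨ norm-≡ (solve 2 (λ p Q → p :* (con (+ 1) :- Q) :- con (+ 1) := (p :- con (+ 1)) :- p :* Q) refl (seg c s) (q ^ (s ℕ.+ c)))
             (norm-- (seg-1-bound c s) (norm-* (seg-bound c s) (q^≤ (s ℕ.+ c)))) ⟩
      D₁ *ℚ (r ^ℚ s -ℚ t) +ℚ Cq *ℚ (t +ℚ t)
        ≡⟨ QS.solve 3 (λ a c t → a QS.:+ c QS.:* (t QS.:+ t) QS.:= a QS.:+ c QS.:* (QS.con (+ 1) QS.:+ QS.con (+ 1)) QS.:* t) refl (D₁ *ℚ (r ^ℚ s -ℚ t)) Cq t ⟩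
      D₁ *ℚ (r ^ℚ s -ℚ t) +ℚ Cq *ℚ 2ℚ *ℚ t
        ≡⟨ telescoping-bound r κ (Cq *ℚ 2ℚ) (r ^ℚ s) t κ-inv ⟩
      D₁ *ℚ (r ^ℚ s -ℚ r ^ℚ suc (s ℕ.+ c))
        ≡⟨ cong (λ i → D₁ *ℚ (r ^ℚ s -ℚ r ^ℚ i)) (ℕ.+-suc s c) ⟨
      D₁ *ℚ (r ^ℚ s -ℚ r ^ℚ (s ℕ.+ suc c)) ∎
      where t = r ^ℚ (s ℕ.+ c)

    seg-1-mono : ∀ c {m s} → m ℕ.≤ s → ‖ seg c s - 1# ‖ ≤ℚ D₁ *ℚ r ^ℚ m
    seg-1-mono c {m} {s} m≤s = ℚ.≤-trans (seg-1-bound c s) (*-monoˡ D₁ 0≤D₁ (ℚ.≤-trans (difference-≤ s (s ℕ.+ c)) (r^-antimono m≤s)))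

    module _ (cancel : ∀ i {a c} → a * (1# - q ^ suc i) ≡ c * (1# - q ^ suc i) → a ≡ c) where

      open Cancellation cancel

      J-error : ∀ l n → ‖ qq (l ℕ.+ n) * J (l ℕ.+ n) (+ n) - θ n ‖ ≤ℚ CJ *ℚ (r ^ℚ (l ℕ.+ n) *ℚ y ^ℚ n)
      J-error l n = begin
        ‖ qq N * J N (+ n) - θ n ‖
          ≤⟨ norm-≡ (trans (cong (_- θ n) (J-closed l n))
               (solve 3 (λ t a b → t :* (a :* b) :- t := t :* ((a :- con (+ 1)) :* b :+ (b :- con (+ 1)))) refl (θ n) a s))
               (norm-* (θ-bound n) (norm-+ (norm-* (seg-1-mono n (ℕ.n≤1+n l)) (seg-bound l _))
                 (seg-1-mono l (ℕ.≤-trans (ℕ.m≤m+n l n) (ℕ.≤-trans (ℕ.m≤m+n N n) (ℕ.≤-trans (ℕ.n≤1+n _) (ℕ.n≤1+n _))))))) ⟩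
        Cθ *ℚ (r ^ℚ n *ℚ y ^ℚ n) *ℚ (D₁ *ℚ r ^ℚ l *ℚ Cq +ℚ D₁ *ℚ r ^ℚ l)
          ≡⟨ QS.solve 6 (λ t r y d l c → t QS.:* (r QS.:* y) QS.:* (d QS.:* l QS.:* c QS.:+ d QS.:* l) QS.:=
               t QS.:* (d QS.:* c QS.:+ d) QS.:* ((l QS.:* r) QS.:* y)) refl Cθ (r ^ℚ n) (y ^ℚ n) D₁ (r ^ℚ l) Cq ⟩
        CJ *ℚ ((r ^ℚ l *ℚ r ^ℚ n) *ℚ y ^ℚ n)
          ≡⟨ cong (λ s → CJ *ℚ (s *ℚ y ^ℚ n)) (^ℚ-homo-* r l n) ⟨
        CJ *ℚ (r ^ℚ (l ℕ.+ n) *ℚ y ^ℚ n) ∎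
        where
        N = l ℕ.+ n
        a = seg n (suc l)
        s = seg l (suc (suc (N ℕ.+ n)))

      boundary-bound : ∀ N k → ‖ qq N * (u N * mul⁻ 1# unit (+ k)) ‖ ≤ℚ C∂ *ℚ (r ^ℚ N *ℚ y ^ℚ k)
      boundary-bound N k = ℚ.≤-trans (norm-* (qq-bound N) (norm-* (u-bound N) (Bounded-mul⁻ 0≤1 Bounded-unit norm-1 (+ k))))
        (ℚ.≤-reflexive (QS.solve 5 (λ c v s m y → c QS.:* (v QS.:* s QS.:* (m QS.:* y)) QS.:= c QS.:* (v QS.:* m) QS.:* (s QS.:* y)) refl
          Cq Cu (r ^ℚ N) (1ℚ *ℚ (1ℚ +ℚ x *ℚ 1ℚ)) (y ^ℚ k)))

      weight-suc-neg : ∀ k → weight (ℤ.suc -[1+ k ]) ≡ y ^ℚ k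
      weight-suc-neg zero    = refl
      weight-suc-neg (suc k) = refl

      -- The factor q^(N+1), due to the unpaired last factor of the product, supplies r^N; the
      -- weights at -k and k + 2 are at most the one at k.
      asymmetry-bound : ∀ N k → ‖ qq N * (q ^ suc N * (ψ N 0 (ℤ.suc -[1+ k ]) - q ^ suc k * ψ N 0 (+ suc (suc k)))) ‖ ≤ℚ
        Cq *ℚ (2ℚ *ℚ (Cψ +ℚ 2ℚ *ℚ Cψ)) *ℚ (r ^ℚ N *ℚ y ^ℚ k)
      asymmetry-bound N k = ℚ.≤-trans (norm-* (qq-bound N) (norm-* (q^-mono (ℕ.n≤1+n N))
          (norm-- (subst (λ s → ‖ ψ N 0 (ℤ.suc -[1+ k ]) ‖ ≤ℚ Cψ *ℚ s) (weight-suc-neg k) (Bounded-ψ N (ℤ.suc -[1+ k ])))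
            (norm-* (q^≤2 (suc k)) (ℚ.≤-trans (Bounded-ψ N (+ suc (suc k))) (*-monoˡ Cψ 0≤Cψ (ℚ.≤-trans (y^-down (suc k)) (y^-down k))))))))
        (ℚ.≤-reflexive (QS.solve 4 (λ c s p y → let two = QS.con (+ 1) QS.:+ QS.con (+ 1) in
          c QS.:* ((s QS.:+ s) QS.:* (p QS.:* y QS.:+ two QS.:* (p QS.:* y))) QS.:=
          c QS.:* (two QS.:* (p QS.:+ two QS.:* p)) QS.:* (s QS.:* y)) refl Cq (r ^ℚ N) Cψ (y ^ℚ k)))

      -- Along i + k = N + 1 the first index of `ρ` drops by one, where `ρ-step` would drop it by
      -- two; the excess is a single `δ`.
      truncation-bound : ∀ i k → ‖ θ k + q ^ suc k * ρ i (suc k) - ρ (suc i) k ‖ ≤ℚ Cθ *ℚ (r ^ℚ (i ℕ.+ k) *ℚ y ^ℚ k)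
      truncation-bound zero k = norm-0 (solve 2 (λ t X → t :+ X :* con (+ 0) :- (con (+ 0) :+ t) := con (+ 0)) refl (θ k) (q ^ suc k)) (0≤* 0≤Cθ (0≤ry k k))
      truncation-bound (suc i) k = begin
        ‖ θ k + q ^ suc k * ρ (suc i) (suc k) - ρ (suc (suc i)) k ‖
          ≤⟨ norm-≡ (trans (cong (λ e → θ k + q ^ suc k * ρ (suc i) (suc k) - e) (ρ-step i k))
               (solve 4 (λ t X a b → t :+ X :* (a :+ b) :- (t :+ X :* a) := X :* b) refl (θ k) (q ^ suc k) (ρ i (suc k)) (δ i (suc k))))
               (gain (i ℕ.+ suc k) k 0≤Cθ (δ-bound i (suc k))) ⟩
        r *ℚ (Cθ *ℚ (r ^ℚ (i ℕ.+ suc k) *ℚ y ^ℚ k))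
          ≤⟨ *≤ (0≤* 0≤Cθ (0≤ry (i ℕ.+ suc k) k)) r≤1 ⟩
        Cθ *ℚ (r ^ℚ (i ℕ.+ suc k) *ℚ y ^ℚ k)
          ≡⟨ cong (λ i → Cθ *ℚ (r ^ℚ i *ℚ y ^ℚ k)) (ℕ.+-suc i k) ⟩
        Cθ *ℚ (r ^ℚ (suc i ℕ.+ k) *ℚ y ^ℚ k) ∎

      -- Descent in k. It starts at k = N + 1, where ψ vanishes by degree and `ρ 0` is empty. Each
      -- step contracts the inherited error by r and adds `Ce`, so the fixed point `Ce′` serves for
      -- all k.
      positive-error : ∀ N i k → i ℕ.+ k ≡ suc N → ‖ qq N * ψ N 0 (+ k) - ρ i k ‖ ≤ℚ Ce′ *ℚ (r ^ℚ N *ℚ y ^ℚ k)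
      positive-error N zero k refl = norm-0
        (trans (cong (λ e → qq N * e - 0#) (ψ-support N 0 (suc N) (ℕ.n<1+n N))) (solve 1 (λ a → a :* con (+ 0) :- con (+ 0) := con (+ 0)) refl (qq N)))
        (0≤* 0≤Ce′ (0≤ry N (suc N)))
      positive-error .(i ℕ.+ k) (suc i) k refl = begin
        ‖ C * f - ρ (suc i) k ‖
          ≤⟨ norm-≡ (positive-split C N i k) (norm-+ (norm-+ (norm-- (norm-+ (gain N k 0≤Ce′ (positive-error N i (suc k) (ℕ.+-suc i k))) (J-error i k))
               (boundary-bound N k)) (asymmetry-bound N k)) (truncation-bound i k)) ⟩
        r *ℚ (Ce′ *ℚ Z) +ℚ CJ *ℚ Z +ℚ C∂ *ℚ Z +ℚ Cq *ℚ (2ℚ *ℚ (Cψ +ℚ 2ℚ *ℚ Cψ)) *ℚ Z +ℚ Cθ *ℚ Z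
          ≡⟨ QS.solve 7 (λ r e a b c d Z → r QS.:* (e QS.:* Z) QS.:+ a QS.:* Z QS.:+ b QS.:* Z QS.:+ c QS.:* Z QS.:+ d QS.:* Z QS.:=
               (r QS.:* e QS.:+ (a QS.:+ b QS.:+ c QS.:+ d)) QS.:* Z) refl
               r Ce′ CJ (C∂) (Cq *ℚ (2ℚ *ℚ (Cψ +ℚ 2ℚ *ℚ Cψ))) Cθ Z ⟩
        (r *ℚ Ce′ +ℚ Ce) *ℚ Z
          ≡⟨ cong (_*ℚ Z) fixed-point ⟩
        Ce′ *ℚ Z ∎
        where
        N = i ℕ.+ k
        C = qq N
        Z = r ^ℚ N *ℚ y ^ℚ k
        X = q ^ suc k
        f = ψ N 0 (+ k)
        f₁ = ψ N 0 (+ suc k)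
        j = J N (+ k)
        um = u N * mul⁻ 1# unit (+ k)
        h = q ^ suc N * (ψ N 0 (ℤ.suc -[1+ k ]) - X * ψ N 0 (+ suc (suc k)))
        fixed-point : r *ℚ Ce′ +ℚ Ce ≡ Ce′
        fixed-point = begin-equality
          r *ℚ (Ce *ℚ κ) +ℚ Ce                          ≡⟨ cong (r *ℚ (Ce *ℚ κ) +ℚ_) (ℚ.*-identityʳ Ce) ⟨
          r *ℚ (Ce *ℚ κ) +ℚ Ce *ℚ 1ℚ                    ≡⟨ cong (λ e → r *ℚ (Ce *ℚ κ) +ℚ Ce *ℚ e) κ-inv ⟨
          r *ℚ (Ce *ℚ κ) +ℚ Ce *ℚ (κ *ℚ (1ℚ -ℚ r))      ≡⟨ QS.solve 3 (λ r c κ → r QS.:* (c QS.:* κ) QS.:+ c QS.:* (κ QS.:* (QS.con (+ 1) QS.:- r)) QS.:= c QS.:* κ) refl r Ce κ ⟩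
          Ce *ℚ κ                                       ∎
      negative-error : ∀ i k → ‖ qq (i ℕ.+ k) * ψ (i ℕ.+ k) 0 -[1+ k ] - (ρ (suc i) k - θ k) ‖ ≤ℚ Ce⁻ *ℚ (r ^ℚ (i ℕ.+ k) *ℚ y ^ℚ k)
      negative-error i k = begin
        ‖ C * g - (ρ (suc i) k - θ k) ‖
          ≤⟨ norm-≡ (negative-split C N i k) (norm-- (positive-error N (suc i) k refl) (norm-- (J-error i k) (boundary-bound N k))) ⟩
        Ce′ *ℚ Z +ℚ (CJ *ℚ Z +ℚ C∂ *ℚ Z)
          ≡⟨ QS.solve 4 (λ a b c Z → a QS.:* Z QS.:+ (b QS.:* Z QS.:+ c QS.:* Z) QS.:= (a QS.:+ (b QS.:+ c)) QS.:* Z) refl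
               Ce′ CJ (C∂) Z ⟩
        Ce⁻ *ℚ Z ∎
        where
        N = i ℕ.+ k
        C = qq N
        Z = r ^ℚ N *ℚ y ^ℚ k
        f = ψ N 0 (+ k)
        g = ψ N 0 -[1+ k ]
        j = J N (+ k)
        um = u N * mul⁻ 1# unit (+ k)

-- The main estimate at one index.

module MainEstimate (R : NormedRing) {r b : ℚ} (S : Scale r b) (q z w : NormedRing.Carrier R)
  (q^≤ : ∀ n → NormedRing.‖ R ‖ (Laurent._^_ R q n) ≤ℚ Rationals._^_ r n +ℚ Rationals._^_ r n)
  (z≤b : NormedRing.‖ R ‖ z ≤ℚ b) (w≤b : NormedRing.‖ R ‖ w ≤ℚ b)
  (zw≡1 : NormedRing._*_ R z w ≡ NormedRing.1# R)
  where
  open NormedRing R using (‖_‖)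
  open Laurent R
  open Coefficients q
  open Evaluation R q z w zw≡1
  open Scale S
  open Estimates R S q
  open Rationals using (0≤+; 0≤*; 0≤1; ≤+; *≤) renaming (_^_ to _^ℚ_)
  open ℚ.≤-Reasoning

  -- Equal to 2^(-k) since y b = 1/2; the weight y^k meets the bound b^k for a power of z or 1/z.
  half : ℕ → ℚ
  half k = y ^ℚ k *ℚ b ^ℚ k

  0≤half : ∀ k → 0ℚ ≤ℚ half k
  0≤half k = 0≤* (0≤y^ k) (Rationals.^-nonNeg 0≤b k)

  half-suc : ∀ k → half (suc k) +ℚ half (suc k) ≡ half k
  half-suc k = begin-equality
    half (suc k) +ℚ half (suc k)
      ≡⟨ QS.solve 4 (λ y b Y B → y QS.:* Y QS.:* (b QS.:* B) QS.:+ y QS.:* Y QS.:* (b QS.:* B) QS.:= (y QS.:* b QS.:+ y QS.:* b) QS.:* (Y QS.:* B)) refl y b (y ^ℚ k) (b ^ℚ k) ⟩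
    (y *ℚ b +ℚ y *ℚ b) *ℚ half k
      ≡⟨ cong (_*ℚ half k) 2yb≡1 ⟩
    1ℚ *ℚ half k
      ≡⟨ ℚ.*-identityˡ (half k) ⟩
    half k ∎

  ∑-bound : ∀ K {B f} → 0ℚ ≤ℚ B → (∀ k → k ℕ.< K → ‖ f k ‖ ≤ℚ B *ℚ half k) → ‖ ∑ K f ‖ ≤ℚ B *ℚ 2ℚ
  ∑-bound K {B} {f} 0≤B f≤ = begin
    ‖ ∑ K f ‖                                       ≤⟨ ≤+ (0≤* 0≤B (0≤+ (0≤half K) (0≤half K))) ⟩
    ‖ ∑ K f ‖ +ℚ B *ℚ (half K +ℚ half K)            ≤⟨ partial K (λ k k<K → f≤ k k<K) ⟩
    B *ℚ 2ℚ                                         ∎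
    where
    partial : ∀ K → (∀ k → k ℕ.< K → ‖ f k ‖ ≤ℚ B *ℚ half k) → ‖ ∑ K f ‖ +ℚ B *ℚ (half K +ℚ half K) ≤ℚ B *ℚ 2ℚ
    partial zero f≤ = begin
      ‖ 0# ‖ +ℚ B *ℚ (1ℚ *ℚ 1ℚ +ℚ 1ℚ *ℚ 1ℚ)    ≡⟨ cong (_+ℚ B *ℚ 2ℚ) (NormedRing.‖0‖ R) ⟩
      0ℚ +ℚ B *ℚ 2ℚ                            ≡⟨ ℚ.+-identityˡ (B *ℚ 2ℚ) ⟩
      B *ℚ 2ℚ                                  ∎
    partial (suc K) f≤ = begin
      ‖ ∑ K f + f K ‖ +ℚ B *ℚ (half (suc K) +ℚ half (suc K))
        ≤⟨ ℚ.+-monoˡ-≤ (B *ℚ (half (suc K) +ℚ half (suc K))) (norm-+ ℚ.≤-refl (f≤ K (ℕ.n<1+n K))) ⟩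
      ‖ ∑ K f ‖ +ℚ B *ℚ half K +ℚ B *ℚ (half (suc K) +ℚ half (suc K))
        ≡⟨ cong (λ h → ‖ ∑ K f ‖ +ℚ B *ℚ half K +ℚ B *ℚ h) (half-suc K) ⟩
      ‖ ∑ K f ‖ +ℚ B *ℚ half K +ℚ B *ℚ half K
        ≡⟨ QS.solve 3 (λ s B h → s QS.:+ B QS.:* h QS.:+ B QS.:* h QS.:= s QS.:+ B QS.:* (h QS.:+ h)) refl ‖ ∑ K f ‖ B (half K) ⟩
      ‖ ∑ K f ‖ +ℚ B *ℚ (half K +ℚ half K)
        ≤⟨ partial K (λ k k<K → f≤ k (ℕ.m<n⇒m<1+n k<K)) ⟩
      B *ℚ 2ℚ ∎

  z^≤ : ∀ k → ‖ z ^ k ‖ ≤ℚ b ^ℚ k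
  z^≤ = norm-^ℚ z≤b

  w^≤ : ∀ k → ‖ w ^ k ‖ ≤ℚ b ^ℚ k
  w^≤ = norm-^ℚ w≤b

  0≤1+b : 0ℚ ≤ℚ 1ℚ +ℚ b
  0≤1+b = 0≤+ 0≤1 0≤b

  half≤1 : ∀ k → half k ≤ℚ 1ℚ
  half≤1 zero    = ℚ.≤-refl
  half≤1 (suc k) = ℚ.≤-trans (ℚ.≤-trans (≤+ (0≤half (suc k))) (ℚ.≤-reflexive (half-suc k))) (half≤1 k)

  hecke-bound : ∀ n → ‖ hecke n ‖ ≤ℚ Ch *ℚ r ^ℚ n
  hecke-bound n = begin
    ‖ hecke n ‖
      ≤⟨ norm-≡ (hecke-row n) (norm-- (∑-bound (suc n) (0≤* (0≤* 0≤Cθ 0≤1+b) (0≤r^ n)) summand)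
           (norm-* (θ-bound q^≤ n) (w^≤ (suc n)))) ⟩
    Cθ *ℚ (1ℚ +ℚ b) *ℚ r ^ℚ n *ℚ 2ℚ +ℚ Cθ *ℚ (r ^ℚ n *ℚ y ^ℚ n) *ℚ (b *ℚ b ^ℚ n)
      ≡⟨ QS.solve 7 (λ c c′ s t y b B → c QS.:* s QS.:* t QS.:+ c′ QS.:* (s QS.:* y) QS.:* (b QS.:* B) QS.:=
           c QS.:* t QS.:* s QS.:+ (y QS.:* B) QS.:* (c′ QS.:* b QS.:* s)) refl (Cθ *ℚ (1ℚ +ℚ b)) Cθ (r ^ℚ n) 2ℚ (y ^ℚ n) b (b ^ℚ n) ⟩
    Cθ *ℚ (1ℚ +ℚ b) *ℚ 2ℚ *ℚ r ^ℚ n +ℚ half n *ℚ (Cθ *ℚ b *ℚ r ^ℚ n)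
      ≤⟨ ℚ.+-monoʳ-≤ (Cθ *ℚ (1ℚ +ℚ b) *ℚ 2ℚ *ℚ r ^ℚ n) (*≤ (0≤* (0≤* 0≤Cθ 0≤b) (0≤r^ n)) (half≤1 n)) ⟩
    Cθ *ℚ (1ℚ +ℚ b) *ℚ 2ℚ *ℚ r ^ℚ n +ℚ Cθ *ℚ b *ℚ r ^ℚ n
      ≡⟨ ℚ.*-distribʳ-+ (r ^ℚ n) (Cθ *ℚ (1ℚ +ℚ b) *ℚ 2ℚ) (Cθ *ℚ b) ⟨
    Ch *ℚ r ^ℚ n ∎
    where
    summand : ∀ k → k ℕ.< suc n → ‖ δ (n ℕ.∸ k) k * (z ^ k + w ^ suc k) ‖ ≤ℚ Cθ *ℚ (1ℚ +ℚ b) *ℚ r ^ℚ n *ℚ half k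
    summand k k<1+n = begin
      ‖ δ (n ℕ.∸ k) k * (z ^ k + w ^ suc k) ‖
        ≤⟨ norm-* (δ-bound q^≤ (n ℕ.∸ k) k) (norm-+ (z^≤ k) (w^≤ (suc k))) ⟩
      Cθ *ℚ (r ^ℚ (n ℕ.∸ k ℕ.+ k) *ℚ y ^ℚ k) *ℚ (b ^ℚ k +ℚ b *ℚ b ^ℚ k)
        ≡⟨ cong (λ i → Cθ *ℚ (r ^ℚ i *ℚ y ^ℚ k) *ℚ (b ^ℚ k +ℚ b *ℚ b ^ℚ k)) (ℕ.m∸n+n≡m (ℕ.≤-pred k<1+n)) ⟩
      Cθ *ℚ (r ^ℚ n *ℚ y ^ℚ k) *ℚ (b ^ℚ k +ℚ b *ℚ b ^ℚ k)
        ≡⟨ QS.solve 5 (λ c s y b B → c QS.:* (s QS.:* y) QS.:* (B QS.:+ b QS.:* B) QS.:= c QS.:* (QS.con (+ 1) QS.:+ b) QS.:* s QS.:* (y QS.:* B)) refl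
             Cθ (r ^ℚ n) (y ^ℚ k) b (b ^ℚ k) ⟩
      Cθ *ℚ (1ℚ +ℚ b) *ℚ r ^ℚ n *ℚ half k ∎

  module _ (cancel : ∀ i {a c} → a * (1# - q ^ suc i) ≡ c * (1# - q ^ suc i) → a ≡ c) where

    errorSeq : ℕ → LaurentSeq
    errorSeq N k = qq N * ψ N 0 k - 1# * heckeSeq (suc N) k - 0# * ψ N 0 k

    error-split : ∀ N → qq N * Ψ N 0 - ∑ (suc N) hecke ≡ ev (suc N) (errorSeq N)
    error-split N = trans (cong₂ (λ a c → qq N * a - c) (sym (ev-ψ (suc N) N 0 (ℕ.n<1+n N))) (∑-hecke (suc N)))
      (trans (solve 3 (λ C e h → C :* e :- h := C :* e :- con (+ 1) :* h :- con (+ 0) :* e) refl (qq N) (ev (suc N) (ψ N 0)) (ev (suc N) (heckeSeq (suc N))))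
        (sym (ev-combine (suc N) (qq N) 1# 0# (ψ N 0) (heckeSeq (suc N)) (ψ N 0))))

    error-bound : ∀ N → ‖ qq N * Ψ N 0 - ∑ (suc N) hecke ‖ ≤ℚ (Ce′ +ℚ Ce⁻ *ℚ b) *ℚ r ^ℚ N *ℚ 2ℚ
    error-bound N = norm-≡ (error-split N) (∑-bound (suc N)
      (0≤* (0≤+ 0≤Ce′ (0≤* 0≤Ce⁻ 0≤b)) (0≤r^ N)) summand)
      where
      simplify : ∀ a c d → qq N * a - 1# * c - 0# * d ≡ qq N * a - c
      simplify a c d = solve 4 (λ Q a c d → Q :* a :- con (+ 1) :* c :- con (+ 0) :* d := Q :* a :- c) refl (qq N) a c d
      index : ∀ {k} → k ℕ.≤ N → suc N ℕ.∸ k ≡ suc (N ℕ.∸ k)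
      index k≤N = ℕ.+-∸-assoc 1 k≤N
      positive : ∀ k → k ℕ.≤ N → ‖ errorSeq N (+ k) ‖ ≤ℚ Ce′ *ℚ (r ^ℚ N *ℚ y ^ℚ k)
      positive k k≤N = norm-≡ (simplify (ψ N 0 (+ k)) (ρ (suc N ℕ.∸ k) k) (ψ N 0 (+ k)))
        (positive-error q^≤ cancel N (suc N ℕ.∸ k) k (ℕ.m∸n+n≡m (ℕ.m≤n⇒m≤1+n k≤N)))
      negative : ∀ k → k ℕ.≤ N → ‖ errorSeq N -[1+ k ] ‖ ≤ℚ Ce⁻ *ℚ (r ^ℚ N *ℚ y ^ℚ k)
      negative k k≤N = norm-≡ (trans (simplify (ψ N 0 -[1+ k ]) (ρ (suc N ℕ.∸ k) k - θ k) (ψ N 0 -[1+ k ]))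
          (cong (λ j → qq N * ψ N 0 -[1+ k ] - (ρ j k - θ k)) (index k≤N)))
        (subst (λ M → ‖ qq M * ψ M 0 -[1+ k ] - (ρ (suc (N ℕ.∸ k)) k - θ k) ‖ ≤ℚ Ce⁻ *ℚ (r ^ℚ M *ℚ y ^ℚ k))
          (ℕ.m∸n+n≡m k≤N) (negative-error q^≤ cancel (N ℕ.∸ k) k))
      summand : ∀ k → k ℕ.< suc N → ‖ errorSeq N (+ k) * z ^ k + errorSeq N -[1+ k ] * w ^ suc k ‖ ≤ℚ
        (Ce′ +ℚ Ce⁻ *ℚ b) *ℚ r ^ℚ N *ℚ half k
      summand k k<1+N = ℚ.≤-trans
        (norm-+ (norm-* (positive k (ℕ.≤-pred k<1+N)) (z^≤ k)) (norm-* (negative k (ℕ.≤-pred k<1+N)) (w^≤ (suc k))))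
        (ℚ.≤-reflexive (QS.solve 6 (λ c d s y b B → c QS.:* (s QS.:* y) QS.:* B QS.:+ d QS.:* (s QS.:* y) QS.:* (b QS.:* B) QS.:=
          (c QS.:+ d QS.:* b) QS.:* s QS.:* (y QS.:* B)) refl Ce′ Ce⁻ (r ^ℚ N) (y ^ℚ k) b (b ^ℚ k)))

    -- The degree window must exceed N, so `error-bound` treats N + 1 Hecke terms; the surplus term
    -- is itself O(r^N).
    main-bound : ∀ (v : ℕ → Carrier) → (∀ n → v n * (poch z (suc n) * poch (w * q) (suc n)) ≡ 1#) → ∀ N →
      ‖ (1# - z) * (poch (z * q) N * poch (w * q) N * poch q N) * ∑ N (λ n → u n * v n) - ∑ N hecke ‖ ≤ℚ Cmain *ℚ r ^ℚ N
    main-bound v v-inverse N = begin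
      ‖ (1# - z) * (poch (z * q) N * poch (w * q) N * poch q N) * ∑ N (λ n → u n * v n) - ∑ N hecke ‖
        ≤⟨ norm-≡ split (norm-+ (error-bound N) (hecke-bound N)) ⟩
      (Ce′ +ℚ Ce⁻ *ℚ b) *ℚ r ^ℚ N *ℚ 2ℚ +ℚ Ch *ℚ r ^ℚ N
        ≡⟨ QS.solve 4 (λ c s t h → c QS.:* s QS.:* t QS.:+ h QS.:* s QS.:= (c QS.:* t QS.:+ h) QS.:* s) refl (Ce′ +ℚ Ce⁻ *ℚ b) (r ^ℚ N) 2ℚ Ch ⟩
      Cmain *ℚ r ^ℚ N ∎
      where
      s = ∑ N (λ n → u n * v n)
      split : (1# - z) * (poch (z * q) N * poch (w * q) N * poch q N) * s - ∑ N hecke ≡ qq N * Ψ N 0 - ∑ (suc N) hecke + hecke N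
      split = trans (solve 6 (λ t a c d s h → t :* (a :* c :* d) :* s :- h := d :* (t :* (a :* c) :* s) :- h) refl
                      (1# - z) (poch (z * q) N) (poch (w * q) N) (poch q N) s (∑ N hecke))
        (trans (cong₂ (λ p e → p * e - ∑ N hecke) (sym (qq≡poch N)) (product-sum v v-inverse N 0))
          (solve 3 (λ a s h → a :- s := a :- (s :+ h) :+ h) refl (qq N * Ψ N 0) (∑ N hecke) (hecke N)))

  poch-bound : ∀ {β} (m : Majorant β) a → (∀ n → ‖ a * q ^ n ‖ ≤ℚ β *ℚ r ^ℚ n) → ∀ n → ‖ poch a n ‖ ≤ℚ Majorant.bound m 0
  poch-bound m a a≤ = product-bound m (poch a) (λ n → 1# - a * q ^ n) refl (λ _ → refl) (λ n → norm-- norm-1 (a≤ n))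

  poch-increment : ∀ {β} (m : Majorant β) a → (∀ n → ‖ a * q ^ n ‖ ≤ℚ β *ℚ r ^ℚ n) →
    ∀ n → ‖ poch a (suc n) - poch a n ‖ ≤ℚ Majorant.bound m 0 *ℚ β *ℚ r ^ℚ n
  poch-increment {β} m a a≤ n = ℚ.≤-trans
    (norm-≡ (solve 2 (λ p x → p :* (con (+ 1) :- x) :- p := :- (p :* x)) refl (poch a n) (a * q ^ n))
      (norm-neg (norm-* (poch-bound m a a≤ n) (a≤ n))))
    (ℚ.≤-reflexive (sym (ℚ.*-assoc (Majorant.bound m 0) β (r ^ℚ n))))

  q*q^≤ : ∀ n → ‖ q * q ^ n ‖ ≤ℚ 2ℚ *ℚ r ^ℚ n
  q*q^≤ n = ℚ.≤-trans (q^-mono q^≤ (ℕ.n≤1+n n)) (ℚ.≤-reflexive (double (r ^ℚ n)))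

  scaled-q^≤ : ∀ a → ‖ a ‖ ≤ℚ b → ∀ n → ‖ a * q ^ n ‖ ≤ℚ b *ℚ 2ℚ *ℚ r ^ℚ n
  scaled-q^≤ a a≤b n = ℚ.≤-trans (norm-* a≤b (ℚ.≤-trans (q^≤ n) (ℚ.≤-reflexive (double (r ^ℚ n)))))
    (ℚ.≤-reflexive (sym (ℚ.*-assoc b 2ℚ (r ^ℚ n))))

  scaled-q*q^≤ : ∀ a → ‖ a ‖ ≤ℚ b → ∀ n → ‖ a * q * q ^ n ‖ ≤ℚ b *ℚ 2ℚ *ℚ r ^ℚ n
  scaled-q*q^≤ a a≤b n = ℚ.≤-trans (norm-≡ (*-assoc a q (q ^ n)) (norm-* a≤b (q*q^≤ n)))
    (ℚ.≤-reflexive (sym (ℚ.*-assoc b 2ℚ (r ^ℚ n))))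

  -- The norm is not multiplicative, so a lower bound for the product would not do: its inverse is
  -- bounded directly, factor by factor.
  inverse-product : ∀ {β} (m : Majorant β) a → (∀ i → ∃[ v ] v * (1# - a * q ^ i) ≡ 1# × ‖ v ‖ ≤ℚ 1ℚ +ℚ β *ℚ r ^ℚ i) →
    ∀ n → ∃[ v ] v * poch a n ≡ 1# × ‖ v ‖ ≤ℚ Majorant.bound m 0
  inverse-product {β} m a inverse n = P n , P-inverse n ,
    product-bound m P (λ i → proj₁ (inverse i)) refl (λ _ → refl) (λ i → proj₂ (proj₂ (inverse i))) n
    where
    P : ℕ → Carrier
    P zero    = 1#
    P (suc n) = P n * proj₁ (inverse n)
    P-inverse : ∀ n → P n * poch a n ≡ 1#
    P-inverse zero    = *-identityˡ 1#
    P-inverse (suc n) = trans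
      (solve 4 (λ p v a x → p :* v :* (a :* x) := (p :* a) :* (v :* x)) refl (P n) (proj₁ (inverse n)) (poch a n) (1# - a * q ^ n))
      (trans (cong₂ _*_ (P-inverse n) (proj₁ (proj₂ (inverse n)))) (*-identityˡ 1#))

-- The Gaussian rationals as a normed ring.

record ℚ[i] : Set where
  no-eta-equality; pattern
  constructor _+i_
  field
    re im : ℚ

module GaussianRationals where
  open import Data.Rational.Base using (∣_∣)
  open Rationals
  open ℚ[i]
  open ℚ.≤-Reasoning

  infixl 6 _⊕_
  infixl 7 _⊗_
  infix  8 ⊝_

  _⊕_ _⊗_ : ℚ[i] → ℚ[i] → ℚ[i]
  (a +i b) ⊕ (c +i d) = (a + c) +i (b + d)
  (a +i b) ⊗ (c +i d) = (a * c - b * d) +i (a * d + b * c)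

  ⊝_ : ℚ[i] → ℚ[i]
  ⊝ (a +i b) = (- a) +i (- b)

  𝟘 𝟙 : ℚ[i]
  𝟘 = 0ℚ +i 0ℚ
  𝟙 = 1ℚ +i 0ℚ

  ⊗-assoc : ∀ u v w → (u ⊗ v) ⊗ w ≡ u ⊗ (v ⊗ w)
  ⊗-assoc (a +i b) (c +i d) (e +i f) = cong₂ _+i_
    (solve 6 (λ a b c d e f → (a :* c :- b :* d) :* e :- (a :* d :+ b :* c) :* f := a :* (c :* e :- d :* f) :- b :* (c :* f :+ d :* e)) refl a b c d e f)
    (solve 6 (λ a b c d e f → (a :* c :- b :* d) :* f :+ (a :* d :+ b :* c) :* e := a :* (c :* f :+ d :* e) :+ b :* (c :* e :- d :* f)) refl a b c d e f)

  ⊗-comm : ∀ u v → u ⊗ v ≡ v ⊗ u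
  ⊗-comm (a +i b) (c +i d) = cong₂ _+i_
    (solve 4 (λ a b c d → a :* c :- b :* d := c :* a :- d :* b) refl a b c d)
    (solve 4 (λ a b c d → a :* d :+ b :* c := c :* b :+ d :* a) refl a b c d)

  ⊗-identityˡ : ∀ u → 𝟙 ⊗ u ≡ u
  ⊗-identityˡ (a +i b) = cong₂ _+i_
    (solve 2 (λ a b → con (+ 1) :* a :- con (+ 0) :* b := a) refl a b)
    (solve 2 (λ a b → con (+ 1) :* b :+ con (+ 0) :* a := b) refl a b)

  ⊗-distribˡ-⊕ : ∀ u v w → u ⊗ (v ⊕ w) ≡ (u ⊗ v) ⊕ (u ⊗ w)
  ⊗-distribˡ-⊕ (a +i b) (c +i d) (e +i f) = cong₂ _+i_
    (solve 6 (λ a b c d e f → a :* (c :+ e) :- b :* (d :+ f) := (a :* c :- b :* d) :+ (a :* e :- b :* f)) refl a b c d e f)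
    (solve 6 (λ a b c d e f → a :* (d :+ f) :+ b :* (c :+ e) := (a :* d :+ b :* c) :+ (a :* f :+ b :* e)) refl a b c d e f)

  ⊕-comm : ∀ u v → u ⊕ v ≡ v ⊕ u
  ⊕-comm (a +i b) (c +i d) = cong₂ _+i_ (ℚ.+-comm a c) (ℚ.+-comm b d)

  isCommutativeRing : IsCommutativeRing _≡_ _⊕_ _⊗_ ⊝_ 𝟘 𝟙
  isCommutativeRing = record
    { isRing = record
      { +-isAbelianGroup = record
        { isGroup = record
          { isMonoid = record
            { isSemigroup = record
              { isMagma = record { isEquivalence = ≡.isEquivalence ; ∙-cong = cong₂ _⊕_ }
              ; assoc = λ { (a +i b) (c +i d) (e +i f) → cong₂ _+i_ (ℚ.+-assoc a c e) (ℚ.+-assoc b d f) }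
              }
            ; identity = (λ { (a +i b) → cong₂ _+i_ (ℚ.+-identityˡ a) (ℚ.+-identityˡ b) })
                       , (λ { (a +i b) → cong₂ _+i_ (ℚ.+-identityʳ a) (ℚ.+-identityʳ b) })
            }
          ; inverse = (λ { (a +i b) → cong₂ _+i_ (ℚ.+-inverseˡ a) (ℚ.+-inverseˡ b) })
                    , (λ { (a +i b) → cong₂ _+i_ (ℚ.+-inverseʳ a) (ℚ.+-inverseʳ b) })
          ; ⁻¹-cong = cong ⊝_
          }
        ; comm = ⊕-comm
        }
      ; *-cong = cong₂ _⊗_
      ; *-assoc = ⊗-assoc
      ; *-identity = ⊗-identityˡ , λ u → trans (⊗-comm u 𝟙) (⊗-identityˡ u)
      ; distrib = ⊗-distribˡ-⊕
                , λ u v w → trans (⊗-comm (v ⊕ w) u) (trans (⊗-distribˡ-⊕ u v w) (cong₂ _⊕_ (⊗-comm u v) (⊗-comm u w)))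
      }
    ; *-comm = ⊗-comm
    }

  -- Rational-valued and submultiplicative, unlike the modulus, but ∣ q ∣ < 1 only yields norm (q ^ n) ≤ 2 r ^ n.
  norm : ℚ[i] → ℚ
  norm (a +i b) = ∣ a ∣ + ∣ b ∣

  ∣re∣≤norm : ∀ u → ∣ re u ∣ ≤ norm u
  ∣re∣≤norm (a +i b) = ≤+ (ℚ.0≤∣p∣ b)

  norm-⊕ : ∀ u v → norm (u ⊕ v) ≤ norm u + norm v
  norm-⊕ (a +i b) (c +i d) = begin
    ∣ a + c ∣ + ∣ b + d ∣                  ≤⟨ ℚ.+-mono-≤ (ℚ.∣p+q∣≤∣p∣+∣q∣ a c) (ℚ.∣p+q∣≤∣p∣+∣q∣ b d) ⟩
    (∣ a ∣ + ∣ c ∣) + (∣ b ∣ + ∣ d ∣)      ≡⟨ solve 4 (λ a b c d → (a :+ c) :+ (b :+ d) := (a :+ b) :+ (c :+ d)) refl (∣ a ∣) (∣ b ∣) (∣ c ∣) (∣ d ∣) ⟩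
    (∣ a ∣ + ∣ b ∣) + (∣ c ∣ + ∣ d ∣)      ∎

  norm-⊗ : ∀ u v → norm (u ⊗ v) ≤ norm u * norm v
  norm-⊗ (a +i b) (c +i d) = begin
    ∣ a * c - b * d ∣ + ∣ a * d + b * c ∣
      ≤⟨ ℚ.+-mono-≤ (ℚ.∣p-q∣≤∣p∣+∣q∣ (a * c) (b * d)) (ℚ.∣p+q∣≤∣p∣+∣q∣ (a * d) (b * c)) ⟩
    (∣ a * c ∣ + ∣ b * d ∣) + (∣ a * d ∣ + ∣ b * c ∣)
      ≡⟨ cong₂ _+_ (cong₂ _+_ (ℚ.∣p*q∣≡∣p∣*∣q∣ a c) (ℚ.∣p*q∣≡∣p∣*∣q∣ b d)) (cong₂ _+_ (ℚ.∣p*q∣≡∣p∣*∣q∣ a d) (ℚ.∣p*q∣≡∣p∣*∣q∣ b c)) ⟩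
    (∣ a ∣ * ∣ c ∣ + ∣ b ∣ * ∣ d ∣) + (∣ a ∣ * ∣ d ∣ + ∣ b ∣ * ∣ c ∣)
      ≡⟨ solve 4 (λ a b c d → (a :* c :+ b :* d) :+ (a :* d :+ b :* c) := (a :+ b) :* (c :+ d)) refl (∣ a ∣) (∣ b ∣) (∣ c ∣) (∣ d ∣) ⟩
    (∣ a ∣ + ∣ b ∣) * (∣ c ∣ + ∣ d ∣) ∎

  normedRing : NormedRing
  normedRing = record
    { isCommutativeRing = isCommutativeRing
    ; ‖_‖       = norm
    ; ‖‖-nonNeg = λ { (a +i b) → 0≤+ (ℚ.0≤∣p∣ a) (ℚ.0≤∣p∣ b) }
    ; ‖0‖       = refl
    ; ‖1‖       = refl
    ; ‖-‖       = λ { (a +i b) → cong₂ _+_ (ℚ.∣-p∣≡∣p∣ a) (ℚ.∣-p∣≡∣p∣ b) }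
    ; ‖+‖       = norm-⊕
    ; ‖*‖       = norm-⊗
    }

  0≤square : ∀ a → 0ℚ ≤ a * a
  0≤square a with ℚ.≤-total 0ℚ a
  ... | inj₁ 0≤a = 0≤* 0≤a 0≤a
  ... | inj₂ a≤0 = ℚ.≤-trans (0≤* 0≤-a 0≤-a) (ℚ.≤-reflexive (solve 1 (λ a → :- a :* :- a := a :* a) refl a))
    where
    0≤-a : 0ℚ ≤ - a
    0≤-a = ℚ.neg-antimono-≤ a≤0

  square-∣∣ : ∀ a → ∣ a ∣ * ∣ a ∣ ≡ a * a
  square-∣∣ a = trans (sym (ℚ.∣p*q∣≡∣p∣*∣q∣ a a)) (ℚ.0≤p⇒∣p∣≡p (0≤square a))

  square-cancel-≤ : ∀ {a b} → 0ℚ ≤ b → a * a ≤ b * b → ∣ a ∣ ≤ b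
  square-cancel-≤ {a} {b} 0≤b a²≤b² = ℚ.≮⇒≥ (λ b<∣a∣ → ℚ.<-irrefl refl (begin-strict
    b * b            ≤⟨ *-monoˡ b 0≤b (ℚ.<⇒≤ b<∣a∣) ⟩
    b * ∣ a ∣        <⟨ ℚ.*-monoˡ-<-pos ∣ a ∣ {{ℚ.positive (ℚ.≤-<-trans 0≤b b<∣a∣)}} b<∣a∣ ⟩
    ∣ a ∣ * ∣ a ∣    ≡⟨ square-∣∣ a ⟩
    a * a            ≤⟨ a²≤b² ⟩
    b * b            ∎))

  modulus² : ℚ[i] → ℚ
  modulus² u = re u * re u + im u * im u

  modulus²-⊗ : ∀ u v → modulus² (u ⊗ v) ≡ modulus² u * modulus² v
  modulus²-⊗ (a +i b) (c +i d) = solve 4 (λ a b c d → (a :* c :- b :* d) :* (a :* c :- b :* d) :+ (a :* d :+ b :* c) :* (a :* d :+ b :* c) :=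
    (a :* a :+ b :* b) :* (c :* c :+ d :* d)) refl a b c d

  0≤modulus² : ∀ u → 0ℚ ≤ modulus² u
  0≤modulus² (a +i b) = 0≤+ (0≤square a) (0≤square b)

  modulus²≤norm² : ∀ u → modulus² u ≤ norm u * norm u
  modulus²≤norm² (a +i b) = begin
    a * a + b * b                                        ≡⟨ cong₂ _+_ (square-∣∣ a) (square-∣∣ b) ⟨
    ∣ a ∣ * ∣ a ∣ + ∣ b ∣ * ∣ b ∣                        ≤⟨ ≤+ (0≤+ (0≤* (ℚ.0≤∣p∣ a) (ℚ.0≤∣p∣ b)) (0≤* (ℚ.0≤∣p∣ a) (ℚ.0≤∣p∣ b))) ⟩
    ∣ a ∣ * ∣ a ∣ + ∣ b ∣ * ∣ b ∣ + (∣ a ∣ * ∣ b ∣ + ∣ a ∣ * ∣ b ∣)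
      ≡⟨ solve 2 (λ a b → a :* a :+ b :* b :+ (a :* b :+ a :* b) := (a :+ b) :* (a :+ b)) refl (∣ a ∣) (∣ b ∣) ⟩
    (∣ a ∣ + ∣ b ∣) * (∣ a ∣ + ∣ b ∣) ∎

  norm≤2modulus : ∀ u s → 0ℚ ≤ s → modulus² u ≤ s * s → norm u ≤ s + s
  norm≤2modulus (a +i b) s 0≤s h = ℚ.+-mono-≤
    (square-cancel-≤ {a} 0≤s (ℚ.≤-trans (≤+ (0≤square b)) h))
    (square-cancel-≤ {b} 0≤s (ℚ.≤-trans (+≤ (0≤square a)) h))

  -- From (|a| - 1/2)² ≥ 0, with 1/4 rounded up to 1/2. Two of these bound `norm` by 1 + `modulus²`
  -- without a square root.
  ∣∣≤½+square : ∀ a → ∣ a ∣ ≤ ½ + a * a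
  ∣∣≤½+square a = 0≤-⇒≤ (begin
    0ℚ                                                  ≤⟨ 0≤+ (0≤square (∣ a ∣ - ½)) (ℚ.nonNegative⁻¹ (½ - ½ * ½)) ⟩
    (∣ a ∣ - ½) * (∣ a ∣ - ½) + (½ - ½ * ½)             ≡⟨ solve 2 (λ a h → (a :- h) :* (a :- h) :+ (h :- h :* h) := h :+ a :* a :- (h :+ h) :* a) refl (∣ a ∣) ½ ⟩
    ½ + ∣ a ∣ * ∣ a ∣ - 1ℚ * ∣ a ∣                      ≡⟨ cong₂ (λ s t → ½ + s - t) (square-∣∣ a) (ℚ.*-identityˡ ∣ a ∣) ⟩
    ½ + a * a - ∣ a ∣                                   ∎)

  norm≤1+modulus² : ∀ u → norm u ≤ 1ℚ + modulus² u
  norm≤1+modulus² (a +i b) = ℚ.≤-trans (ℚ.+-mono-≤ (∣∣≤½+square a) (∣∣≤½+square b))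
    (ℚ.≤-reflexive (solve 3 (λ h s t → (h :+ s) :+ (h :+ t) := (h :+ h) :+ (s :+ t)) refl ½ (a * a) (b * b)))

  conjugate-inverse : ∀ u t → t * modulus² u ≡ 1ℚ → ((re u * t) +i (- im u * t)) ⊗ u ≡ 𝟙
  conjugate-inverse (a +i b) t e = cong₂ _+i_
    (trans (solve 3 (λ a b t → a :* t :* a :- (:- b) :* t :* b := t :* (a :* a :+ b :* b)) refl a b t) e)
    (solve 3 (λ a b t → a :* t :* b :+ (:- b) :* t :* a := con (+ 0)) refl a b t)

  conjugate-norm : ∀ u t → 0ℚ ≤ t → t * modulus² u ≡ 1ℚ → norm ((re u * t) +i (- im u * t)) ≤ 1ℚ + t
  conjugate-norm (a +i b) t 0≤t e = begin
    ∣ a * t ∣ + ∣ - b * t ∣         ≡⟨ cong₂ _+_ (ℚ.∣p*q∣≡∣p∣*∣q∣ a t) (trans (ℚ.∣p*q∣≡∣p∣*∣q∣ (- b) t) (cong (_* ∣ t ∣) (ℚ.∣-p∣≡∣p∣ b))) ⟩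
    ∣ a ∣ * ∣ t ∣ + ∣ b ∣ * ∣ t ∣   ≡⟨ cong (λ s → ∣ a ∣ * s + ∣ b ∣ * s) (ℚ.0≤p⇒∣p∣≡p 0≤t) ⟩
    ∣ a ∣ * t + ∣ b ∣ * t           ≡⟨ ℚ.*-distribʳ-+ t ∣ a ∣ ∣ b ∣ ⟨
    (∣ a ∣ + ∣ b ∣) * t             ≤⟨ *-monoʳ t 0≤t (norm≤1+modulus² (a +i b)) ⟩
    (1ℚ + (a * a + b * b)) * t      ≡⟨ solve 2 (λ m t → (con (+ 1) :+ m) :* t := t :+ t :* m) refl (a * a + b * b) t ⟩
    t + t * (a * a + b * b)         ≡⟨ cong (λ s → t + s) e ⟩
    t + 1ℚ                          ≡⟨ ℚ.+-comm t 1ℚ ⟩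
    1ℚ + t                          ∎

  inverse-unique : ∀ {u v v′} → v ⊗ u ≡ 𝟙 → v′ ⊗ u ≡ 𝟙 → v ≡ v′
  inverse-unique {u} {v} {v′} vu≡1 v′u≡1 =
    trans (sym (⊗-identityˡ v))
    (trans (cong (_⊗ v) (sym v′u≡1))
    (trans (⊗-assoc v′ u v)
    (trans (cong (v′ ⊗_) (trans (⊗-comm u v) vu≡1))
    (trans (⊗-comm v′ 𝟙) (⊗-identityˡ v′)))))

  a≤∣a∣ : ∀ a → a ≤ ∣ a ∣
  a≤∣a∣ a with ℚ.≤-total 0ℚ a
  ... | inj₁ 0≤a = ℚ.≤-reflexive (sym (ℚ.0≤p⇒∣p∣≡p 0≤a))
  ... | inj₂ a≤0 = ℚ.≤-trans a≤0 (ℚ.0≤∣p∣ a)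

  1-x-positive : ∀ x s → ∣ re x ∣ ≤ s → s < 1ℚ → 0ℚ < modulus² (𝟙 ⊕ (⊝ x))
  1-x-positive (a +i b) s ∣a∣≤s s<1 = ℚ.<-≤-trans (0<* 0<1-a 0<1-a) (≤+ (0≤square (0ℚ - b)))
    where
    0<1-a : 0ℚ < 1ℚ - a
    0<1-a = <⇒0<- {a} {1ℚ} (ℚ.≤-<-trans (ℚ.≤-trans (a≤∣a∣ a) ∣a∣≤s) s<1)

  -- v = 1 + v x and the triangle inequality bound the norm of v = 1 / (1 - x).
  small-inverse : ∀ v x t → v ⊗ (𝟙 ⊕ (⊝ x)) ≡ 𝟙 → norm x ≤ t → t ≤ ½ → norm v ≤ 1ℚ + (t + t)
  small-inverse v x t e x≤t t≤½ = ℚ.*-cancelʳ-≤-pos (1ℚ - t) {{ℚ.positive 0<1-t}} (begin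
    norm v * (1ℚ - t)                          ≡⟨ solve 2 (λ v t → v :* (con (+ 1) :- t) := v :- v :* t) refl (norm v) t ⟩
    norm v - norm v * t                        ≤⟨ ℚ.+-monoˡ-≤ (- (norm v * t)) v≤1+vt ⟩
    1ℚ + norm v * t - norm v * t               ≡⟨ solve 1 (λ a → con (+ 1) :+ a :- a := con (+ 1)) refl (norm v * t) ⟩
    1ℚ                                         ≤⟨ ≤+ (0≤* 0≤t (≤⇒0≤- 2t≤1)) ⟩
    1ℚ + t * (1ℚ - (t + t))                    ≡⟨ solve 1 (λ t → con (+ 1) :+ t :* (con (+ 1) :- (t :+ t)) := (con (+ 1) :+ (t :+ t)) :* (con (+ 1) :- t)) refl t ⟩
    (1ℚ + (t + t)) * (1ℚ - t)                  ∎)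
    where
    module L = Laurent normedRing
    0≤t : 0ℚ ≤ t
    0≤t = ℚ.≤-trans (NormedRing.‖‖-nonNeg normedRing x) x≤t
    2t≤1 : t + t ≤ 1ℚ
    2t≤1 = ℚ.+-mono-≤ t≤½ t≤½
    0<1-t : 0ℚ < 1ℚ - t
    ½<1 : ½ < 1ℚ
    ½<1 = ℚ.*<* (ℤ.+<+ (ℕ.s≤s (ℕ.s≤s ℕ.z≤n)))
    0<1-t = <⇒0<- {t} {1ℚ} (ℚ.≤-<-trans t≤½ ½<1)
    v≡ : v ≡ 𝟙 ⊕ (v ⊗ x)
    v≡ = trans (L.solve 2 (λ v x → v L.:= v L.:* (L.con (+ 1) L.:- x) L.:+ v L.:* x) refl v x) (cong (_⊕ (v ⊗ x)) e)
    v≤1+vt : norm v ≤ 1ℚ + norm v * t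
    v≤1+vt = begin
      norm v                          ≡⟨ cong norm v≡ ⟩
      norm (𝟙 ⊕ (v ⊗ x))              ≤⟨ norm-⊕ 𝟙 (v ⊗ x) ⟩
      1ℚ + norm (v ⊗ x)               ≤⟨ ℚ.+-monoʳ-≤ 1ℚ (norm-⊗ v x) ⟩
      1ℚ + norm v * norm x            ≤⟨ ℚ.+-monoʳ-≤ 1ℚ (*-monoˡ (norm v) (NormedRing.‖‖-nonNeg normedRing v) x≤t) ⟩
      1ℚ + norm v * t                 ∎

-- Complex numbers read index by index.

open import Defs

module G = GaussianRationals
module L = Laurent G.normedRing
open G using (_⊕_; _⊗_; ⊝_; 𝟙; norm; modulus²)

at : ℂ → ℕ → ℚ[i]
at y n = seq (re y) n +i seq (im y) n

eventually-× : ∀ {P Q : ℕ → Set} → Eventually P → Eventually Q → Eventually (λ n → P n × Q n)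
eventually-× (M , p) (N , q) = M ℕ.⊔ N , λ n h → p n (ℕ.m⊔n≤o⇒m≤o M N h) , q n (ℕ.m⊔n≤o⇒n≤o M N h)

module Termwise where
  open Rationals using (0≤+; *-monoˡ; *-monoʳ; *-mono-≤; reciprocal)

  at-∑ : ∀ N f n → at (∑< N f) n ≡ L.∑ N (λ i → at (f i) n)
  at-∑ zero    f n = refl
  at-∑ (suc N) f n = trans (cong (at (f 0) n ⊕_) (at-∑ N (λ i → f (suc i)) n)) (sym (L.∑-head N (λ i → at (f i) n)))

  ∏ : ℕ → (ℕ → ℚ[i]) → ℚ[i]
  ∏ zero    f = 𝟙
  ∏ (suc n) f = ∏ n f ⊗ f n

  ∏-head : ∀ n f → ∏ (suc n) f ≡ f 0 ⊗ ∏ n (λ i → f (suc i))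
  ∏-head zero    f = G.⊗-comm 𝟙 (f 0)
  ∏-head (suc n) f = trans (cong (_⊗ f (suc n)) (∏-head n f)) (G.⊗-assoc (f 0) (∏ n (λ i → f (suc i))) (f (suc n)))

  at-∏ : ∀ N f n → at (∏< N f) n ≡ ∏ N (λ i → at (f i) n)
  at-∏ zero    f n = refl
  at-∏ (suc N) f n = trans (cong (at (f 0) n ⊗_) (at-∏ N (λ i → f (suc i)) n)) (sym (∏-head N (λ i → at (f i) n)))

  at-^ : ∀ y m n → at (y ^ m) n ≡ at y n L.^ m
  at-^ y zero    n = refl
  at-^ y (suc m) n = cong (at y n ⊗_) (at-^ y m n)

  at-qPoch : ∀ a q N n → at (qPoch a q N) n ≡ L.Coefficients.poch (at q n) (at a n) N
  at-qPoch a q N n = trans (at-∏ N (λ i → 1ℂ - a * q ^ i) n) (lemma N)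
    where
    lemma : ∀ N → ∏ N (λ i → at (1ℂ - a * q ^ i) n) ≡ L.Coefficients.poch (at q n) (at a n) N
    lemma zero    = refl
    lemma (suc N) = cong₂ (λ p x → p ⊗ (𝟙 ⊕ (⊝ (at a n ⊗ x)))) (lemma N) (at-^ q N n)

  reciprocalᴷ : ℚ[i] → ℚ[i]
  reciprocalᴷ u = (ℚ[i].re u ℚ.* invℚ (modulus² u)) +i (ℚ.- ℚ[i].im u ℚ.* invℚ (modulus² u))

  at-inv : ∀ y (p : y # 0ℂ) n → at (inv y p) n ≡ reciprocalᴷ (at y n)
  at-inv y (ε , 0<ε , N , h) n = refl

  reciprocal-inverse : ∀ u → 0ℚ ℚ.< modulus² u → reciprocalᴷ u ⊗ u ≡ 𝟙
  reciprocal-inverse u 0<m = G.conjugate-inverse u (invℚ (modulus² u)) (invℚ-inverseˡ (modulus² u) 0<m)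

  unit⇒0<modulus² : ∀ {u v} → v ⊗ u ≡ 𝟙 → 0ℚ ℚ.< modulus² u
  unit⇒0<modulus² {u} {v} vu≡1 = ℚ.≰⇒> (λ m≤0 → ℚ.1≢0 (begin
    1ℚ                          ≡⟨ cong modulus² vu≡1 ⟨
    modulus² (v ⊗ u)            ≡⟨ G.modulus²-⊗ v u ⟩
    modulus² v ℚ.* modulus² u   ≡⟨ cong (modulus² v ℚ.*_) (ℚ.≤-antisym m≤0 (G.0≤modulus² u)) ⟩
    modulus² v ℚ.* 0ℚ           ≡⟨ ℚ.*-zeroʳ (modulus² v) ⟩
    0ℚ                          ∎))
    where open ≡-Reasoning

  -- Identifies an inverse assembled from bounded factors with the termwise reciprocal that `inv`
  -- computes.
  reciprocal-unique : ∀ {u v} → v ⊗ u ≡ 𝟙 → reciprocalᴷ u ≡ v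
  reciprocal-unique {u} {v} vu≡1 = G.inverse-unique (reciprocal-inverse u (unit⇒0<modulus² {u} {v} vu≡1)) vu≡1

  -- Equivalent to y # 0, but visibly closed under products and provable by ring identities at each
  -- index.
  BoundedInverse : ℂ → Set
  BoundedInverse y = ∃[ B ] Eventually (λ n → ∃[ v ] v ⊗ at y n ≡ 𝟙 × norm v ℚ.≤ B)

  positive⇒boundedInverse : ∀ y → 0ᴿ <ᴿ ∣ y ∣² → BoundedInverse y
  positive⇒boundedInverse y (ε , 0<ε , N , h) with reciprocal 0<ε
  ... | c , 0<c , εc≡1 = 1ℚ ℚ.+ c , N , λ n N≤n →
    let u = at y n
        m = modulus² u
        t = invℚ m
        ε<m : ε ℚ.< m
        ε<m = subst (ℚ._< m) (ℚ.+-identityˡ ε) (h n N≤n)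
        0<m = ℚ.<-trans 0<ε ε<m
        tm≡1 = invℚ-inverseˡ m 0<m
        0≤t : 0ℚ ℚ.≤ t
        0≤t = ℚ.*-cancelʳ-≤-pos m {{ℚ.positive 0<m}} (≤-by (ℚ.*-zeroˡ m) tm≡1 Rationals.0≤1)
    in reciprocalᴷ u , reciprocal-inverse u 0<m ,
       ℚ.≤-trans (G.conjugate-norm u t 0≤t tm≡1) (ℚ.+-monoʳ-≤ 1ℚ (t≤c t m 0≤t tm≡1 (ℚ.<⇒≤ ε<m)))
    where
    open ℚ.≤-Reasoning
    ≤-by : ∀ {a a′ b b′} → a ≡ a′ → b ≡ b′ → a′ ℚ.≤ b′ → a ℚ.≤ b
    ≤-by refl refl p = p
    t≤c : ∀ t m → 0ℚ ℚ.≤ t → t ℚ.* m ≡ 1ℚ → ε ℚ.≤ m → t ℚ.≤ c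
    t≤c t m 0≤t tm≡1 ε≤m = begin
      t                    ≡⟨ ℚ.*-identityʳ t ⟨
      t ℚ.* 1ℚ             ≡⟨ cong (t ℚ.*_) εc≡1 ⟨
      t ℚ.* (ε ℚ.* c)      ≤⟨ *-monoˡ t 0≤t (*-monoʳ c (ℚ.<⇒≤ 0<c) ε≤m) ⟩
      t ℚ.* (m ℚ.* c)      ≡⟨ ℚ.*-assoc t m c ⟨
      t ℚ.* m ℚ.* c        ≡⟨ cong (ℚ._* c) tm≡1 ⟩
      1ℚ ℚ.* c             ≡⟨ ℚ.*-identityˡ c ⟩
      c                    ∎

  -- The gap is 1 / (B² + 1): 1 = |v|² |u|² ≤ B² |u|² < (B² + 1) |u|². The added 1 makes the
  -- inequality strict and the reciprocal exist even for B = 0.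
  boundedInverse⇒#0 : ∀ y → BoundedInverse y → y # 0ℂ
  boundedInverse⇒#0 y (B , N , h) with reciprocal {B ℚ.* B ℚ.+ 1ℚ} (ℚ.+-mono-≤-< (G.0≤square B) (ℚ.positive⁻¹ 1ℚ))
  ... | c , 0<c , [B²+1]c≡1 = c , 0<c , N , λ n N≤n → begin-strict
    0ℚ ℚ.+ c                   ≡⟨ ℚ.+-identityˡ c ⟩
    c                          <⟨ small (at y n) (h n N≤n) ⟩
    modulus² (at y n)          ≡⟨ cong₂ (λ a b → a ℚ.* a ℚ.+ b ℚ.* b) (ℚ.+-identityʳ (seq (re y) n)) (ℚ.+-identityʳ (seq (im y) n)) ⟨
    seq ∣ y - 0ℂ ∣² n          ∎
    where
    open ℚ.≤-Reasoning
    small : ∀ u → ∃[ v ] v ⊗ u ≡ 𝟙 × norm v ℚ.≤ B → c ℚ.< modulus² u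
    small u (v , vu≡1 , v≤B) = ℚ.*-cancelˡ-<-nonNeg (B ℚ.* B ℚ.+ 1ℚ) {{ℚ.nonNegative (0≤+ (G.0≤square B) Rationals.0≤1)}} (begin-strict
      (B ℚ.* B ℚ.+ 1ℚ) ℚ.* c                      ≡⟨ [B²+1]c≡1 ⟩
      1ℚ                                          ≡⟨ cong modulus² vu≡1 ⟨
      modulus² (v ⊗ u)                            ≡⟨ G.modulus²-⊗ v u ⟩
      modulus² v ℚ.* m                            ≤⟨ *-monoʳ m (G.0≤modulus² u) (ℚ.≤-trans (G.modulus²≤norm² v) (*-mono-≤ 0≤v v≤B 0≤v v≤B)) ⟩
      B ℚ.* B ℚ.* m                               ≡⟨ ℚ.+-identityʳ (B ℚ.* B ℚ.* m) ⟨
      B ℚ.* B ℚ.* m ℚ.+ 0ℚ                        <⟨ ℚ.+-monoʳ-< (B ℚ.* B ℚ.* m) (unit⇒0<modulus² {u} {v} vu≡1) ⟩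
      B ℚ.* B ℚ.* m ℚ.+ m                         ≡⟨ cong (B ℚ.* B ℚ.* m ℚ.+_) (ℚ.*-identityˡ m) ⟨
      B ℚ.* B ℚ.* m ℚ.+ 1ℚ ℚ.* m                  ≡⟨ ℚ.*-distribʳ-+ m (B ℚ.* B) 1ℚ ⟨
      (B ℚ.* B ℚ.+ 1ℚ) ℚ.* m                      ∎)
      where
      m = modulus² u
      0≤v = NormedRing.‖‖-nonNeg G.normedRing v

  boundedInverse-* : ∀ x y → BoundedInverse x → BoundedInverse y → BoundedInverse (x * y)
  boundedInverse-* x y (B , p) (C , q) with eventually-× p q
  ... | N , h = B ℚ.* C , N , λ n N≤n → invert (at x n) (at y n) (h n N≤n)
    where
    invert : ∀ u u′ → (∃[ v ] v ⊗ u ≡ 𝟙 × norm v ℚ.≤ B) × (∃[ v ] v ⊗ u′ ≡ 𝟙 × norm v ℚ.≤ C) →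
      ∃[ v ] v ⊗ (u ⊗ u′) ≡ 𝟙 × norm v ℚ.≤ B ℚ.* C
    invert u u′ ((v , vu≡1 , v≤B) , (v′ , v′u′≡1 , v′≤C)) = v ⊗ v′ ,
      trans (L.solve 4 (λ v v′ u u′ → (v L.:* v′) L.:* (u L.:* u′) L.:= (v L.:* u) L.:* (v′ L.:* u′)) refl v v′ u u′)
        (trans (cong₂ _⊗_ vu≡1 v′u′≡1) (G.⊗-identityˡ 𝟙)) ,
      ℚ.≤-trans (G.norm-⊗ v v′) (*-mono-≤ (0≤norm v) v≤B (0≤norm v′) v′≤C)
      where 0≤norm = NormedRing.‖‖-nonNeg G.normedRing

  boundedInverse-resp : ∀ x y → Eventually (λ n → at x n ≡ at y n) → BoundedInverse x → BoundedInverse y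
  boundedInverse-resp x y e (B , p) with eventually-× e p
  ... | N , h = B , N , λ n N≤n → let eq , v , vx≡1 , v≤B = h n N≤n in v , trans (cong (v ⊗_) (sym eq)) vx≡1 , v≤B

  boundedInverse-^ : ∀ x m → BoundedInverse x → BoundedInverse (x ^ m)
  boundedInverse-^ x zero    _ = 1ℚ , 0 , λ n _ → 𝟙 , G.⊗-identityˡ 𝟙 , ℚ.≤-refl
  boundedInverse-^ x (suc m) p = boundedInverse-* x (x ^ m) p (boundedInverse-^ x m p)

  bounded : ∀ y → ∃[ B ] 0ℚ ℚ.≤ B × Eventually (λ n → norm (at y n) ℚ.≤ B)
  bounded y =
    let B , 0<B , M , h = cauchy-bounded {seq (re y)} (cauchy (re y))
        C , 0<C , N , k = cauchy-bounded {seq (im y)} (cauchy (im y))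
    in B ℚ.+ C , 0≤+ (ℚ.<⇒≤ 0<B) (ℚ.<⇒≤ 0<C) , M ℕ.⊔ N ,
       λ n l → ℚ.+-mono-≤ (h n (ℕ.m⊔n≤o⇒m≤o M N l)) (k n (ℕ.m⊔n≤o⇒n≤o M N l))

  inv-inverse : ∀ x (p : x # 0ℂ) → Eventually (λ n → at (inv x p) n ⊗ at x n ≡ 𝟙)
  inv-inverse x p =
    let ε , 0<ε , N , h = #0⇒0<∣∣² x p
    in N , λ n N≤n → trans (cong (_⊗ at x n) (at-inv x p n))
         (reciprocal-inverse (at x n) (ℚ.<-trans 0<ε (subst (ℚ._< modulus² (at x n)) (ℚ.+-identityˡ ε) (h n N≤n))))

-- Limits as diagonal sequences.

open Termwise

-- Both diagonal entries are compared with one fixed row f N, each at its own index; the budget is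
-- ε/4 + ε/2 + ε/4.
diagonal-cauchy : (f : ℕ → ℝ) →
  (∀ δ → 0ℚ ℚ.< δ → ∃[ N ] Eventually (λ n → ℚ.∣ seq (f n) n ℚ.- seq (f N) n ∣ ℚ.≤ δ)) →
  IsCauchy (λ n → seq (f n) n)
diagonal-cauchy f tail ε 0<ε =
  let δ = ½ ℚ.* (½ ℚ.* ε)
      N , K , close = tail δ (½-pos (½-pos 0<ε))
      M , near = cauchy (f N) (½ ℚ.* ε) (½-pos 0<ε)
  in K ℕ.⊔ M , λ m n h k → begin-strict
    ℚ.∣ seq (f m) m ℚ.- seq (f n) n ∣
      ≡⟨ cong ℚ.∣_∣ (solve 4 (λ a b c d → a :- d := (a :- b) :+ (b :- c) :+ (:- (d :- c))) refl
           (seq (f m) m) (seq (f N) m) (seq (f N) n) (seq (f n) n)) ⟩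
    ℚ.∣ (seq (f m) m ℚ.- seq (f N) m) ℚ.+ (seq (f N) m ℚ.- seq (f N) n) ℚ.+ ℚ.- (seq (f n) n ℚ.- seq (f N) n) ∣
      ≤⟨ ℚ.≤-trans (ℚ.∣p+q∣≤∣p∣+∣q∣ (seq (f m) m ℚ.- seq (f N) m ℚ.+ (seq (f N) m ℚ.- seq (f N) n)) (ℚ.- (seq (f n) n ℚ.- seq (f N) n)))
           (ℚ.+-monoˡ-≤ _ (ℚ.∣p+q∣≤∣p∣+∣q∣ (seq (f m) m ℚ.- seq (f N) m) (seq (f N) m ℚ.- seq (f N) n))) ⟩
    ℚ.∣ seq (f m) m ℚ.- seq (f N) m ∣ ℚ.+ ℚ.∣ seq (f N) m ℚ.- seq (f N) n ∣ ℚ.+ ℚ.∣ ℚ.- (seq (f n) n ℚ.- seq (f N) n) ∣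
      <⟨ ℚ.+-mono-<-≤ (ℚ.+-mono-≤-< (close m (ℕ.m⊔n≤o⇒m≤o K M h)) (near m n (ℕ.m⊔n≤o⇒n≤o K M h) (ℕ.m⊔n≤o⇒n≤o K M k)))
           (ℚ.≤-trans (ℚ.≤-reflexive (ℚ.∣-p∣≡∣p∣ (seq (f n) n ℚ.- seq (f N) n))) (close n (ℕ.m⊔n≤o⇒m≤o K M k))) ⟩
    δ ℚ.+ ½ ℚ.* ε ℚ.+ δ
      ≡⟨ solve 2 (λ d e → d :+ e :+ d := (d :+ d) :+ e) refl δ (½ ℚ.* ε) ⟩
    (δ ℚ.+ δ) ℚ.+ ½ ℚ.* ε
      ≡⟨ trans (cong (ℚ._+ ½ ℚ.* ε) (½+½ (½ ℚ.* ε))) (½+½ ε) ⟩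
    ε ∎
  where
  open Rationals using (solve; _:=_; _:+_; _:-_; :-_)
  open ℚ.≤-Reasoning

module Limits (r κ : ℚ) (0<r : 0ℚ ℚ.< r) (r<1 : r ℚ.< 1ℚ) (0≤κ : 0ℚ ℚ.≤ κ) (κ-inv : κ ℚ.* (1ℚ ℚ.- r) ≡ 1ℚ) where
  open Rationals using (0≤*; ≤+; *-monoˡ; *-mono-≤; ≤⇒0≤-; module Geometric)
    renaming (_^_ to _^ℚ_)
  open Geometric r 0<r r<1
  open ℚ.≤-Reasoning

  norm-self : ∀ u → norm (u L.- u) ≡ 0ℚ
  norm-self u = trans (cong norm (L.-‿inverseʳ u)) (NormedRing.‖0‖ G.normedRing)

  -- The quantifier order matters: one threshold for n serves all N, so the bound may be used at N
  -- near n.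
  Geometric-Cauchy : (ℕ → ℂ) → ℚ → Set
  Geometric-Cauchy s B = Eventually (λ n → ∀ N → norm (at (s (suc N)) n L.- at (s N) n) ℚ.≤ B ℚ.* r ^ℚ N)

  module _ (s : ℕ → ℂ) (B : ℚ) (0≤B : 0ℚ ℚ.≤ B) (gc : Geometric-Cauchy s B) where

    n₀ = proj₁ gc

    tail-bound : ∀ n → n₀ ℕ.≤ n → ∀ k N → norm (at (s (k ℕ.+ N)) n L.- at (s N) n) ℚ.≤ B ℚ.* κ ℚ.* (r ^ℚ N ℚ.- r ^ℚ (k ℕ.+ N))
    tail-bound n n₀≤n zero N = begin
      norm (at (s N) n L.- at (s N) n)         ≡⟨ norm-self (at (s N) n) ⟩
      0ℚ                                       ≤⟨ 0≤* (0≤* 0≤B 0≤κ) (≤⇒0≤- {r ^ℚ N} {r ^ℚ N} ℚ.≤-refl) ⟩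
      B ℚ.* κ ℚ.* (r ^ℚ N ℚ.- r ^ℚ N)          ∎
    tail-bound n n₀≤n (suc k) N = begin
      norm (a L.- c)
        ≡⟨ cong norm (L.solve 3 (λ a b c → a L.:- c L.:= (b L.:- c) L.:+ (a L.:- b)) refl a b c) ⟩
      norm ((b L.- c) ⊕ (a L.- b))
        ≤⟨ ℚ.≤-trans (G.norm-⊕ (b L.- c) (a L.- b)) (ℚ.+-mono-≤ (tail-bound n n₀≤n k N) (proj₂ gc n n₀≤n (k ℕ.+ N))) ⟩
      B ℚ.* κ ℚ.* (r ^ℚ N ℚ.- r ^ℚ (k ℕ.+ N)) ℚ.+ B ℚ.* r ^ℚ (k ℕ.+ N)
        ≡⟨ Inequalities.telescoping-bound r κ B (r ^ℚ N) (r ^ℚ (k ℕ.+ N)) κ-inv ⟩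
      B ℚ.* κ ℚ.* (r ^ℚ N ℚ.- r ^ℚ (suc k ℕ.+ N)) ∎
      where
      a = at (s (suc k ℕ.+ N)) n
      b = at (s (k ℕ.+ N)) n
      c = at (s N) n

    tail-small : ∀ δ → 0ℚ ℚ.< δ → ∃[ I ] (∀ N n → I ℕ.≤ N → N ℕ.≤ n → n₀ ℕ.≤ n → norm (at (s n) n L.- at (s N) n) ℚ.≤ δ)
    tail-small δ 0<δ =
      let I , small = vanishing (B ℚ.* κ) δ (0≤* 0≤B 0≤κ) 0<δ
      in I , λ N n I≤N N≤n n₀≤n → begin
        norm (at (s n) n L.- at (s N) n)
          ≡⟨ cong (λ m → norm (at (s m) n L.- at (s N) n)) (ℕ.m∸n+n≡m N≤n) ⟨
        norm (at (s (n ℕ.∸ N ℕ.+ N)) n L.- at (s N) n)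
          ≤⟨ tail-bound n n₀≤n (n ℕ.∸ N) N ⟩
        B ℚ.* κ ℚ.* (r ^ℚ N ℚ.- r ^ℚ (n ℕ.∸ N ℕ.+ N))
          ≤⟨ *-monoˡ (B ℚ.* κ) (0≤* 0≤B 0≤κ) (difference N (n ℕ.∸ N ℕ.+ N)) ⟩
        B ℚ.* κ ℚ.* r ^ℚ N
          ≤⟨ small N I≤N ⟩
        δ ∎
      where
      difference : ∀ m k → r ^ℚ m ℚ.- r ^ℚ k ℚ.≤ r ^ℚ m
      difference m k = ℚ.≤-trans (ℚ.+-monoʳ-≤ (r ^ℚ m) (ℚ.neg-antimono-≤ (0≤r^ k))) (ℚ.≤-reflexive (ℚ.+-identityʳ (r ^ℚ m)))

    component-cauchy : (c : ℂ → ℝ) → (∀ y y′ n → ℚ.∣ seq (c y) n ℚ.- seq (c y′) n ∣ ℚ.≤ norm (at y n L.- at y′ n)) →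
      IsCauchy (λ n → seq (c (s n)) n)
    component-cauchy c c≤ = diagonal-cauchy (λ n → c (s n)) (λ δ 0<δ →
      let I , small = tail-small δ 0<δ
      in I , I ℕ.⊔ n₀ , λ n h → ℚ.≤-trans (c≤ (s n) (s I) n)
           (small I n ℕ.≤-refl (ℕ.m⊔n≤o⇒m≤o I n₀ h) (ℕ.m⊔n≤o⇒n≤o I n₀ h)))

    -- The estimates are uniform in the index, so the diagonal sequence is a limit.
    limit : ℂ
    limit = mkℝ (λ n → seq (re (s n)) n) (component-cauchy re (λ y y′ n → ≤+ (ℚ.0≤∣p∣ (seq (im y) n ℚ.- seq (im y′) n))))
         +i mkℝ (λ n → seq (im (s n)) n) (component-cauchy im (λ y y′ n → Rationals.+≤ (ℚ.0≤∣p∣ (seq (re y) n ℚ.- seq (re y′) n))))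

    limit-converges : Converges s limit
    limit-converges ε 0<ε =
      let I , small = tail-small (½ ℚ.* ε) (½-pos 0<ε)
      in I , λ N I≤N → η , 0<η , N ℕ.⊔ n₀ , λ n h →
        let d = at (s N) n L.- at (s n) n
            d≤ : norm d ℚ.≤ ½ ℚ.* ε
            d≤ = ℚ.≤-trans (ℚ.≤-reflexive (trans
                   (cong norm (L.solve 2 (λ a b → a L.:- b L.:= L.:- (b L.:- a)) refl (at (s N) n) (at (s n) n)))
                   (NormedRing.‖-‖ G.normedRing (at (s n) n L.- at (s N) n))))
                   (small N n I≤N (ℕ.m⊔n≤o⇒m≤o N n₀ h) (ℕ.m⊔n≤o⇒n≤o N n₀ h))
            0≤d = NormedRing.‖‖-nonNeg G.normedRing d
        in begin-strict
          modulus² d ℚ.+ η                     ≤⟨ ℚ.+-monoˡ-≤ η (ℚ.≤-trans (G.modulus²≤norm² d) (*-mono-≤ 0≤d d≤ 0≤d d≤)) ⟩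
          η ℚ.+ η                              ≡⟨ ℚ.+-identityʳ (η ℚ.+ η) ⟨
          (η ℚ.+ η) ℚ.+ 0ℚ                     <⟨ ℚ.+-monoʳ-< (η ℚ.+ η) (ℚ.+-mono-< 0<η 0<η) ⟩
          (η ℚ.+ η) ℚ.+ (η ℚ.+ η)              ≡⟨ solve 1 (λ h → (h :* h :+ h :* h) :+ (h :* h :+ h :* h) := (h :+ h) :* (h :+ h)) refl (½ ℚ.* ε) ⟩
          (½ ℚ.* ε ℚ.+ ½ ℚ.* ε) ℚ.* (½ ℚ.* ε ℚ.+ ½ ℚ.* ε)   ≡⟨ cong₂ ℚ._*_ (½+½ ε) (½+½ ε) ⟩
          ε ℚ.* ε                              ∎
      where
      open Rationals using (solve; _:=_; _:+_; _:*_)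
      η = (½ ℚ.* ε) ℚ.* (½ ℚ.* ε)
      0<η : 0ℚ ℚ.< η
      0<η = Rationals.0<* (½-pos 0<ε) (½-pos 0<ε)

  vanishing⇒≃ : ∀ x y B → 0ℚ ℚ.≤ B → Eventually (λ n → norm (at x n L.- at y n) ℚ.≤ B ℚ.* r ^ℚ n) → x ≃ y
  vanishing⇒≃ x y B 0≤B (n₀ , h) =
    (λ ε 0<ε → let I , small = vanishing B (½ ℚ.* ε) 0≤B (½-pos 0<ε) in I ℕ.⊔ n₀ , λ n k → ℚ.≤-<-trans
      (ℚ.≤-trans (≤+ (ℚ.0≤∣p∣ (seq (im x) n ℚ.- seq (im y) n))) (bound ε n I small k)) (half<ε 0<ε)) ,
    (λ ε 0<ε → let I , small = vanishing B (½ ℚ.* ε) 0≤B (½-pos 0<ε) in I ℕ.⊔ n₀ , λ n k → ℚ.≤-<-trans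
      (ℚ.≤-trans (Rationals.+≤ (ℚ.0≤∣p∣ (seq (re x) n ℚ.- seq (re y) n))) (bound ε n I small k)) (half<ε 0<ε))
    where
    bound : ∀ ε n I → (∀ n → I ℕ.≤ n → B ℚ.* r ^ℚ n ℚ.≤ ½ ℚ.* ε) → I ℕ.⊔ n₀ ℕ.≤ n → norm (at x n L.- at y n) ℚ.≤ ½ ℚ.* ε
    bound ε n I small k = ℚ.≤-trans (h n (ℕ.m⊔n≤o⇒n≤o I n₀ k)) (small n (ℕ.m⊔n≤o⇒m≤o I n₀ k))
    half<ε : ∀ {ε} → 0ℚ ℚ.< ε → ½ ℚ.* ε ℚ.< ε
    half<ε {ε} 0<ε = begin-strict
      ½ ℚ.* ε                  ≡⟨ ℚ.+-identityʳ (½ ℚ.* ε) ⟨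
      ½ ℚ.* ε ℚ.+ 0ℚ           <⟨ ℚ.+-monoʳ-< (½ ℚ.* ε) (½-pos 0<ε) ⟩
      ½ ℚ.* ε ℚ.+ ½ ℚ.* ε      ≡⟨ ½+½ ε ⟩
      ε                        ∎

-- Exact halving, powers of q, and bounded inverses of the factors.

n/2≡⌊n/2⌋ : ∀ n → n ℕ./ 2 ≡ ⌊ n /2⌋
n/2≡⌊n/2⌋ zero          = refl
n/2≡⌊n/2⌋ (suc zero)    = refl
n/2≡⌊n/2⌋ (suc (suc n)) = trans (ℕ.m/n≡1+[m∸n]/n {suc (suc n)} {2} (ℕ.s≤s (ℕ.s≤s ℕ.z≤n))) (cong suc (n/2≡⌊n/2⌋ n))

n[1+n]≡triangular*2 : ∀ n → n ℕ.* suc n ≡ triangular n ℕ.* 2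
n[1+n]≡triangular*2 zero    = refl
n[1+n]≡triangular*2 (suc n) = begin
  suc n ℕ.* suc (suc n)                  ≡⟨ solve 1 (λ n → (con 1 :+ n) :* (con 2 :+ n) := (con 1 :+ n) :* con 2 :+ n :* (con 1 :+ n)) refl n ⟩
  suc n ℕ.* 2 ℕ.+ n ℕ.* suc n            ≡⟨ cong (suc n ℕ.* 2 ℕ.+_) (n[1+n]≡triangular*2 n) ⟩
  suc n ℕ.* 2 ℕ.+ triangular n ℕ.* 2     ≡⟨ ℕ.*-distribʳ-+ 2 (suc n) (triangular n) ⟨
  (suc n ℕ.+ triangular n) ℕ.* 2         ∎
  where
  open ≡-Reasoning
  open ℕSolver.+-*-Solver

n[1+n]/2≡triangular : ∀ n → n ℕ.* suc n ℕ./ 2 ≡ triangular n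
n[1+n]/2≡triangular n = trans (cong (ℕ._/ 2) (n[1+n]≡triangular*2 n)) (ℕ.m*n/n≡m (triangular n) 2)

-- With gap ε below 1 take r = 1 - ε/2, since 1 - ε ≤ (1 - ε/2)². Nonnegativity of |q|² forces ε <
-- 1, hence r > 0.
radius : ∀ q → ∣ q ∣< 1ℚ → ∃[ r ] 0ℚ ℚ.< r × r ℚ.< 1ℚ × Eventually (λ n → modulus² (at q n) ℚ.≤ r ℚ.* r)
radius q (ε , 0<ε , N , h) = 1ℚ ℚ.- ½ ℚ.* ε , 0<r , r<1 , N , λ n N≤n → begin
  modulus² (at q n)
    ≡⟨ solve 2 (λ m e → m := (m :+ e) :- e) refl (modulus² (at q n)) ε ⟩
  (modulus² (at q n) ℚ.+ ε) ℚ.- ε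
    ≤⟨ ℚ.+-monoˡ-≤ (ℚ.- ε) (ℚ.<⇒≤ (h n N≤n)) ⟩
  1ℚ ℚ.* 1ℚ ℚ.- ε
    ≤⟨ ≤+ (G.0≤square (½ ℚ.* ε)) ⟩
  1ℚ ℚ.* 1ℚ ℚ.- ε ℚ.+ ½ ℚ.* ε ℚ.* (½ ℚ.* ε)
    ≡⟨ cong (λ e → 1ℚ ℚ.* 1ℚ ℚ.- e ℚ.+ ½ ℚ.* ε ℚ.* (½ ℚ.* ε)) (½+½ ε) ⟨
  1ℚ ℚ.* 1ℚ ℚ.- (½ ℚ.* ε ℚ.+ ½ ℚ.* ε) ℚ.+ ½ ℚ.* ε ℚ.* (½ ℚ.* ε)
    ≡⟨ solve 1 (λ h → con (+ 1) :* con (+ 1) :- (h :+ h) :+ h :* h := (con (+ 1) :- h) :* (con (+ 1) :- h)) refl (½ ℚ.* ε) ⟩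
  (1ℚ ℚ.- ½ ℚ.* ε) ℚ.* (1ℚ ℚ.- ½ ℚ.* ε) ∎
  where
  open Rationals using (solve; _:=_; _:+_; _:-_; _:*_; con; ≤+; <⇒0<-)
  open ℚ.≤-Reasoning
  ε<1 : ε ℚ.< 1ℚ
  ε<1 = begin-strict
    ε                           ≡⟨ ℚ.+-identityˡ ε ⟨
    0ℚ ℚ.+ ε                    ≤⟨ ℚ.+-monoˡ-≤ ε (G.0≤modulus² (at q N)) ⟩
    modulus² (at q N) ℚ.+ ε     <⟨ h N ℕ.≤-refl ⟩
    1ℚ ℚ.* 1ℚ                   ≡⟨ ℚ.*-identityˡ 1ℚ ⟩
    1ℚ                          ∎
  ½ε<1 : ½ ℚ.* ε ℚ.< 1ℚ
  ½ε<1 = begin-strict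
    ½ ℚ.* ε                     ≡⟨ ℚ.+-identityʳ (½ ℚ.* ε) ⟨
    ½ ℚ.* ε ℚ.+ 0ℚ              <⟨ ℚ.+-monoʳ-< (½ ℚ.* ε) (½-pos 0<ε) ⟩
    ½ ℚ.* ε ℚ.+ ½ ℚ.* ε         ≡⟨ ½+½ ε ⟩
    ε                           <⟨ ε<1 ⟩
    1ℚ                          ∎
  0<r : 0ℚ ℚ.< 1ℚ ℚ.- ½ ℚ.* ε
  0<r = <⇒0<- ½ε<1
  r<1 : 1ℚ ℚ.- ½ ℚ.* ε ℚ.< 1ℚ
  r<1 = begin-strict
    1ℚ ℚ.- ½ ℚ.* ε              <⟨ ℚ.+-monoʳ-< 1ℚ (ℚ.neg-antimono-< (½-pos 0<ε)) ⟩
    1ℚ ℚ.+ 0ℚ                   ≡⟨ ℚ.+-identityʳ 1ℚ ⟩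
    1ℚ                          ∎

module Powers (u : ℚ[i]) (r : ℚ) (0<r : 0ℚ ℚ.< r) (r<1 : r ℚ.< 1ℚ) (u≤r : modulus² u ℚ.≤ r ℚ.* r) where
  open Rationals using (solve; _:=_; _:*_; *-mono-≤; ≤+; module Geometric) renaming (_^_ to _^ℚ_)
  open Geometric r 0<r r<1
  open ℚ.≤-Reasoning

  modulus²-^ : ∀ m → modulus² (u L.^ m) ℚ.≤ r ^ℚ m ℚ.* r ^ℚ m
  modulus²-^ zero    = ℚ.≤-refl
  modulus²-^ (suc m) = begin
    modulus² (u ⊗ (u L.^ m))                ≡⟨ G.modulus²-⊗ u (u L.^ m) ⟩
    modulus² u ℚ.* modulus² (u L.^ m)       ≤⟨ *-mono-≤ (G.0≤modulus² u) u≤r (G.0≤modulus² (u L.^ m)) (modulus²-^ m) ⟩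
    r ℚ.* r ℚ.* (r ^ℚ m ℚ.* r ^ℚ m)         ≡⟨ solve 2 (λ r s → r :* r :* (s :* s) := (r :* s) :* (r :* s)) refl r (r ^ℚ m) ⟩
    r ^ℚ suc m ℚ.* r ^ℚ suc m               ∎

  norm-^ : ∀ m → norm (u L.^ m) ℚ.≤ r ^ℚ m ℚ.+ r ^ℚ m
  norm-^ m = G.norm≤2modulus (u L.^ m) (r ^ℚ m) (0≤r^ m) (modulus²-^ m)

  1-u^-positive : ∀ m → 0ℚ ℚ.< modulus² (𝟙 L.- u L.^ suc m)
  1-u^-positive m = G.1-x-positive (u L.^ suc m) (r ^ℚ suc m)
    (G.square-cancel-≤ {ℚ[i].re (u L.^ suc m)} (0≤r^ (suc m))
      (ℚ.≤-trans (≤+ (G.0≤square (ℚ[i].im (u L.^ suc m)))) (modulus²-^ (suc m))))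
    (ℚ.≤-<-trans (ℚ.≤-trans (ℚ.≤-reflexive (ℚ.*-comm r (r ^ℚ m))) (Rationals.*≤ 0≤r (r^≤1 m))) r<1)

  1-u^-cancel : ∀ m {a c} → a ⊗ (𝟙 L.- u L.^ suc m) ≡ c ⊗ (𝟙 L.- u L.^ suc m) → a ≡ c
  1-u^-cancel m {a} {c} e = trans (sym (undo a)) (trans (cong (_⊗ reciprocalᴷ x) e) (undo c))
    where
    x = 𝟙 L.- u L.^ suc m
    undo : ∀ a → (a ⊗ x) ⊗ reciprocalᴷ x ≡ a
    undo a = trans (G.⊗-assoc a x (reciprocalᴷ x)) (trans (cong (a ⊗_) (trans (G.⊗-comm x (reciprocalᴷ x)) (reciprocal-inverse x (1-u^-positive m))))
      (trans (G.⊗-comm a 𝟙) (G.⊗-identityˡ a)))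

module InverseBounds (q : ℂ) (r : ℚ) (0<r : 0ℚ ℚ.< r) (r<1 : r ℚ.< 1ℚ) where
  open Rationals using (0≤*; 0≤+; ≤+; *-monoʳ; reciprocal; ^-pos; module Geometric) renaming (_^_ to _^ℚ_)
  open Geometric r 0<r r<1
  open ℚ.≤-Reasoning

  -- The bound has the shape 1 + β r^i so that a `Majorant` controls the product of all these
  -- inverses.
  Invertible : ℂ → ℚ → ℕ → ℕ → Set
  Invertible a β n i = ∃[ v ] v ⊗ (𝟙 L.- at a n ⊗ (at q n L.^ i)) ≡ 𝟙 × norm v ℚ.≤ 1ℚ ℚ.+ β ℚ.* r ^ℚ i

  Invertible-mono : ∀ a {β β′} n i → β ℚ.≤ β′ → Invertible a β n i → Invertible a β′ n i
  Invertible-mono a n i β≤β′ (v , e , v≤) = v , e , ℚ.≤-trans v≤ (ℚ.+-monoʳ-≤ 1ℚ (*-monoʳ (r ^ℚ i) (0≤r^ i) β≤β′))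

  -- For a single i any bound B takes the required shape once it is divided by r^i; the finitely
  -- many constants are added up.
  finitely-many : ∀ a → (∀ i → BoundedInverse (1ℂ - a * q ^ i)) → ∀ I →
    ∃[ β ] 0ℚ ℚ.≤ β × Eventually (λ n → ∀ i → i ℕ.< I → Invertible a β n i)
  finitely-many a inverse zero = 0ℚ , ℚ.≤-refl , 0 , λ _ _ _ ()
  finitely-many a inverse (suc I) =
    let β , 0≤β , E = finitely-many a inverse I
        B , E′ = inverse I
        s , 0<s , r^Is≡1 = reciprocal (^-pos 0<r I)
        0≤∣B∣s : 0ℚ ℚ.≤ ℚ.∣ B ∣ ℚ.* s
        0≤∣B∣s = 0≤* (ℚ.0≤∣p∣ B) (ℚ.<⇒≤ 0<s)
        N , h = eventually-× E E′
    in β ℚ.+ ℚ.∣ B ∣ ℚ.* s , 0≤+ 0≤β 0≤∣B∣s , N ,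
       λ n N≤n → step n β (ℚ.∣ B ∣ ℚ.* s) B 0≤β 0≤∣B∣s (enough B s r^Is≡1) (proj₁ (h n N≤n)) (proj₂ (h n N≤n))
    where
    enough : ∀ B s → r ^ℚ I ℚ.* s ≡ 1ℚ → B ℚ.≤ ℚ.∣ B ∣ ℚ.* s ℚ.* r ^ℚ I
    enough B s e = begin
      B                             ≤⟨ G.a≤∣a∣ B ⟩
      ℚ.∣ B ∣                       ≡⟨ ℚ.*-identityʳ ℚ.∣ B ∣ ⟨
      ℚ.∣ B ∣ ℚ.* 1ℚ                ≡⟨ cong (ℚ.∣ B ∣ ℚ.*_) (trans (ℚ.*-comm s (r ^ℚ I)) e) ⟨
      ℚ.∣ B ∣ ℚ.* (s ℚ.* r ^ℚ I)    ≡⟨ ℚ.*-assoc ℚ.∣ B ∣ s (r ^ℚ I) ⟨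
      ℚ.∣ B ∣ ℚ.* s ℚ.* r ^ℚ I      ∎
    step : ∀ n β γ B → 0ℚ ℚ.≤ β → 0ℚ ℚ.≤ γ → B ℚ.≤ γ ℚ.* r ^ℚ I → (∀ i → i ℕ.< I → Invertible a β n i) →
      (∃[ v ] v ⊗ at (1ℂ - a * q ^ I) n ≡ 𝟙 × norm v ℚ.≤ B) → ∀ i → i ℕ.< suc I → Invertible a (β ℚ.+ γ) n i
    step n β γ B 0≤β 0≤γ B≤ below (v , e , v≤B) i i<1+I with i ℕ.≟ I
    ... | no i≢I = Invertible-mono a {β} n i (≤+ 0≤γ) (below i (ℕ.≤∧≢⇒< (ℕ.≤-pred i<1+I) i≢I))
    ... | yes refl = v , trans (cong (λ x → v ⊗ (𝟙 ⊕ (⊝ (at a n ⊗ x)))) (sym (at-^ q i n))) e , (begin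
      norm v                        ≤⟨ v≤B ⟩
      B                             ≤⟨ B≤ ⟩
      γ ℚ.* r ^ℚ i                  ≤⟨ *-monoʳ (r ^ℚ i) (0≤r^ i) (Rationals.+≤ 0≤β) ⟩
      (β ℚ.+ γ) ℚ.* r ^ℚ i          ≤⟨ Rationals.+≤ Rationals.0≤1 ⟩
      1ℚ ℚ.+ (β ℚ.+ γ) ℚ.* r ^ℚ i   ∎)

  -- From I on, β₀ r^i ≤ 1/2 and `small-inverse` gives 1 + 2 β₀ r^i; below I the individual inverses
  -- are used.
  all-invertible : ∀ a β₀ → 0ℚ ℚ.≤ β₀ → Eventually (λ n → ∀ i → norm (at a n ⊗ (at q n L.^ i)) ℚ.≤ β₀ ℚ.* r ^ℚ i) →
    (∀ i → BoundedInverse (1ℂ - a * q ^ i)) → ∃[ β ] 0ℚ ℚ.≤ β × Eventually (λ n → ∀ i → Invertible a β n i)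
  all-invertible a β₀ 0≤β₀ decay inverse =
    let I , small = vanishing β₀ ½ 0≤β₀ (ℚ.positive⁻¹ ½)
        β , 0≤β , E = finitely-many a inverse I
        N , h = eventually-× E decay
    in β ℚ.+ (β₀ ℚ.+ β₀) , 0≤+ 0≤β (0≤+ 0≤β₀ 0≤β₀) , N ,
       λ n N≤n i → choose n β 0≤β I small (proj₁ (h n N≤n)) (proj₂ (h n N≤n)) i
    where
    ½<1 : ½ ℚ.< 1ℚ
    ½<1 = ℚ.*<* (ℤ.+<+ (ℕ.s≤s (ℕ.s≤s ℕ.z≤n)))
    choose : ∀ n β → 0ℚ ℚ.≤ β → ∀ I → (∀ n → I ℕ.≤ n → β₀ ℚ.* r ^ℚ n ℚ.≤ ½) → (∀ i → i ℕ.< I → Invertible a β n i) →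
      (∀ i → norm (at a n ⊗ (at q n L.^ i)) ℚ.≤ β₀ ℚ.* r ^ℚ i) → ∀ i → Invertible a (β ℚ.+ (β₀ ℚ.+ β₀)) n i
    choose n β 0≤β I small below decay i with i ℕ.<? I
    ... | yes i<I = Invertible-mono a {β} n i (≤+ (0≤+ 0≤β₀ 0≤β₀)) (below i i<I)
    ... | no i≮I = Invertible-mono a {β₀ ℚ.+ β₀} n i (Rationals.+≤ 0≤β) (reciprocalᴷ (𝟙 ⊕ (⊝ x)) , inverse-x ,
      ℚ.≤-trans (G.small-inverse (reciprocalᴷ (𝟙 ⊕ (⊝ x))) x t inverse-x (decay i) t≤½)
        (ℚ.≤-reflexive (cong (1ℚ ℚ.+_) (sym (ℚ.*-distribʳ-+ (r ^ℚ i) β₀ β₀)))))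
      where
      x = at a n ⊗ (at q n L.^ i)
      t = β₀ ℚ.* r ^ℚ i
      t≤½ : t ℚ.≤ ½
      t≤½ = small i (ℕ.≮⇒≥ i≮I)
      inverse-x : reciprocalᴷ (𝟙 ⊕ (⊝ x)) ⊗ (𝟙 ⊕ (⊝ x)) ≡ 𝟙
      inverse-x = reciprocal-inverse (𝟙 ⊕ (⊝ x)) (G.1-x-positive x t (ℚ.≤-trans (G.∣re∣≤norm x) (decay i)) (ℚ.≤-<-trans t≤½ ½<1))

-- The denominators of g₂ are apart from 0.

module Denominators (q z : ℂ) (q#0 : q # 0ℂ) (z#0 : z # 0ℂ) (z#q^ : ∀ (m : ℤ) → z # zpow q q#0 m) where
  boundedInverse-q : BoundedInverse q
  boundedInverse-q = positive⇒boundedInverse q (#0⇒0<∣∣² q q#0)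

  wz≡1 : Eventually (λ n → at (inv z z#0) n ⊗ at z n ≡ 𝟙)
  wz≡1 = inv-inverse z z#0

  boundedInverse-w : BoundedInverse (inv z z#0)
  boundedInverse-w =
    let B , _ , E = bounded z
        N , h = eventually-× E wz≡1
    in B , N , λ n N≤n → at z n , trans (G.⊗-comm (at z n) (at (inv z z#0) n)) (proj₂ (h n N≤n)) , proj₁ (h n N≤n)

  boundedInverse--1 : BoundedInverse (- 1ℂ)
  boundedInverse--1 = 1ℚ , 0 , λ n _ → ⊝ 𝟙 , L.-1*-1≡1 ,
    ℚ.≤-reflexive (trans (NormedRing.‖-‖ G.normedRing 𝟙) (NormedRing.‖1‖ G.normedRing))

  inverse-power : ∀ u v → v ⊗ u ≡ 𝟙 → ∀ m → (v L.^ m) ⊗ (u L.^ m) ≡ 𝟙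
  inverse-power u v vu≡1 zero    = G.⊗-identityˡ 𝟙
  inverse-power u v vu≡1 (suc m) = trans
    (L.solve 4 (λ v u a b → (v L.:* a) L.:* (u L.:* b) L.:= (v L.:* u) L.:* (a L.:* b)) refl v u (v L.^ m) (u L.^ m))
    (trans (cong₂ _⊗_ vu≡1 (inverse-power u v vu≡1 m)) (G.⊗-identityˡ 𝟙))

  -- 1 - z q^i = -(z - p) q^i with p = q^(-i): here z is kept apart from the nonpositive powers of
  -- q.
  factor-z-via : ∀ p i → z # p → Eventually (λ n → at p n ⊗ at (q ^ i) n ≡ 𝟙) → BoundedInverse (1ℂ - z * q ^ i)
  factor-z-via p i z#p (N , pq≡1) = boundedInverse-resp (- 1ℂ * ((z - p) * q ^ i)) (1ℂ - z * q ^ i)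
    (N , λ n N≤n → trans
      (L.solve 3 (λ z p Q → (L.:- L.con (+ 1)) L.:* ((z L.:- p) L.:* Q) L.:= p L.:* Q L.:- z L.:* Q) refl (at z n) (at p n) (at (q ^ i) n))
      (cong (λ e → e ⊕ (⊝ (at z n ⊗ at (q ^ i) n))) (pq≡1 n N≤n)))
    (boundedInverse-* (- 1ℂ) ((z - p) * q ^ i) boundedInverse--1
      (boundedInverse-* (z - p) (q ^ i) (positive⇒boundedInverse (z - p) z#p) (boundedInverse-^ q i boundedInverse-q)))

  factor-z : ∀ i → BoundedInverse (1ℂ - z * q ^ i)
  factor-z zero    = factor-z-via 1ℂ 0 (z#q^ (+ 0)) (0 , λ n _ → G.⊗-identityˡ 𝟙)
  factor-z (suc i) =
    let N , h = inv-inverse q q#0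
    in factor-z-via (inv q q#0 ^ suc i) (suc i) (z#q^ -[1+ i ]) (N , λ n N≤n →
      trans (cong₂ _⊗_ (at-^ (inv q q#0) (suc i) n) (at-^ q (suc i) n)) (inverse-power (at q n) (at (inv q q#0) n) (h n N≤n) (suc i)))

  -- 1 - q^(i+1)/z = (z - q^(i+1))/z: here z is kept apart from the positive powers of q.
  factor-w : ∀ i → BoundedInverse (1ℂ - (inv z z#0 * q) * q ^ i)
  factor-w i =
    let N , h = wz≡1
    in boundedInverse-resp (inv z z#0 * (z - q ^ suc i)) (1ℂ - (inv z z#0 * q) * q ^ i)
      (N , λ n N≤n → trans
        (L.solve 4 (λ v z q Q → v L.:* (z L.:- q L.:* Q) L.:= v L.:* z L.:- (v L.:* q) L.:* Q) refl (at (inv z z#0) n) (at z n) (at q n) (at (q ^ i) n))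
        (cong (λ e → e ⊕ (⊝ (at (inv z z#0 * q) n ⊗ at (q ^ i) n))) (h n N≤n)))
      (boundedInverse-* (inv z z#0) (z - q ^ suc i) boundedInverse-w (positive⇒boundedInverse (z - q ^ suc i) (z#q^ (+ suc i))))

  boundedInverse-∏ : ∀ N f → (∀ i → BoundedInverse (f i)) → BoundedInverse (∏< N f)
  boundedInverse-∏ zero    f p = 1ℚ , 0 , λ n _ → 𝟙 , G.⊗-identityˡ 𝟙 , ℚ.≤-refl
  boundedInverse-∏ (suc N) f p = boundedInverse-* (f 0) (∏< N (λ i → f (suc i))) (p 0) (boundedInverse-∏ N (λ i → f (suc i)) (λ i → p (suc i)))

  boundedInverse-qPoch : ∀ a → (∀ i → BoundedInverse (1ℂ - a * q ^ i)) → ∀ N → BoundedInverse (qPoch a q N)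
  boundedInverse-qPoch a p N = boundedInverse-∏ N (λ i → 1ℂ - a * q ^ i) p

  denominator#0 : ∀ m → g₂-denominator z z#0 q m # 0ℂ
  denominator#0 m = boundedInverse⇒#0 (g₂-denominator z z#0 q m)
    (boundedInverse-* (qPoch z q (suc m)) (qPoch (inv z z#0 * q) q (suc m))
      (boundedInverse-qPoch z factor-z (suc m)) (boundedInverse-qPoch (inv z z#0 * q) factor-w (suc m)))

-- Convergence and the identity of the limits.

module Convergence (q z : ℂ) (z#0 : z # 0ℂ) {r b : ℚ} (S : Scale r b) where
  module S = Scale S
  open S using (2ℚ; 0<r; r<1)
  open InverseBounds q r 0<r r<1
  open Rationals using (0≤*; *-mono-≤; module Geometric) renaming (_^_ to _^ℚ_)

  record Good (n : ℕ) : Set where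
    field
      q≤ : modulus² (at q n) ℚ.≤ r ℚ.* r
      z≤ : norm (at z n) ℚ.≤ b
      w≤ : norm (at (inv z z#0) n) ℚ.≤ b
      zw : at z n ⊗ at (inv z z#0) n ≡ 𝟙
    open Powers (at q n) r 0<r r<1 q≤ public
    open MainEstimate G.normedRing S (at q n) (at z n) (at (inv z z#0) n) norm-^ z≤ w≤ zw public
    open Evaluation G.normedRing (at q n) (at z n) (at (inv z z#0) n) zw public using (hecke)

  good : Eventually (λ n → modulus² (at q n) ℚ.≤ r ℚ.* r) → Eventually (λ n → norm (at z n) ℚ.≤ b) →
    Eventually (λ n → norm (at (inv z z#0) n) ℚ.≤ b) → Eventually Good
  good q≤r z≤b w≤b =
    let N , h = eventually-× q≤r (eventually-× z≤b (eventually-× w≤b (inv-inverse z z#0)))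
    in N , λ n N≤n → let q≤ , z≤ , w≤ , wz = h n N≤n in record
      { q≤ = q≤ ; z≤ = z≤ ; w≤ = w≤ ; zw = trans (G.⊗-comm (at z n) (at (inv z z#0) n)) wz }

  0≤b2 : 0ℚ ℚ.≤ b ℚ.* 2ℚ
  0≤b2 = 0≤* S.0≤b S.0≤2

  decay-z : ∀ n → Good n → ∀ i → norm (at z n ⊗ (at q n L.^ i)) ℚ.≤ b ℚ.* 2ℚ ℚ.* r ^ℚ i
  decay-z n g = Good.scaled-q^≤ g (at z n) (Good.z≤ g)

  decay-w : ∀ n → Good n → ∀ i → norm (at (inv z z#0 * q) n ⊗ (at q n L.^ i)) ℚ.≤ b ℚ.* 2ℚ ℚ.* r ^ℚ i
  decay-w n g = Good.scaled-q*q^≤ g (at (inv z z#0) n) (Good.w≤ g)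

  module WithInverses (q#0 : q # 0ℂ) (denominator#0 : ∀ m → g₂-denominator z z#0 q m # 0ℂ)
    (βz βw : ℚ) (0≤βz : 0ℚ ℚ.≤ βz) (0≤βw : 0ℚ ℚ.≤ βw)
    (eventually : Eventually (λ n → Good n × (∀ i → Invertible z βz n i) × (∀ i → Invertible (inv z z#0 * q) βw n i))) where

    open Geometric r 0<r r<1 using (Majorant; majorant)
    mz : Majorant βz
    mz = majorant βz 0≤βz
    mw : Majorant βw
    mw = majorant βw 0≤βw
    mb : Majorant (b ℚ.* 2ℚ)
    mb = majorant (b ℚ.* 2ℚ) 0≤b2

    Cv : ℚ
    Cv = Majorant.bound mz 0 ℚ.* Majorant.bound mw 0

    v : ℕ → ℕ → ℚ[i]
    v n m = reciprocalᴷ (at (g₂-denominator z z#0 q m) n)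

    g₂-term : ℕ → ℂ
    g₂-term m = g₂-numerator q m /[ g₂-denominator z z#0 q m , denominator#0 m ]

    module AtIndex (n : ℕ) (good-n : Good n) (iz : ∀ i → Invertible z βz n i) (iw : ∀ i → Invertible (inv z z#0 * q) βw n i) where
      open Good good-n
      open L.Coefficients (at q n) using (poch; u; u≡poch)

      at-denominator : ∀ m → at (g₂-denominator z z#0 q m) n ≡ poch (at z n) (suc m) ⊗ poch (at (inv z z#0) n ⊗ at q n) (suc m)
      at-denominator m = cong₂ _⊗_ (at-qPoch z q (suc m) n) (at-qPoch (inv z z#0 * q) q (suc m) n)

      -- By uniqueness the reciprocal of the denominator is a product of two bounded inverses, so
      -- `Cv` holds for every m and every admissible n.
      v-facts : ∀ m → v n m ⊗ (poch (at z n) (suc m) ⊗ poch (at (inv z z#0) n ⊗ at q n) (suc m)) ≡ 𝟙 × norm (v n m) ℚ.≤ Cv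
      v-facts m =
        let a , a-inv , a≤ = inverse-product mz (at z n) iz (suc m)
            c , c-inv , c≤ = inverse-product mw (at (inv z z#0) n ⊗ at q n) iw (suc m)
            P = poch (at z n) (suc m)
            Q = poch (at (inv z z#0) n ⊗ at q n) (suc m)
            ac-inv : (a ⊗ c) ⊗ (P ⊗ Q) ≡ 𝟙
            ac-inv = trans (L.solve 4 (λ a c P Q → (a L.:* c) L.:* (P L.:* Q) L.:= (a L.:* P) L.:* (c L.:* Q)) refl a c P Q)
              (trans (cong₂ _⊗_ a-inv c-inv) (G.⊗-identityˡ 𝟙))
            v≡ac : v n m ≡ a ⊗ c
            v≡ac = trans (cong reciprocalᴷ (at-denominator m)) (reciprocal-unique {P ⊗ Q} {a ⊗ c} ac-inv)
        in trans (cong (_⊗ (P ⊗ Q)) v≡ac) ac-inv ,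
           ℚ.≤-trans (ℚ.≤-reflexive (cong norm v≡ac)) (ℚ.≤-trans (G.norm-⊗ a c)
             (*-mono-≤ (NormedRing.‖‖-nonNeg G.normedRing a) a≤ (NormedRing.‖‖-nonNeg G.normedRing c) c≤))

      at-numerator : ∀ m → at (g₂-numerator q m) n ≡ u m
      at-numerator m = trans (cong₂ _⊗_ (at-qPoch (- q) q m n) (trans (at-^ q (m ℕ.* suc m ℕ./ 2) n)
        (cong (at q n L.^_) (n[1+n]/2≡triangular m)))) (sym (u≡poch m))

      at-g₂-term : ∀ m → at (g₂-term m) n ≡ u m ⊗ v n m
      at-g₂-term m = cong₂ _⊗_ (at-numerator m) (at-inv (g₂-denominator z z#0 q m) (denominator#0 m) n)

      at-hecke-term : ∀ m → at (hecke-term z z#0 q q#0 m) n ≡ hecke m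
      at-hecke-term m = cong₂ _⊕_
        (trans (at-∑ (suc (m ℕ./ 2)) term⁺ n) (trans (cong (λ j → L.∑ (suc j) (λ i → at (term⁺ i) n)) (n/2≡⌊n/2⌋ m))
          (L.∑-cong (suc ⌊ m /2⌋) (λ i i<1+m/2 → term⁺≡ i (m≤⌊n/2⌋⇒m+m≤n (ℕ.≤-pred i<1+m/2))))))
        (trans (at-∑ (m ℕ./ 2) term⁻ n) (trans (cong (λ j → L.∑ j (λ k → at (term⁻ k) n)) (n/2≡⌊n/2⌋ m))
          (L.∑-cong ⌊ m /2⌋ (λ k k<m/2 → term⁻≡ k (m≤⌊n/2⌋⇒m+m≤n k<m/2)))))
        where
        term⁺ term⁻ : ℕ → ℂ
        term⁺ i = (- 1ℂ) ^ (i ℕ.+ m) * zpow z z#0 (m ⊖ 2 ℕ.* i) * zpow q q#0 (hecke-exponent m i)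
        term⁻ k = (- 1ℂ) ^ (suc k ℕ.+ m) * zpow z z#0 (2 ℕ.* suc k ⊖ suc m) * zpow q q#0 (hecke-exponent m (suc k))
        2*i : ∀ i → 2 ℕ.* i ≡ i ℕ.+ i
        2*i i = cong (i ℕ.+_) (ℕ.+-identityʳ i)
        exponent : ∀ i → i ℕ.+ i ℕ.≤ m → hecke-exponent m i ≡ + (triangular m ℕ.∸ i ℕ.* i)
        exponent i i+i≤m = trans (cong (_⊖ (i ℕ.* i)) (n[1+n]/2≡triangular m))
          (ℤ.⊖-≥ (subst (λ j → i ℕ.* i ℕ.≤ triangular j) (ℕ.m∸n+n≡m i+i≤m) (square≤triangular i (m ℕ.∸ (i ℕ.+ i)))))
        q-power : ∀ i → i ℕ.+ i ℕ.≤ m → at (zpow q q#0 (hecke-exponent m i)) n ≡ at q n L.^ (triangular m ℕ.∸ i ℕ.* i)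
        q-power i i+i≤m = trans (cong (λ e → at (zpow q q#0 e) n) (exponent i i+i≤m)) (at-^ q (triangular m ℕ.∸ i ℕ.* i) n)
        term⁺≡ : ∀ i → i ℕ.+ i ℕ.≤ m → at (term⁺ i) n ≡ ((⊝ 𝟙) L.^ (i ℕ.+ m)) ⊗ (at z n L.^ (m ℕ.∸ (i ℕ.+ i))) ⊗ (at q n L.^ (triangular m ℕ.∸ i ℕ.* i))
        term⁺≡ i i+i≤m = cong₂ _⊗_ (cong₂ _⊗_ (at-^ (- 1ℂ) (i ℕ.+ m) n)
          (trans (cong (λ e → at (zpow z z#0 e) n) (trans (cong (m ⊖_) (2*i i)) (ℤ.⊖-≥ i+i≤m))) (at-^ z (m ℕ.∸ (i ℕ.+ i)) n)))
          (q-power i i+i≤m)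
        term⁻≡ : ∀ k → suc k ℕ.+ suc k ℕ.≤ m →
          at (term⁻ k) n ≡ ((⊝ 𝟙) L.^ (suc k ℕ.+ m)) ⊗ (at (inv z z#0) n L.^ suc (m ℕ.∸ (suc k ℕ.+ suc k))) ⊗ (at q n L.^ (triangular m ℕ.∸ suc k ℕ.* suc k))
        term⁻≡ k 2+2k≤m = cong₂ _⊗_ (cong₂ _⊗_ (at-^ (- 1ℂ) (suc k ℕ.+ m) n)
          (trans (cong (λ e → at (zpow z z#0 e) n) negative) (at-^ (inv z z#0) (suc (m ℕ.∸ (suc k ℕ.+ suc k))) n)))
          (q-power (suc k) 2+2k≤m)
          where
          negative : 2 ℕ.* suc k ⊖ suc m ≡ -[1+ m ℕ.∸ (suc k ℕ.+ suc k) ]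
          negative = trans (cong (_⊖ suc m) (2*i (suc k))) (trans (ℤ.⊖-< (ℕ.s≤s 2+2k≤m))
            (cong (λ e → ℤ.- (+ e)) (ℕ.+-∸-assoc 1 2+2k≤m)))

      g₂-term-bound : ∀ m → norm (at (g₂-term m) n) ℚ.≤ S.Cu ℚ.* Cv ℚ.* r ^ℚ m
      g₂-term-bound m = begin
        norm (at (g₂-term m) n)            ≡⟨ cong norm (at-g₂-term m) ⟩
        norm (u m ⊗ v n m)                 ≤⟨ G.norm-⊗ (u m) (v n m) ⟩
        norm (u m) ℚ.* norm (v n m)        ≤⟨ *-mono-≤ (0≤norm (u m)) (u-bound norm-^ m) (0≤norm (v n m)) (proj₂ (v-facts m)) ⟩
        S.Cu ℚ.* r ^ℚ m ℚ.* Cv             ≡⟨ Rationals.solve 3 (λ a s c → a Rationals.:* s Rationals.:* c Rationals.:= a Rationals.:* c Rationals.:* s) refl S.Cu (r ^ℚ m) Cv ⟩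
        S.Cu ℚ.* Cv ℚ.* r ^ℚ m             ∎
        where
        open ℚ.≤-Reasoning
        open Estimates G.normedRing S (at q n) using (u-bound)
        0≤norm = NormedRing.‖‖-nonNeg G.normedRing

      hecke-term-bound : ∀ m → norm (at (hecke-term z z#0 q q#0 m) n) ℚ.≤ S.Ch ℚ.* r ^ℚ m
      hecke-term-bound m = subst (λ e → norm e ℚ.≤ S.Ch ℚ.* r ^ℚ m) (sym (at-hecke-term m)) (hecke-bound m)

    open Limits r S.κ 0<r r<1 S.0≤κ S.κ-inv

    at-index : ∀ {P : ℕ → Set} → (∀ n (g : Good n) → (∀ i → Invertible z βz n i) → (∀ i → Invertible (inv z z#0 * q) βw n i) → P n) → Eventually P
    at-index f = proj₁ eventually , λ n h → let g , iz , iw = proj₂ eventually n h in f n g iz iw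

    qPoch-cauchy : ∀ a β (m : Majorant β) → (∀ n → Good n → ∀ i → norm (at a n ⊗ (at q n L.^ i)) ℚ.≤ β ℚ.* r ^ℚ i) →
      Geometric-Cauchy (qPoch a q) (Majorant.bound m 0 ℚ.* β)
    qPoch-cauchy a β m a≤ = at-index (λ n g iz iw N →
      subst (λ e → norm e ℚ.≤ Majorant.bound m 0 ℚ.* β ℚ.* r ^ℚ N)
        (sym (cong₂ L._-_ (at-qPoch a q (suc N) n) (at-qPoch a q N n)))
        (Good.poch-increment g m (at a n) (a≤ n g) N))

    ∑-cauchy : ∀ (f : ℕ → ℂ) B → Eventually (λ n → ∀ N → norm (at (f N) n) ℚ.≤ B ℚ.* r ^ℚ N) → Geometric-Cauchy (λ N → ∑< N f) B
    ∑-cauchy f B (K , h) = K , λ n K≤n N → subst (λ e → norm e ℚ.≤ B ℚ.* r ^ℚ N)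
      (sym (trans (cong₂ L._-_ (at-∑ (suc N) f n) (at-∑ N f n))
        (L.solve 2 (λ s x → s L.:+ x L.:- s L.:= x) refl (L.∑ N (λ i → at (f i) n)) (at (f N) n))))
      (h n K≤n N)

    0≤bound : ∀ {β} (m : Majorant β) → 0ℚ ℚ.≤ Majorant.bound m 0
    0≤bound m = Majorant.0≤bound m 0

    0≤CuCv : 0ℚ ℚ.≤ S.Cu ℚ.* Cv
    0≤CuCv = 0≤* S.0≤Cu (0≤* (0≤bound mz) (0≤bound mw))

    cauchy-A : Geometric-Cauchy (qPoch (z * q) q) (Majorant.bound mb 0 ℚ.* (b ℚ.* 2ℚ))
    cauchy-A = qPoch-cauchy (z * q) (b ℚ.* 2ℚ) mb (λ n g → Good.scaled-q*q^≤ g (at z n) (Good.z≤ g))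
    cauchy-B : Geometric-Cauchy (qPoch (inv z z#0 * q) q) (Majorant.bound mb 0 ℚ.* (b ℚ.* 2ℚ))
    cauchy-B = qPoch-cauchy (inv z z#0 * q) (b ℚ.* 2ℚ) mb (λ n g → Good.scaled-q*q^≤ g (at (inv z z#0) n) (Good.w≤ g))
    cauchy-C : Geometric-Cauchy (qPoch q q) (Majorant.bound S.majorant₂ 0 ℚ.* 2ℚ)
    cauchy-C = qPoch-cauchy q 2ℚ S.majorant₂ (λ n g → Good.q*q^≤ g)
    cauchy-G : Geometric-Cauchy (λ N → ∑< N g₂-term) (S.Cu ℚ.* Cv)
    cauchy-G = ∑-cauchy g₂-term (S.Cu ℚ.* Cv) (at-index AtIndex.g₂-term-bound)
    cauchy-S : Geometric-Cauchy (λ N → ∑< N (hecke-term z z#0 q q#0)) S.Ch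
    cauchy-S = ∑-cauchy (hecke-term z z#0 q q#0) S.Ch (at-index AtIndex.hecke-term-bound)

    0≤CA : 0ℚ ℚ.≤ Majorant.bound mb 0 ℚ.* (b ℚ.* 2ℚ)
    0≤CA = 0≤* (0≤bound mb) 0≤b2
    0≤CC : 0ℚ ℚ.≤ Majorant.bound S.majorant₂ 0 ℚ.* 2ℚ
    0≤CC = 0≤* (0≤bound S.majorant₂) S.0≤2

    A B C G S∞ : ℂ
    A = limit (qPoch (z * q) q) _ 0≤CA cauchy-A
    B = limit (qPoch (inv z z#0 * q) q) _ 0≤CA cauchy-B
    C = limit (qPoch q q) _ 0≤CC cauchy-C
    G = limit (λ N → ∑< N g₂-term) _ 0≤CuCv cauchy-G
    S∞ = limit (λ N → ∑< N (hecke-term z z#0 q q#0)) _ S.0≤Ch cauchy-S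

    -- The n-th entries of A, B, C, G and S∞ are, by construction of `limit`, the truncations at N =
    -- n taken at index n, so `main-bound` with N = n applies verbatim.
    identity : (1ℂ - z) * (A * B * C) * G ≃ S∞
    identity = vanishing⇒≃ ((1ℂ - z) * (A * B * C) * G) S∞ S.Cmain S.0≤Cmain (at-index bound)
      where
      bound : ∀ n (g : Good n) → (∀ i → Invertible z βz n i) → (∀ i → Invertible (inv z z#0 * q) βw n i) →
        norm (at ((1ℂ - z) * (A * B * C) * G) n L.- at S∞ n) ℚ.≤ S.Cmain ℚ.* r ^ℚ n
      bound n g iz iw = subst (λ e → norm e ℚ.≤ S.Cmain ℚ.* r ^ℚ n)
        (sym (cong₂ L._-_
          (cong₂ (λ p s → ((𝟙 ⊕ (⊝ at z n)) ⊗ p) ⊗ s)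
            (cong₂ _⊗_ (cong₂ _⊗_ (at-qPoch (z * q) q n n) (at-qPoch (inv z z#0 * q) q n n)) (at-qPoch q q n n))
            (trans (at-∑ n g₂-term n) (L.∑-cong n (λ m _ → at-g₂-term m))))
          (trans (at-∑ n (hecke-term z z#0 q q#0) n) (L.∑-cong n (λ m _ → at-hecke-term m)))))
        (Good.main-bound g (λ i {a} {c} → Good.1-u^-cancel g i {a} {c}) (v n) (λ m → proj₁ (v-facts m)) n)
        where open AtIndex n g iz iw

    result : ∃[ A ] ∃[ B ] ∃[ C ] ∃[ G ] ∃[ S ]
      ( IsQPoch∞ (z * q) q A × IsQPoch∞ (inv z z#0 * q) q B × IsQPoch∞ q q C
      × Isg₂ z z#0 q G × HasSum (hecke-term z z#0 q q#0) S × (1ℂ - z) * (A * B * C) * G ≃ S )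
    result = A , B , C , G , S∞
      , limit-converges (qPoch (z * q) q) _ 0≤CA cauchy-A
      , limit-converges (qPoch (inv z z#0 * q) q) _ 0≤CA cauchy-B
      , limit-converges (qPoch q q) _ 0≤CC cauchy-C
      , (denominator#0 , limit-converges (λ N → ∑< N g₂-term) _ 0≤CuCv cauchy-G)
      , limit-converges (λ N → ∑< N (hecke-term z z#0 q q#0)) _ S.0≤Ch cauchy-S
      , identity

theorem1p2 : (q z : ℂ) (q#0 : q # 0ℂ) → ∣ q ∣< 1ℚ →
    (z#0 : z # 0ℂ) → (∀ (m : ℤ) → z # zpow q q#0 m) →
    ∃[ A ] ∃[ B ] ∃[ C ] ∃[ G ] ∃[ S ]
    ( IsQPoch∞ (z * q) q A
    × IsQPoch∞ (inv z z#0 * q) q B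
    × IsQPoch∞ q q C
    × Isg₂ z z#0 q G
    × HasSum (hecke-term z z#0 q q#0) S
    × (1ℂ - z) * (A * B * C) * G ≃ S )
theorem1p2 q z q#0 ∣q∣<1 z#0 z#q^ =
  let open Denominators q z q#0 z#0 z#q^
      r , 0<r , r<1 , q≤r = radius q ∣q∣<1
      Bz , 0≤Bz , M , z≤ = bounded z
      Bw , 0≤Bw , N , w≤ = bounded (inv z z#0)
      -- The summand 1 secures b ≥ 1 and hence y ≤ 1/2; one b has to bound both z and 1/z.
      b = 1ℚ ℚ.+ (Bz ℚ.+ Bw)
      S = scale r b 0<r r<1 (Rationals.≤+ (Rationals.0≤+ 0≤Bz 0≤Bw))
      open Convergence q z z#0 S
      good-n = good q≤r
        (M , λ n M≤n → ℚ.≤-trans (z≤ n M≤n) (ℚ.≤-trans (Rationals.≤+ 0≤Bw) (Rationals.+≤ Rationals.0≤1)))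
        (N , λ n N≤n → ℚ.≤-trans (w≤ n N≤n) (ℚ.≤-trans (Rationals.+≤ 0≤Bz) (Rationals.+≤ Rationals.0≤1)))
      open InverseBounds q r 0<r r<1
      βz , 0≤βz , iz = all-invertible z (b ℚ.* Scale.2ℚ S) 0≤b2
        (proj₁ good-n , λ n h → decay-z n (proj₂ good-n n h)) factor-z
      βw , 0≤βw , iw = all-invertible (inv z z#0 * q) (b ℚ.* Scale.2ℚ S) 0≤b2
        (proj₁ good-n , λ n h → decay-w n (proj₂ good-n n h)) factor-w
  in WithInverses.result q#0 denominator#0 βz βw 0≤βz 0≤βw (eventually-× good-n (eventually-× iz iw))
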